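{- Let $d\ge4$ be an integer, put $a=\lfloor (d-4)/2\rfloor$, $b=\lceil (d-4)/2\rceil$, $\gamma=(a,0,b,0)\in\mathbb N^4$, and for $f\in\mathcal L_{4,d}^+$ with normalized coefficients $c_\alpha$ let $$R_d(f)=\frac{c_{\gamma+(1,0,3,0)}\,c_{\gamma+(3,0,1,0)}\,c_{\gamma+(0,2,0,2)}}{c_{\gamma+(2,0,2,0)}\,c_{\gamma+(1,0,1,2)}\,c_{\gamma+(1,2,1,0)}}.$$ Let $w_d\in\mathbb R^{\Delta_4^d}$ be the exponent vector of $R_d$ (entry $+1$ at the three numerator indices, $-1$ at the three denominator indices, $0$ elsewhere). Let $\mu_d(s)=\min\{s,d-s\}$ for $0\le s\le d$, let $\alpha^*=\gamma+(2,0,2,0)$, let $\epsilon_d=2$ if $d$ is even and $\epsilon_d=1$ if $d$ is odd, and define $q_d\in\mathbb R^{\Delta_4^d}$ by $$q_d(\alpha)=\mu_d(\alpha_2+\alpha_3)+\mu_d(\alpha_3+\alpha_4)-\epsilon_d\,\mathbf 1_{\{\alpha=\alpha^*\}}.$$ Then $$w_d\in\operatorname{BR}(\mathcal L_{4,d}^+)\setminus\operatorname{Cone}\bigl(\mathcal G_4(\Delta_4^d)\bigr).$$ More precisely, $R_d(f)\le 64$ for every $f\in\mathcal L_{4,d}^+$, and $$\langle w_d,q_d\rangle=\epsilon_d>0,\qquad q_d\in\operatorname{Cone}\bigl(\mathcal G_4(\Delta_4^d)\bigr)^\circ.$$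
   Context: Notation: $\mathbb N=\mathbb Z_{\ge0}$, $[n]=\{1,\dots,n\}$, $e_i$ is the $i$-th standard basis vector of $\mathbb R^n$; for $\alpha\in\mathbb N^n$, $|\alpha|=\alpha_1+\cdots+\alpha_n$, $\alpha!=\alpha_1!\cdots\alpha_n!$, and $\mathbf x^\alpha=x_1^{\alpha_1}\cdots x_n^{\alpha_n}$; $\Delta_n^d=\{\alpha\in\mathbb N^n:|\alpha|=d\}$. For a finite set $S$, $\varepsilon_\alpha$ ($\alpha\in S$) denotes the standard basis of $\mathbb R^S$, and $\langle w,q\rangle=\sum_{\alpha\in S}w_\alpha q_\alpha$ (with $q_\alpha=q(\alpha)$). $\operatorname{Cone}(E)$ is the set of finite nonnegative linear combinations of elements of $E$. The polar of $C\subseteq\mathbb R^S$ is $C^\circ=\{q\in\mathbb R^S:\langle w,q\rangle\le0\text{ for all }w\in C\}$. A nonempty set $S\subseteq\Delta_n^d$ is $M$-convex if, whenever $\alpha,\beta\in S$ and $\alpha_i>\beta_i$, there is $j$ with $\alpha_j<\beta_j$ such that $\alpha-e_i+e_j\in S$ and $\beta-e_j+e_i\in S$. Lorentzian polynomials: for $d\ge2$, a polynomial $f=\sum_{\alpha\in\Delta_n^d}c_\alpha\,\mathbf x^\alpha/\alpha!$ with all $c_\alpha\ge0$, not identically zero, is Lorentzian if and only if its support $\{\alpha:c_\alpha\ne0\}$ is $M$-convex and for every $\beta\in\Delta_n^{d-2}$ the symmetric matrix $H_\beta(f)=(c_{\beta+e_i+e_j})_{1\le i,j\le n}$ (the Hessian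 of $\partial^\beta f$) has at most one positive eigenvalue. The numbers $c_\alpha$ are called the normalized coefficients of $f$. For an $M$-convex $S\subseteq\Delta_n^d$, $\mathcal L_S^+$ is the set of Lorentzian polynomials whose normalized coefficients $c_\alpha$ are positive exactly for $\alpha\in S$; $\mathcal L_{n,d}^+:=\mathcal L_{\Delta_n^d}^+$. For $w\in\mathbb R^S$ and $f\in\mathcal L_S^+$ put $R_w(f)=\prod_{\alpha\in S}c_\alpha^{w_\alpha}$, and $\operatorname{BR}(\mathcal L_S^+)=\{w\in\mathbb R^S:\sup_{f\in\mathcal L_S^+}R_w(f)<\infty\}$. Quadratic local generators: for $\beta\in\Delta_n^{d-2}$ let $S_\beta=\{e_i+e_j:i,j\in[n],\ \beta+e_i+e_j\in S\}\subseteq\Delta_n^2$ (which is $M$-convex whenever nonempty; for $S=\Delta_n^d$ it is $\Delta_n^2$). For $v\in\mathbb R^{S_\beta}$ let $\widetilde v^{\,\beta}=\sum_{\gamma\in S_\beta}v_\gamma\varepsilon_{\beta+\gamma}\in\mathbb R^S$. Then $\mathcal G_n(S)=\bigcup_{\beta\in\Delta_n^{d-2},\,S_\beta\ne\varnothing}\{\widetilde v^{\,\beta}:v\in\operatorname{BR}(\mathcal L_{S_\beta}^+)\}$. -}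

module Defs where

open import Algebra.Bundles using (CommutativeRing; Semiring)
import Algebra.Definitions.RawSemiring as RawSemiringDefinitions
open import Data.Bool using (Bool; T; if_then_else_)
open import Data.Fin using (Fin)
open import Data.Fin.Patterns using (1F; 2F; 3F)
import Data.Fin as Fin
import Data.Fin.Properties as Fin
open import Data.List using (List; []; _∷_; map; concatMap; upTo; filterᵇ; foldr)
open import Data.Nat as ℕ using (ℕ; zero; suc; _∸_; _⊓_; ⌊_/2⌋; ⌈_/2⌉; _≡ᵇ_)
open import Data.Nat.DivMod using (_%_)
import Data.Nat.Properties as ℕ
open import Data.Nat.Solver using (module +-*-Solver)
open import Data.Product using (_×_; _,_; ∃; ∃-syntax; Σ-syntax)
open import Data.Sum using (_⊎_)
open import Data.Vec as Vec using (Vec; []; _∷_; lookup; replicate; zipWith; _[_]≔_)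
open import Data.Vec.Properties using (≡-dec)
open import Function using (_⇔_)
open import Level using (0ℓ)
open import Relation.Binary.Core using (Rel)
import Relation.Binary.Construct.NonStrictToStrict as NonStrictToStrict
open import Relation.Binary.Structures using (IsTotalOrder)
open import Relation.Binary.PropositionalEquality using (_≡_; refl; trans; cong; cong₂)
open import Relation.Nullary using (¬_; Dec)
open import Relation.Nullary.Decidable using (⌊_⌋; _×-dec_; T?; toWitness)
open import Relation.Unary using (Pred)

------------------------------------------------------------------------
-- The real numbers

-- A Dedekind-complete ordered field; classically these axioms determine
-- ℝ up to isomorphism.  As usual, _⁻¹ and sup are total operations whose
-- values are specified only at nonzero elements and at nonempty bounded
-- above sets, respectively.

record CompleteOrderedField : Set₁ where
  field
    commutativeRing : CommutativeRing 0ℓ 0ℓ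

  open CommutativeRing commutativeRing public
    hiding (refl; sym; trans)

  infix  4 _≤_
  infix  8 _⁻¹

  field
    _≤_          : Rel Carrier 0ℓ
    isTotalOrder : IsTotalOrder _≈_ _≤_
    1≉0          : ¬ (1# ≈ 0#)
    +-monoʳ-≤    : ∀ x {y z} → y ≤ z → x + y ≤ x + z
    *-nonNeg     : ∀ {x y} → 0# ≤ x → 0# ≤ y → 0# ≤ x * y
    _⁻¹          : Carrier → Carrier
    *-inverseʳ   : ∀ x → ¬ (x ≈ 0#) → x * x ⁻¹ ≈ 1#

  UpperBound : Pred Carrier 0ℓ → Pred Carrier 0ℓ
  UpperBound P u = ∀ x → P x → x ≤ u

  field
    sup       : Pred Carrier 0ℓ → Carrier
    sup-upper : ∀ P → ∃ P → ∃ (UpperBound P) → UpperBound P (sup P)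
    sup-least : ∀ P → ∃ P → ∃ (UpperBound P) →
                ∀ u → UpperBound P u → sup P ≤ u

  open NonStrictToStrict _≈_ _≤_ public using (_<_)
  open RawSemiringDefinitions (Semiring.rawSemiring semiring) public
    using (_^_; sum) renaming (_×_ to _·_)

  fromℕ : ℕ → Carrier
  fromℕ n = n · 1#

  -- y is the rational power a ^ ((p - q) / (k + 1)), with exponent at
  -- most x if a ≥ 1, and at least x if a ≤ 1.
  RationalPower : (a x y : Carrier) → Set
  RationalPower a x y = ∃[ p ] ∃[ q ] ∃[ k ]
    (0# ≤ y) × (y ^ suc k * a ^ q ≈ a ^ p) ×
    (((1# ≤ a) × (fromℕ p ≤ fromℕ q + fromℕ (suc k) * x)) ⊎
     ((a ≤ 1#) × (fromℕ q + fromℕ (suc k) * x ≤ fromℕ p)))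

  -- The real power a ^ x, meaningful for a > 0.
  pow : Carrier → Carrier → Carrier
  pow a x = sup (RationalPower a x)

------------------------------------------------------------------------
-- Multi-indices

infixl 6 _⊕_ _⊖_

_⊕_ : ∀ {n} → Vec ℕ n → Vec ℕ n → Vec ℕ n
_⊕_ = zipWith ℕ._+_

-- Truncated subtraction, only used where the difference is nonnegative.
_⊖_ : ∀ {n} → Vec ℕ n → Vec ℕ n → Vec ℕ n
_⊖_ = zipWith _∸_

e : ∀ {n} → Fin n → Vec ℕ n
e i = replicate _ 0 [ i ]≔ 1

_≟_ : ∀ {n} (α β : Vec ℕ n) → Dec (α ≡ β)
_≟_ = ≡-dec ℕ._≟_

∣_∣ : ∀ {n} → Vec ℕ n → ℕ
∣ α ∣ = Vec.sum α

-- All α ∈ ℕⁿ with ∣ α ∣ ≡ d, each listed once.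
multiIndices : (n d : ℕ) → List (Vec ℕ n)
multiIndices zero    zero    = [] ∷ []
multiIndices zero    (suc d) = []
multiIndices (suc n) d       =
  concatMap (λ k → map (k ∷_) (multiIndices n (d ∸ k))) (upTo (suc d))

-- A subset of Δₙᵈ.
record Subset (n d : ℕ) : Set where
  field
    mem    : Vec ℕ n → Bool
    degree : ∀ α → T (mem α) → ∣ α ∣ ≡ d

open Subset public

infix 4 _∈_

_∈_ : ∀ {n d} → Vec ℕ n → Subset n d → Set
α ∈ S = T (mem S α)

elements : ∀ {n d} → Subset n d → List (Vec ℕ n)
elements {n} {d} S = filterᵇ (mem S) (multiIndices n d)

Δ : (n d : ℕ) → Subset n d
Δ n d = record
  { mem    = λ α → ∣ α ∣ ≡ᵇ d
  ; degree = λ α → ℕ.≡ᵇ⇒≡ ∣ α ∣ d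
  }

∣⊕∣ : ∀ {n} (α β : Vec ℕ n) → ∣ α ⊕ β ∣ ≡ ∣ α ∣ ℕ.+ ∣ β ∣
∣⊕∣ []      []      = refl
∣⊕∣ (a ∷ α) (b ∷ β) = trans (cong ((a ℕ.+ b) ℕ.+_) (∣⊕∣ α β))
  (solve 4 (λ a b x y → (a :+ b) :+ (x :+ y) := (a :+ x) :+ (b :+ y))
    refl a b ∣ α ∣ ∣ β ∣)
  where open +-*-Solver

∣0∣ : ∀ n → ∣ replicate n 0 ∣ ≡ 0
∣0∣ zero    = refl
∣0∣ (suc n) = ∣0∣ n

∣e∣ : ∀ {n} (i : Fin n) → ∣ e i ∣ ≡ 1
∣e∣ {suc n} Fin.zero    = cong suc (∣0∣ n)
∣e∣ {suc n} (Fin.suc i) = ∣e∣ i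

-- S_β = { eᵢ + eⱼ : β + eᵢ + eⱼ ∈ S }
localSubset : ∀ {n d} → Subset n d → Vec ℕ n → Subset n 2
localSubset {n} S β = record
  { mem    = λ γ → ⌊ local? γ ⌋
  ; degree = λ γ p → degree′ γ (toWitness {a? = local? γ} p)
  }
  where
  Local : Vec ℕ n → Set
  Local γ = ∃[ i ] ∃[ j ] (γ ≡ e i ⊕ e j) × (β ⊕ e i ⊕ e j ∈ S)

  local? : ∀ γ → Dec (Local γ)
  local? γ = Fin.any? λ i → Fin.any? λ j →
    (γ ≟ (e i ⊕ e j)) ×-dec T? (mem S (β ⊕ e i ⊕ e j))

  degree′ : ∀ γ → Local γ → ∣ γ ∣ ≡ 2
  degree′ _ (i , j , refl , _) =
    trans (∣⊕∣ (e i) (e j)) (cong₂ ℕ._+_ (∣e∣ i) (∣e∣ j))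

MConvex : ∀ {n} → Pred (Vec ℕ n) 0ℓ → Set
MConvex S = ∃ S × (∀ α β → S α → S β → ∀ i → lookup β i ℕ.< lookup α i →
  ∃[ j ] (lookup α j ℕ.< lookup β j) ×
         S (α ⊖ e i ⊕ e j) × S (β ⊖ e j ⊕ e i))

------------------------------------------------------------------------
-- Lorentzian polynomials and bounded ratios

module Lorentzian (R : CompleteOrderedField) where

  open CompleteOrderedField R

  Matrix : ℕ → Set
  Matrix n = Fin n → Fin n → Carrier

  record Eigenpair {n} (H : Matrix n) (l : Carrier) (u : Fin n → Carrier) : Set where
    field
      nonzero : ∃[ i ] ¬ (u i ≈ 0#)
      eigen   : ∀ i → sum (λ j → H i j * u j) ≈ l * u i

  -- Eigenvalues are counted with multiplicity: eigenvectors for positive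
  -- eigenvalues, equal or not, are always proportional.  For the symmetric
  -- matrices considered here, the multiplicity of an eigenvalue is the
  -- dimension of its eigenspace.
  AtMostOnePositiveEigenvalue : ∀ {n} → Matrix n → Set
  AtMostOnePositiveEigenvalue H = ∀ l m u v →
    0# < l → 0# < m → Eigenpair H l u → Eigenpair H m v →
    ∃[ s ] ∃[ t ] (¬ (s ≈ 0#) ⊎ ¬ (t ≈ 0#)) ×
                  (∀ i → s * u i + t * v i ≈ 0#)

  -- A function on multi-indices.  It serves both as the family of
  -- normalized coefficients c_α of a polynomial ∑ c_α x^α / α!, and as a
  -- vector in ℝ^S, where only its values on S are relevant.
  Family : ℕ → Set
  Family n = Vec ℕ n → Carrier

  hessian : ∀ {n} → Family n → Vec ℕ n → Matrix n
  hessian c β i j = c (β ⊕ e i ⊕ e j)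

  -- For d ≥ 2.
  record IsLorentzian (n d : ℕ) (c : Family n) : Set where
    field
      homogeneous : ∀ α → ¬ (∣ α ∣ ≡ d) → c α ≈ 0#
      nonNeg      : ∀ α → 0# ≤ c α
      nonzero     : ∃[ α ] ¬ (c α ≈ 0#)
      mConvex     : MConvex (λ α → ¬ (c α ≈ 0#))
      signature   : ∀ β → β ∈ Δ n (d ∸ 2) →
                    AtMostOnePositiveEigenvalue (hessian c β)

  𝓛⁺ : ∀ {n d} → Subset n d → Pred (Family n) 0ℓ
  𝓛⁺ {n} {d} S c = IsLorentzian n d c × (∀ α → 0# < c α ⇔ α ∈ S)

  ∑ : List Carrier → Carrier
  ∑ = foldr _+_ 0#

  ∏ : List Carrier → Carrier
  ∏ = foldr _*_ 1#

  ratio : ∀ {n d} → Subset n d → Family n → Family n → Carrier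
  ratio S w c = ∏ (map (λ α → pow (c α) (w α)) (elements S))

  BR : ∀ {n d} → Subset n d → Pred (Family n) 0ℓ
  BR S w = ∃[ M ] (∀ c → 𝓛⁺ S c → ratio S w c ≤ M)

  inner : ∀ {n d} → Subset n d → Family n → Family n → Carrier
  inner S w q = ∑ (map (λ α → w α * q α) (elements S))

  Cone : ∀ {n d} → Subset n d → Pred (Family n) 0ℓ → Pred (Family n) 0ℓ
  Cone {n} S E w = ∃[ m ] Σ[ a ∈ (Fin m → Carrier) ] Σ[ g ∈ (Fin m → Family n) ]
    (∀ k → (0# ≤ a k) × E (g k)) ×
    (∀ α → α ∈ S → w α ≈ sum (λ k → a k * g k α))

  Polar : ∀ {n d} → Subset n d → Pred (Family n) 0ℓ → Pred (Family n) 0ℓ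
  Polar S C q = ∀ w → C w → inner S w q ≤ 0#

  -- The standard basis vector at α.
  basis : ∀ {n} → Vec ℕ n → Family n
  basis α α′ = if ⌊ α ≟ α′ ⌋ then 1# else 0#

  extend : ∀ {n d} → Subset n d → Vec ℕ n → Family n → Family n
  extend S β v α =
    ∑ (map (λ γ → v γ * basis (β ⊕ γ) α) (elements (localSubset S β)))

  𝓖 : ∀ {n d} → Subset n d → Pred (Family n) 0ℓ
  𝓖 {n} {d} S g = ∃[ β ] (β ∈ Δ n (d ∸ 2)) × (∃[ γ ] γ ∈ localSubset S β) ×
    ∃[ v ] BR (localSubset S β) v × (∀ α → α ∈ S → g α ≈ extend S β v α)

  ----------------------------------------------------------------------
  -- The ratio R_d, its exponent vector w_d and the separating vector q_d

  base : ℕ → Vec ℕ 4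
  base d = ⌊ d ∸ 4 /2⌋ ∷ 0 ∷ ⌈ d ∸ 4 /2⌉ ∷ 0 ∷ []

  α* : ℕ → Vec ℕ 4
  α* d = base d ⊕ (2 ∷ 0 ∷ 2 ∷ 0 ∷ [])

  numerator : ℕ → List (Vec ℕ 4)
  numerator d = map (base d ⊕_)
    ( (1 ∷ 0 ∷ 3 ∷ 0 ∷ [])
    ∷ (3 ∷ 0 ∷ 1 ∷ 0 ∷ [])
    ∷ (0 ∷ 2 ∷ 0 ∷ 2 ∷ [])
    ∷ [])

  denominator : ℕ → List (Vec ℕ 4)
  denominator d = map (base d ⊕_)
    ( (2 ∷ 0 ∷ 2 ∷ 0 ∷ [])
    ∷ (1 ∷ 0 ∷ 1 ∷ 2 ∷ [])
    ∷ (1 ∷ 2 ∷ 1 ∷ 0 ∷ [])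
    ∷ [])

  R[_] : ℕ → Family 4 → Carrier
  R[ d ] c = ∏ (map c (numerator d)) * ∏ (map c (denominator d)) ⁻¹

  -- The six indices are pairwise distinct.
  w[_] : ℕ → Family 4
  w[ d ] α = ∑ (map (λ η → basis η α) (numerator d))
           - ∑ (map (λ η → basis η α) (denominator d))

  μ : ℕ → ℕ → ℕ
  μ d s = s ⊓ (d ∸ s)

  ε : ℕ → ℕ
  ε d = if d % 2 ≡ᵇ 0 then 2 else 1

  q[_] : ℕ → Family 4
  q[ d ] α =
    fromℕ (μ d (lookup α 1F ℕ.+ lookup α 2F) ℕ.+ μ d (lookup α 2F ℕ.+ lookup α 3F))
    - fromℕ (ε d) * basis (α* d) α

{-# OPTIONS --safe #-}
module Submission where

-- The bound.  A symmetric matrix with at most one positive eigenvalue is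
-- negative on the hyperplane orthogonal to its top eigenvector, which gives
-- reverse Cauchy–Schwarz.  On suitable test vectors this says, for a
-- positive Hessian H, that Hᵢᵢ Hⱼₖ ≤ 2 Hᵢⱼ Hᵢₖ and that Hᵢₖ Hⱼₗ is at most
-- 4 Hᵢⱼ Hₖₗ or at most 4 Hᵢₗ Hⱼₖ.  In either branch of the second
-- inequality at γ + e₂ + e₄, multiplying by four instances of the first
-- cancels to R_d ≤ 4 · 2⁴.
--
-- The separation.  If m : Δ₄² → ℕ is such that the forms with normalized
-- coefficients t^m are Lorentzian for all t ≥ 1, then ⟨v, m⟩ ≤ 0 for every
-- bounded ratio v, by letting t → ∞.  This applies to m(γ) = γᵢ and to the
-- cut functions [γ(X) = 1], where the Hessian is u uᵀ − (t² − 1) v vᵀ.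
-- Restricted to any β + Δ₄², the function μ_d(α₂+α₃) + μ_d(α₃+α₄) is a
-- nonnegative combination of these.  Subtracting ε_d at α* only matters
-- for three β.  For β = α* − e₁ − e₃ it uses the identity
--   cut{2,3} + cut{3,4} − 2·1_{e₁+e₃} = cut{2} + cut{4}  on Δ₄²,
-- and for β = α* − 2eᵢ the identity γᵢ = 2·1_{2eᵢ} + cut{i}.

open import Defs
open import Level using (0ℓ)
open import Algebra.Bundles using (CommutativeMonoid; CommutativeRing)
import Algebra.Properties.CommutativeSemiring.Exp as Exp
import Algebra.Properties.Ring as RingProperties
import Algebra.Properties.Semiring.Mult as SemiringMult
import Algebra.Properties.Semiring.Sum as SemiringSum
import Algebra.Solver.Ring
open import Algebra.Solver.Ring.AlmostCommutativeRing using (fromCommutativeRing; _-Raw-AlmostCommutative⟶_)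
open import Axiom.ExcludedMiddle using (ExcludedMiddle)
open import Data.Bool using (Bool; true; false; T; if_then_else_; not)
open import Data.Fin as Fin using (Fin; zero; suc)
open import Data.Fin.Patterns using (0F; 1F; 2F; 3F)
import Data.Fin.Properties as Fin
open import Data.Integer as ℤ using (ℤ; +_; -[1+_])
import Data.Integer.Properties as ℤ
open import Data.List using (List; []; _∷_; _++_; map; concatMap; upTo; applyUpTo; filterᵇ; foldr)
open import Data.List.Relation.Unary.All as All using (All; []; _∷_)
open import Data.Maybe using (Maybe; just; nothing)
open import Data.Nat as ℕ using (ℕ; zero; suc; _∸_; ⌊_/2⌋; ⌈_/2⌉) renaming (_≤_ to _≤ℕ_)
import Data.Nat.ListAction as List
import Data.Nat.Properties as ℕ
open import Algebra.Properties.CommutativeSemigroup ℕ.+-commutativeSemigroup using (interchange)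
open import Data.Nat.Solver using (module +-*-Solver)
open import Data.Product using (_×_; _,_; proj₁; proj₂; ∃; ∃-syntax)
open import Data.Sum using (_⊎_; inj₁; inj₂)
open import Data.Unit using (tt)
open import Data.Vec as Vec using (Vec; []; _∷_; lookup; replicate)
open import Data.Vec.Properties using (∷-injective; zipWith-assoc; zipWith-comm)
open import Function using (_∘_; id; Equivalence; mk⇔)
import Relation.Binary.Reasoning.Setoid as SetoidReasoning
open import Relation.Binary.PropositionalEquality as ≡ using (_≡_; _≢_)
open import Relation.Binary.Structures using (IsTotalOrder)
open import Relation.Nullary using (¬_; Dec; yes; no; contradiction)
open import Relation.Nullary.Decidable
  using (⌊_⌋; True; toWitness; fromWitness; dec-true; dec-false; isYes≗does; _×-dec_; _⊎-dec_; _→-dec_; T?)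

-- Since w_d is a bounded ratio, no globally Lorentzian family can grow like t to the power q_d: the
-- limit argument would give ⟨w_d, q_d⟩ ≤ 0. So q_d may look Lorentzian only on each β + Δ₄²
-- separately. Before the correction it pairs to 0 with w_d; the index α* has exponent -1 in w_d, so
-- lowering the function there by ε_d gains exactly ε_d. The size of the correction is dictated by β
-- = α* - e₁ - e₃: both cut functions have there, as coefficient, minus the second difference of μ_d
-- next to d/2, which is 2 or 1 according to the parity of d. The definitions pose two obstacles.
-- Eigenvalues enter through eigenvectors over an axiomatic complete ordered field, so both
-- directions between "at most one positive eigenvalue" and "nonpositive on a hyperplane" are
-- derived from suprema; one direction serves the bound, the other the families. Real powers are
-- suprema of rational powers, so every estimate is arranged to involve only integer exponents or
-- exact powers.

private variable n : ℕ

-- Integer coefficients in commutative rings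

module IntegerSolver (CR : CommutativeRing 0ℓ 0ℓ) where
  open CommutativeRing CR
  open RingProperties ring
  open SemiringMult semiring renaming (_×_ to _·_)
  open SetoidReasoning setoid

  -- With this choice `con (+ n)` is definitionally `fromℕ n`, so numerals match by `≈-refl`. But
  -- `con (+ 1)` is `1# + 0#`, which is why a literal `1#` is passed to the solver below as a
  -- variable, usually `o`.
  ⟦_⟧ : ℤ → Carrier
  ⟦ + n ⟧      = n · 1#
  ⟦ -[1+ n ] ⟧ = - (suc n · 1#)

  private
    cancel-suc : ∀ a x y → (a + x) - (a + y) ≈ x - y
    cancel-suc a x y = begin
      (a + x) - (a + y)       ≈⟨ +-congˡ (-‿+-comm a y) ⟨
      (a + x) + (- a + - y)   ≈⟨ +-congʳ (+-comm a x) ⟩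
      (x + a) + (- a + - y)   ≈⟨ +-assoc x a _ ⟩
      x + (a + (- a + - y))   ≈⟨ +-congˡ (+-assoc a (- a) (- y)) ⟨
      x + ((a - a) + - y)     ≈⟨ +-congˡ (+-congʳ (-‿inverseʳ a)) ⟩
      x + (0# + - y)          ≈⟨ +-congˡ (+-identityˡ _) ⟩
      x - y                   ∎

  ⊖-homo : ∀ m n → ⟦ m ℤ.⊖ n ⟧ ≈ m · 1# - n · 1#
  ⊖-homo m zero = sym (trans (+-congˡ -0#≈0#) (+-identityʳ _))
  ⊖-homo zero (suc n) = sym (+-identityˡ _)
  ⊖-homo (suc m) (suc n) = begin
    ⟦ suc m ℤ.⊖ suc n ⟧ ≡⟨ ≡.cong ⟦_⟧ (ℤ.[1+m]⊖[1+n]≡m⊖n m n) ⟩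
    ⟦ m ℤ.⊖ n ⟧         ≈⟨ ⊖-homo m n ⟩
    m · 1# - n · 1#     ≈⟨ cancel-suc 1# _ _ ⟨
    suc m · 1# - suc n · 1# ∎

  +-homo : ∀ i j → ⟦ i ℤ.+ j ⟧ ≈ ⟦ i ⟧ + ⟦ j ⟧
  +-homo (+ m)    (+ n)    = ×-homo-+ 1# m n
  +-homo (+ m)    -[1+ n ] = ⊖-homo m (suc n)
  +-homo -[1+ m ] (+ n)    = trans (⊖-homo n (suc m)) (+-comm _ _)
  +-homo -[1+ m ] -[1+ n ] = begin
    - (suc (suc (m ℕ.+ n)) · 1#)         ≡⟨ ≡.cong (λ k → - (k · 1#)) (≡.cong suc (≡.sym (ℕ.+-suc m n))) ⟩
    - ((suc m ℕ.+ suc n) · 1#)           ≈⟨ -‿cong (×-homo-+ 1# (suc m) (suc n)) ⟩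
    - (suc m · 1# + suc n · 1#)          ≈⟨ -‿+-comm _ _ ⟨
    - (suc m · 1#) + - (suc n · 1#)      ∎

  -‿homo : ∀ i → ⟦ ℤ.- i ⟧ ≈ - ⟦ i ⟧
  -‿homo (+ zero)  = sym -0#≈0#
  -‿homo (+ suc n) = refl
  -‿homo -[1+ n ]  = sym (-‿involutive _)

  private
    +*-homo : ∀ m j → ⟦ + m ℤ.* j ⟧ ≈ ⟦ + m ⟧ * ⟦ j ⟧
    +*-homo m (+ n) = trans (reflexive (≡.cong ⟦_⟧ (≡.sym (ℤ.pos-* m n)))) (×1-homo-* m n)
    +*-homo m -[1+ n ] = begin
      ⟦ + m ℤ.* -[1+ n ] ⟧       ≡⟨ ≡.cong ⟦_⟧ (ℤ.neg-distribʳ-* (+ m) (+ suc n)) ⟨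
      ⟦ ℤ.- (+ m ℤ.* + suc n) ⟧  ≈⟨ -‿homo (+ m ℤ.* + suc n) ⟩
      - ⟦ + m ℤ.* + suc n ⟧      ≈⟨ -‿cong (+*-homo m (+ suc n)) ⟩
      - (⟦ + m ⟧ * ⟦ + suc n ⟧)  ≈⟨ -‿distribʳ-* _ _ ⟩
      ⟦ + m ⟧ * - ⟦ + suc n ⟧    ∎

  *-homo : ∀ i j → ⟦ i ℤ.* j ⟧ ≈ ⟦ i ⟧ * ⟦ j ⟧
  *-homo (+ m) j = +*-homo m j
  *-homo -[1+ m ] j = begin
    ⟦ -[1+ m ] ℤ.* j ⟧        ≡⟨ ≡.cong ⟦_⟧ (ℤ.neg-distribˡ-* (+ suc m) j) ⟨
    ⟦ ℤ.- (+ suc m ℤ.* j) ⟧   ≈⟨ -‿homo (+ suc m ℤ.* j) ⟩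
    - ⟦ + suc m ℤ.* j ⟧       ≈⟨ -‿cong (+*-homo (suc m) j) ⟩
    - (⟦ + suc m ⟧ * ⟦ j ⟧)   ≈⟨ -‿distribˡ-* _ _ ⟩
    - ⟦ + suc m ⟧ * ⟦ j ⟧     ∎

  morphism : ℤ.+-*-rawRing -Raw-AlmostCommutative⟶ fromCommutativeRing CR
  morphism = record
    { ⟦_⟧    = ⟦_⟧
    ; +-homo = +-homo
    ; *-homo = *-homo
    ; -‿homo = -‿homo
    ; 0-homo = refl
    ; 1-homo = +-identityʳ 1#
    }

  coeff≟ : ∀ i j → Maybe (⟦ i ⟧ ≈ ⟦ j ⟧)
  coeff≟ i j with i ℤ.≟ j
  ... | yes ≡.refl = just refl
  ... | no  _      = nothing

  open Algebra.Solver.Ring ℤ.+-*-rawRing (fromCommutativeRing CR) morphism coeff≟ public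
    using (solve; _:=_; _:+_; _:*_; _:-_; :-_; _:^_; con; Polynomial)

-- Arithmetic of complete ordered fields

module OrderedField (em : ExcludedMiddle 0ℓ) (R : CompleteOrderedField) where
  open CompleteOrderedField R public
  open CommutativeRing commutativeRing public using ()
    renaming (refl to ≈-refl; sym to ≈-sym; trans to ≈-trans; reflexive to ≈-reflexive)
  open IsTotalOrder isTotalOrder public using ()
    renaming (refl to ≤-refl; reflexive to ≤-reflexive; trans to ≤-trans; antisym to ≤-antisym;
              total to ≤-total; ≤-respˡ-≈ to ≤-respˡ; ≤-respʳ-≈ to ≤-respʳ)
  open IntegerSolver commutativeRing public
    using (solve; _:=_; _:+_; _:*_; _:-_; :-_; _:^_; con; Polynomial)
  open SemiringMult semiring public using () renaming (×-homo-+ to ·-homo-+; ×1-homo-* to fromℕ-*)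
  open Exp commutativeSemiring public using (^-homo-*; ^-assocʳ; ^-distrib-*; ^-congˡ)

  0≤y-x : ∀ {x y} → x ≤ y → 0# ≤ y - x
  0≤y-x {x} {y} x≤y = ≤-respˡ (-‿inverseˡ x) (≤-respʳ (+-comm (- x) y) (+-monoʳ-≤ (- x) x≤y))

  -- The pattern for polynomial inequalities below: the solver rewrites the difference as an
  -- expression `z` assembled from squares, products of nonnegative terms and known differences.
  ≤-diff : ∀ {x y z} → 0# ≤ z → y - x ≈ z → x ≤ y
  ≤-diff {x} {y} {z} 0≤z eq = ≤-respˡ (+-identityʳ x) (≤-respʳ
    (≈-trans (+-congˡ (≈-sym eq)) (solve 2 (λ x y → x :+ (y :- x) := y) ≈-refl x y))
    (+-monoʳ-≤ x 0≤z))

  +-mono-≤ : ∀ {x y u v} → x ≤ y → u ≤ v → x + u ≤ y + v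
  +-mono-≤ {x} {y} {u} {v} x≤y u≤v =
    ≤-trans (+-monoʳ-≤ x u≤v) (≤-respˡ (+-comm v x) (≤-respʳ (+-comm v y) (+-monoʳ-≤ v x≤y)))

  +-nonNeg : ∀ {x y} → 0# ≤ x → 0# ≤ y → 0# ≤ x + y
  +-nonNeg 0≤x 0≤y = ≤-respˡ (+-identityˡ 0#) (+-mono-≤ 0≤x 0≤y)

  neg-nonNeg : ∀ {x} → x ≤ 0# → 0# ≤ - x
  neg-nonNeg {x} x≤0 = ≤-respʳ (+-identityˡ (- x)) (0≤y-x x≤0)

  square-nonNeg : ∀ x → 0# ≤ x * x
  square-nonNeg x with ≤-total 0# x
  ... | inj₁ 0≤x = *-nonNeg 0≤x 0≤x
  ... | inj₂ x≤0 = ≤-respʳ (solve 1 (λ x → :- x :* :- x := x :* x) ≈-refl x)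
                     (*-nonNeg (neg-nonNeg x≤0) (neg-nonNeg x≤0))

  0≤1 : 0# ≤ 1#
  0≤1 = ≤-respʳ (*-identityˡ 1#) (square-nonNeg 1#)

  *-monoʳ-≤ : ∀ {x y} z → 0# ≤ z → x ≤ y → z * x ≤ z * y
  *-monoʳ-≤ {x} {y} z 0≤z x≤y = ≤-diff (*-nonNeg 0≤z (0≤y-x x≤y))
    (solve 3 (λ x y z → z :* y :- z :* x := z :* (y :- x)) ≈-refl x y z)

  *-mono-≤ : ∀ {x y u v} → 0# ≤ x → 0# ≤ v → x ≤ y → u ≤ v → x * u ≤ y * v
  *-mono-≤ {x} {y} {u} {v} 0≤x 0≤v x≤y u≤v = ≤-trans (*-monoʳ-≤ x 0≤x u≤v)
    (≤-respˡ (*-comm v x) (≤-respʳ (*-comm v y) (*-monoʳ-≤ v 0≤v x≤y)))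

  <⇒≉ : ∀ {x} → 0# < x → x ≉ 0#
  <⇒≉ (_ , 0≉x) x≈0 = 0≉x (≈-sym x≈0)

  <⇒≤ : ∀ {x y} → x < y → x ≤ y
  <⇒≤ = proj₁

  ≤∧≉⇒< : ∀ {x} → 0# ≤ x → x ≉ 0# → 0# < x
  ≤∧≉⇒< 0≤x x≉0 = 0≤x , λ 0≈x → x≉0 (≈-sym 0≈x)

  <⇒≱ : ∀ {x y} → x < y → ¬ (y ≤ x)
  <⇒≱ (x≤y , x≉y) y≤x = x≉y (≤-antisym x≤y y≤x)

  ≰⇒> : ∀ {x y} → ¬ (x ≤ y) → y < x
  ≰⇒> {x} {y} x≰y with ≤-total x y
  ... | inj₁ x≤y = contradiction x≤y x≰y
  ... | inj₂ y≤x = y≤x , λ y≈x → x≰y (≤-reflexive (≈-sym y≈x))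

  <-≤-trans : ∀ {x y z} → x < y → y ≤ z → x < z
  <-≤-trans x<y y≤z = ≤-trans (<⇒≤ x<y) y≤z , λ x≈z → <⇒≱ x<y (≤-respʳ (≈-sym x≈z) y≤z)

  0<1 : 0# < 1#
  0<1 = ≤∧≉⇒< 0≤1 1≉0

  +-pos-nonNeg : ∀ {x y} → 0# < x → 0# ≤ y → 0# < x + y
  +-pos-nonNeg {x} {y} 0<x 0≤y = <-≤-trans 0<x (≤-respˡ (+-identityʳ x) (+-monoʳ-≤ x 0≤y))

  *-cancelˡ-0 : ∀ {x y} → x ≉ 0# → x * y ≈ 0# → y ≈ 0#
  *-cancelˡ-0 {x} {y} x≉0 xy≈0 =
    ≈-trans (≈-sym (*-identityˡ y)) (≈-trans (*-congʳ (≈-sym (*-inverseʳ x x≉0)))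
    (≈-trans (solve 3 (λ x i y → x :* i :* y := i :* (x :* y)) ≈-refl x (x ⁻¹) y)
    (≈-trans (*-congˡ xy≈0) (zeroʳ _))))

  square-≈0 : ∀ {x} → x * x ≈ 0# → x ≈ 0#
  square-≈0 {x} xx≈0 with em {x ≈ 0#}
  ... | yes x≈0 = x≈0
  ... | no  x≉0 = *-cancelˡ-0 x≉0 xx≈0

  *-pos : ∀ {x y} → 0# < x → 0# < y → 0# < x * y
  *-pos 0<x 0<y = ≤∧≉⇒< (*-nonNeg (<⇒≤ 0<x) (<⇒≤ 0<y)) λ xy≈0 → <⇒≉ 0<y (*-cancelˡ-0 (<⇒≉ 0<x) xy≈0)

  square-pos : ∀ {x} → x ≉ 0# → 0# < x * x
  square-pos {x} x≉0 = ≤∧≉⇒< (square-nonNeg x) λ xx≈0 → x≉0 (square-≈0 xx≈0)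

  *-cancelˡ-nonNeg : ∀ {x y} → 0# < x → 0# ≤ x * y → 0# ≤ y
  *-cancelˡ-nonNeg {x} {y} 0<x 0≤xy with ≤-total 0# y
  ... | inj₁ 0≤y = 0≤y
  ... | inj₂ y≤0 = ≤-reflexive (≈-sym (*-cancelˡ-0 (<⇒≉ 0<x) (≤-antisym
    (≤-diff (*-nonNeg (<⇒≤ 0<x) (neg-nonNeg y≤0)) (solve 2 (λ x y → con (+ 0) :- x :* y := x :* :- y) ≈-refl x y))
    0≤xy)))

  *-cancelˡ-≤ : ∀ {x y} z → 0# < z → z * x ≤ z * y → x ≤ y
  *-cancelˡ-≤ {x} {y} z 0<z zx≤zy = ≤-diff (*-cancelˡ-nonNeg 0<z (≤-respʳ
    (solve 3 (λ x y z → z :* y :- z :* x := z :* (y :- x)) ≈-refl x y z) (0≤y-x zx≤zy))) ≈-refl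

  ⁻¹-pos : ∀ {x} → 0# < x → 0# < x ⁻¹
  ⁻¹-pos {x} 0<x = ≤∧≉⇒<
    (*-cancelˡ-nonNeg 0<x (≤-respʳ (≈-sym (*-inverseʳ x (<⇒≉ 0<x))) 0≤1))
    λ x⁻¹≈0 → 1≉0 (≈-trans (≈-sym (*-inverseʳ x (<⇒≉ 0<x))) (≈-trans (*-congˡ x⁻¹≈0) (zeroʳ x)))

  *-cancelˡ-≈ : ∀ {x y} z → z ≉ 0# → z * x ≈ z * y → x ≈ y
  *-cancelˡ-≈ {x} {y} z z≉0 zx≈zy =
    ≈-trans (solve 2 (λ x y → x := (x :- y) :+ y) ≈-refl x y) (≈-trans (+-congʳ x-y≈0) (+-identityˡ y))
    where
    x-y≈0 : x - y ≈ 0#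
    x-y≈0 = *-cancelˡ-0 z≉0 (≈-trans
      (solve 3 (λ x y z → z :* (x :- y) := z :* x :- z :* y) ≈-refl x y z)
      (≈-trans (+-congʳ zx≈zy) (-‿inverseʳ (z * y))))

  fromℕ-nonNeg : ∀ n → 0# ≤ fromℕ n
  fromℕ-nonNeg zero    = ≤-refl
  fromℕ-nonNeg (suc n) = +-nonNeg 0≤1 (fromℕ-nonNeg n)

  fromℕ-pos : ∀ n → 0# < fromℕ (suc n)
  fromℕ-pos n = +-pos-nonNeg 0<1 (fromℕ-nonNeg n)

  fromℕ-+ : ∀ m n → fromℕ (m ℕ.+ n) ≈ fromℕ m + fromℕ n
  fromℕ-+ = ·-homo-+ 1#

  fromℕ-mono : ∀ {m n} → m ℕ.≤ n → fromℕ m ≤ fromℕ n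
  fromℕ-mono {n = n} ℕ.z≤n = fromℕ-nonNeg n
  fromℕ-mono (ℕ.s≤s m≤n) = +-monoʳ-≤ 1# (fromℕ-mono m≤n)

  fromℕ-mono-< : ∀ {m n} → m ℕ.< n → fromℕ m < fromℕ n
  fromℕ-mono-< {m} {suc n} (ℕ.s≤s m≤n) = ≤-trans (fromℕ-mono m≤n) n≤1+n , λ eq → n≱1+n (≤-respˡ eq (fromℕ-mono m≤n))
    where
    n≤1+n : fromℕ n ≤ fromℕ (suc n)
    n≤1+n = ≤-diff 0≤1 (solve 2 (λ x y → x :+ y :- y := x) ≈-refl 1# (fromℕ n))
    n≱1+n : ¬ (fromℕ (suc n) ≤ fromℕ n)
    n≱1+n le = <⇒≱ 0<1 (≤-diff (0≤y-x le) (solve 2 (λ x y → con (+ 0) :- x := y :- (x :+ y)) ≈-refl 1# (fromℕ n)))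

  fromℕ-cancel-≤ : ∀ {m n} → fromℕ m ≤ fromℕ n → m ℕ.≤ n
  fromℕ-cancel-≤ {m} {n} le = ℕ.≮⇒≥ λ n<m → <⇒≱ (fromℕ-mono-< n<m) le

  archimedean : ∀ x → ∃[ n ] x ≤ fromℕ n
  archimedean x with em {∃[ n ] x ≤ fromℕ n}
  ... | yes p = p
  ... | no ¬p = contradiction (sup-least P inhabited bounded (s - 1#) s-1-upper) s≰s-1
    where
    P : Carrier → Set
    P y = ∃[ n ] y ≈ fromℕ n
    s : Carrier
    s = sup P
    inhabited : ∃ P
    inhabited = 0# , 0 , ≈-refl
    bounded : ∃ (UpperBound P)
    bounded = x , λ { y (n , y≈n) → ≤-respˡ (≈-sym y≈n) (<⇒≤ (≰⇒> λ x≤n → ¬p (n , x≤n))) }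
    -- The naturals are closed under successor, so n + 1 ≤ s gives n ≤ s - 1.
    s-1-upper : UpperBound P (s - 1#)
    s-1-upper y (n , y≈n) = ≤-diff (0≤y-x (sup-upper P inhabited bounded (fromℕ (suc n)) (suc n , ≈-refl)))
      (≈-trans (+-congˡ (-‿cong y≈n)) (solve 3 (λ s o n → s :- o :- n := s :- (o :+ n)) ≈-refl s 1# (fromℕ n)))
    s≰s-1 : ¬ (s ≤ s - 1#)
    s≰s-1 le = <⇒≱ 0<1 (≤-diff (0≤y-x le) (solve 2 (λ s o → con (+ 0) :- o := s :- o :- s) ≈-refl s 1#))

  ^-nonNeg : ∀ {x} → 0# ≤ x → ∀ n → 0# ≤ x ^ n
  ^-nonNeg 0≤x zero    = 0≤1
  ^-nonNeg 0≤x (suc n) = *-nonNeg 0≤x (^-nonNeg 0≤x n)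

  ^-pos : ∀ {x} → 0# < x → ∀ n → 0# < x ^ n
  ^-pos 0<x zero    = 0<1
  ^-pos 0<x (suc n) = *-pos 0<x (^-pos 0<x n)

  1≤^ : ∀ {x} → 1# ≤ x → ∀ n → 1# ≤ x ^ n
  1≤^ 1≤x zero    = ≤-refl
  1≤^ 1≤x (suc n) = ≤-respˡ (*-identityˡ 1#) (*-mono-≤ 0≤1 (^-nonNeg (≤-trans 0≤1 1≤x) n) 1≤x (1≤^ 1≤x n))

  ^≤1 : ∀ {x} → 0# ≤ x → x ≤ 1# → ∀ n → x ^ n ≤ 1#
  ^≤1 0≤x x≤1 zero    = ≤-refl
  ^≤1 0≤x x≤1 (suc n) = ≤-respʳ (*-identityˡ 1#) (*-mono-≤ 0≤x 0≤1 x≤1 (^≤1 0≤x x≤1 n))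

  ^-monoʳ-≤ : ∀ {x m n} → 1# ≤ x → m ℕ.≤ n → x ^ m ≤ x ^ n
  ^-monoʳ-≤ {n = n} 1≤x ℕ.z≤n = 1≤^ 1≤x n
  ^-monoʳ-≤ 1≤x (ℕ.s≤s m≤n) = *-monoʳ-≤ _ (≤-trans 0≤1 1≤x) (^-monoʳ-≤ 1≤x m≤n)

  ^-antimonoʳ-≤ : ∀ {x m n} → 0# ≤ x → x ≤ 1# → m ℕ.≤ n → x ^ n ≤ x ^ m
  ^-antimonoʳ-≤ {n = n} 0≤x x≤1 ℕ.z≤n = ^≤1 0≤x x≤1 n
  ^-antimonoʳ-≤ 0≤x x≤1 (ℕ.s≤s m≤n) = *-monoʳ-≤ _ 0≤x (^-antimonoʳ-≤ 0≤x x≤1 m≤n)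

  ^-mono-< : ∀ {x y} → 0# ≤ x → x < y → ∀ n → x ^ suc n < y ^ suc n
  ^-mono-< {x} {y} 0≤x x<y zero =
    ≤-respˡ (≈-sym (*-identityʳ x)) (≤-respʳ (≈-sym (*-identityʳ y)) (<⇒≤ x<y)) ,
    λ eq → proj₂ x<y (≈-trans (≈-sym (*-identityʳ x)) (≈-trans eq (*-identityʳ y)))
  ^-mono-< {x} {y} 0≤x x<y (suc n) with ^-mono-< 0≤x x<y n
  ... | le , ne = *-mono-≤ 0≤x (^-nonNeg 0≤y (suc n)) (<⇒≤ x<y) le , λ eq → ne (*-cancelˡ-≈ y y≉0
         (≤-antisym (*-monoʳ-≤ y 0≤y le) (≤-respˡ eq (≤-respˡ (*-comm _ _) (≤-respʳ (*-comm _ _)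
           (*-monoʳ-≤ _ (^-nonNeg 0≤x (suc n)) (<⇒≤ x<y)))))))
    where
    0≤y = ≤-trans 0≤x (<⇒≤ x<y)
    y≉0 : y ≉ 0#
    y≉0 y≈0 = <⇒≱ x<y (≤-respˡ (≈-sym y≈0) 0≤x)

  ^-cancel-≤ : ∀ {x y} → 0# ≤ y → ∀ n → x ^ suc n ≤ y ^ suc n → x ≤ y
  ^-cancel-≤ {x} {y} 0≤y n le with em {x ≤ y}
  ... | yes x≤y = x≤y
  ... | no  x≰y = contradiction le (<⇒≱ (^-mono-< 0≤y (≰⇒> x≰y) n))

-- Symmetric forms: isotropic or coercive

module LinearAlgebra (em : ExcludedMiddle 0ℓ) (R : CompleteOrderedField) where
  open OrderedField em R hiding (zero)
  open Lorentzian R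
  open SetoidReasoning setoid
  open SemiringSum semiring using (sum-cong-≋; sum-replicate-zero; *-distribˡ-sum; *-distribʳ-sum; ∑-distrib-+; ∑-comm)

  Vector : ℕ → Set
  Vector n = Fin n → Carrier

  dot : Vector n → Vector n → Carrier
  dot x y = sum λ i → x i * y i

  _*ᵥ_ : Matrix n → Vector n → Vector n
  (H *ᵥ x) i = dot (H i) x

  form : Matrix n → Vector n → Vector n → Carrier
  form H x y = dot x (H *ᵥ y)

  comb : Carrier → Vector n → Carrier → Vector n → Vector n
  comb s x t y i = s * x i + t * y i

  Symmetric : Matrix n → Set
  Symmetric H = ∀ i j → H i j ≈ H j i

  Nonzero : Vector n → Set
  Nonzero x = ∃[ i ] x i ≉ 0#

  dot-cong : {x x′ y y′ : Vector n} → (∀ i → x i ≈ x′ i) → (∀ i → y i ≈ y′ i) → dot x y ≈ dot x′ y′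
  dot-cong p q = sum-cong-≋ λ i → *-cong (p i) (q i)

  dot-congʳ : {x y y′ : Vector n} → (∀ i → y i ≈ y′ i) → dot x y ≈ dot x y′
  dot-congʳ = dot-cong λ _ → ≈-refl

  dot-comm : (x y : Vector n) → dot x y ≈ dot y x
  dot-comm x y = sum-cong-≋ λ i → *-comm (x i) (y i)

  dot-combˡ : ∀ s (x : Vector n) t y z → dot (comb s x t y) z ≈ s * dot x z + t * dot y z
  dot-combˡ s x t y z = begin
    dot (comb s x t y) z
      ≈⟨ sum-cong-≋ (λ i → solve 5 (λ s x t y z → (s :* x :+ t :* y) :* z := s :* (x :* z) :+ t :* (y :* z))
           ≈-refl s (x i) t (y i) (z i)) ⟩
    sum (λ i → s * (x i * z i) + t * (y i * z i))
      ≈⟨ ∑-distrib-+ (λ i → s * (x i * z i)) (λ i → t * (y i * z i)) ⟩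
    sum (λ i → s * (x i * z i)) + sum (λ i → t * (y i * z i))
      ≈⟨ +-cong (*-distribˡ-sum s (λ i → x i * z i)) (*-distribˡ-sum t (λ i → y i * z i)) ⟨
    s * dot x z + t * dot y z ∎

  dot-combʳ : ∀ z s (x : Vector n) t y → dot z (comb s x t y) ≈ s * dot z x + t * dot z y
  dot-combʳ z s x t y = ≈-trans (dot-comm z _) (≈-trans (dot-combˡ s x t y z)
    (+-cong (*-congˡ (dot-comm x z)) (*-congˡ (dot-comm y z))))

  dot-zeroʳ : ∀ (x : Vector n) {y} → (∀ i → y i ≈ 0#) → dot x y ≈ 0#
  dot-zeroʳ {n} x y≈0 = ≈-trans (sum-cong-≋ λ i → ≈-trans (*-congˡ (y≈0 i)) (zeroʳ (x i))) (sum-replicate-zero n)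

  dot-nonNeg : ∀ (x : Vector n) → 0# ≤ dot x x
  dot-nonNeg {zero}  x = ≤-refl
  dot-nonNeg {suc n} x = +-nonNeg (square-nonNeg (x zero)) (dot-nonNeg (x ∘ suc))

  dot-pos : ∀ (x : Vector n) → Nonzero x → 0# < dot x x
  dot-pos x (zero  , x0≉0) = +-pos-nonNeg (square-pos x0≉0) (dot-nonNeg (x ∘ suc))
  dot-pos x (suc i , xi≉0) = <-≤-trans (dot-pos (x ∘ suc) (i , xi≉0))
    (≤-diff (square-nonNeg (x zero)) (solve 2 (λ a b → a :+ b :- b := a) ≈-refl _ _))

  dot≈0⇒≈0 : ∀ (x : Vector n) → dot x x ≈ 0# → ∀ i → x i ≈ 0#
  dot≈0⇒≈0 x eq i with em {x i ≈ 0#}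
  ... | yes p = p
  ... | no ¬p = contradiction eq (<⇒≉ (dot-pos x (i , ¬p)))

  sum-mono : {f g : Vector n} → (∀ i → f i ≤ g i) → sum f ≤ sum g
  sum-mono {zero}  le = ≤-refl
  sum-mono {suc n} le = +-mono-≤ (le zero) (sum-mono (le ∘ suc))

  *ᵥ-comb : ∀ (H : Matrix n) s x t y i → (H *ᵥ comb s x t y) i ≈ comb s (H *ᵥ x) t (H *ᵥ y) i
  *ᵥ-comb H s x t y i = dot-combʳ (H i) s x t y

  form-combˡ : ∀ (H : Matrix n) s x t y z → form H (comb s x t y) z ≈ s * form H x z + t * form H y z
  form-combˡ H s x t y z = dot-combˡ s x t y (H *ᵥ z)

  form-combʳ : ∀ (H : Matrix n) z s x t y → form H z (comb s x t y) ≈ s * form H z x + t * form H z y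
  form-combʳ H z s x t y = ≈-trans (dot-congʳ (*ᵥ-comb H s x t y)) (dot-combʳ z s (H *ᵥ x) t (H *ᵥ y))

  form-sym : ∀ (H : Matrix n) → Symmetric H → ∀ x y → form H x y ≈ form H y x
  form-sym H H-sym x y = begin
    sum (λ i → x i * sum (λ j → H i j * y j))
      ≈⟨ sum-cong-≋ (λ i → *-distribˡ-sum (x i) (λ j → H i j * y j)) ⟩
    sum (λ i → sum (λ j → x i * (H i j * y j)))
      ≈⟨ ∑-comm (λ i j → x i * (H i j * y j)) ⟩
    sum (λ j → sum (λ i → x i * (H i j * y j)))
      ≈⟨ sum-cong-≋ (λ j → sum-cong-≋ λ i → ≈-trans (*-congˡ (*-congʳ (H-sym i j)))
           (solve 3 (λ x h y → x :* (h :* y) := y :* (h :* x)) ≈-refl (x i) (H j i) (y j))) ⟩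
    sum (λ j → sum (λ i → y j * (H j i * x i)))
      ≈⟨ sum-cong-≋ (λ j → *-distribˡ-sum (y j) (λ i → H j i * x i)) ⟨
    sum (λ j → y j * sum (λ i → H j i * x i)) ∎

  form-comb : ∀ (H : Matrix n) → Symmetric H → ∀ s x t y →
    form H (comb s x t y) (comb s x t y) ≈
    s * s * form H x x + fromℕ 2 * (s * t) * form H x y + t * t * form H y y
  form-comb H H-sym s x t y = begin
    form H z z
      ≈⟨ form-combˡ H s x t y z ⟩
    s * form H x z + t * form H y z
      ≈⟨ +-cong (*-congˡ (form-combʳ H x s x t y)) (*-congˡ (form-combʳ H y s x t y)) ⟩
    s * (s * form H x x + t * form H x y) + t * (s * form H y x + t * form H y y)
      ≈⟨ +-congˡ (*-congˡ (+-congʳ (*-congˡ (form-sym H H-sym y x)))) ⟩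
    s * (s * form H x x + t * form H x y) + t * (s * form H x y + t * form H y y)
      ≈⟨ solve 5 (λ s t a b c → s :* (s :* a :+ t :* b) :+ t :* (s :* b :+ t :* c) :=
           s :* s :* a :+ con (+ 2) :* (s :* t) :* b :+ t :* t :* c) ≈-refl s t _ _ _ ⟩
    s * s * form H x x + fromℕ 2 * (s * t) * form H x y + t * t * form H y y ∎
    where
    z = comb s x t y

  -- One shape for three uses: the Schur complement times its pivot, the deflation by an eigenvector
  -- times its squared length, and the assembly of rank-two Hessians. The scale `a` keeps division
  -- out of the matrix entries.
  rankOne : Carrier → Matrix n → Carrier → Vector n → Matrix n
  rankOne a H k u i j = a * H i j - k * (u i * u j)

  rankOne-*ᵥ : ∀ a (H : Matrix n) k u x i → (rankOne a H k u *ᵥ x) i ≈ a * (H *ᵥ x) i - k * dot u x * u i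
  rankOne-*ᵥ a H k u x i = begin
    dot (rankOne a H k u i) x
      ≈⟨ dot-cong (λ j → solve 5 (λ a h k ui uj → a :* h :- k :* (ui :* uj) := a :* h :+ :- (k :* ui) :* uj)
           ≈-refl a (H i j) k (u i) (u j)) (λ _ → ≈-refl) ⟩
    dot (comb a (H i) (- (k * u i)) u) x
      ≈⟨ dot-combˡ a (H i) (- (k * u i)) u x ⟩
    a * dot (H i) x + - (k * u i) * dot u x
      ≈⟨ solve 5 (λ a h k ui d → a :* h :+ :- (k :* ui) :* d := a :* h :- k :* d :* ui) ≈-refl a _ k (u i) _ ⟩
    a * (H *ᵥ x) i - k * dot u x * u i ∎

  rankOne-form : ∀ a (H : Matrix n) k u x y →
    form (rankOne a H k u) x y ≈ a * form H x y - k * (dot u x * dot u y)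
  rankOne-form a H k u x y = begin
    dot x (rankOne a H k u *ᵥ y)
      ≈⟨ dot-congʳ (λ i → ≈-trans (rankOne-*ᵥ a H k u y i)
           (solve 4 (λ a h k u → a :* h :- k :* u := a :* h :+ :- k :* u) ≈-refl a _ (k * dot u y) (u i))) ⟩
    dot x (comb a (H *ᵥ y) (- (k * dot u y)) u)
      ≈⟨ dot-combʳ x a (H *ᵥ y) (- (k * dot u y)) u ⟩
    a * form H x y + - (k * dot u y) * dot x u
      ≈⟨ +-congˡ (*-congˡ (dot-comm x u)) ⟩
    a * form H x y + - (k * dot u y) * dot u x
      ≈⟨ solve 5 (λ a h k d d′ → a :* h :+ :- (k :* d′) :* d := a :* h :- k :* (d :* d′)) ≈-refl a _ k _ _ ⟩
    a * form H x y - k * (dot u x * dot u y) ∎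

  rankOne-sym : ∀ a {H : Matrix n} k u → Symmetric H → Symmetric (rankOne a H k u)
  rankOne-sym a k u H-sym i j = +-cong (*-congˡ (H-sym i j)) (-‿cong (*-congˡ (*-comm (u i) (u j))))

  form-split : ∀ (H : Matrix (suc n)) → Symmetric H → ∀ x →
    form H x x ≈ H zero zero * (x zero * x zero) + fromℕ 2 * (x zero * dot (H zero ∘ suc) (x ∘ suc))
                 + form (λ i j → H (suc i) (suc j)) (x ∘ suc) (x ∘ suc)
  form-split H H-sym x = begin
    x₀ * (H zero zero * x₀ + dot h x′) + dot x′ (λ i → H (suc i) zero * x₀ + (H′ *ᵥ x′) i)
      ≈⟨ +-congˡ (dot-congʳ λ i → +-cong (≈-trans (*-comm _ _) (*-congˡ (H-sym (suc i) zero))) (≈-sym (*-identityˡ _))) ⟩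
    x₀ * (H zero zero * x₀ + dot h x′) + dot x′ (comb x₀ h 1# (H′ *ᵥ x′))
      ≈⟨ +-congˡ (≈-trans (dot-combʳ x′ x₀ h 1# (H′ *ᵥ x′)) (+-cong (*-congˡ (dot-comm x′ h)) (*-identityˡ _))) ⟩
    x₀ * (H zero zero * x₀ + dot h x′) + (x₀ * dot h x′ + form H′ x′ x′)
      ≈⟨ solve 4 (λ a x d q → x :* (a :* x :+ d) :+ (x :* d :+ q) := a :* (x :* x) :+ con (+ 2) :* (x :* d) :+ q)
           ≈-refl (H zero zero) x₀ (dot h x′) _ ⟩
    H zero zero * (x₀ * x₀) + fromℕ 2 * (x₀ * dot h x′) + form H′ x′ x′ ∎
    where
    x₀ = x zero
    x′ = x ∘ suc
    h = H zero ∘ suc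
    H′ = λ i j → H (suc i) (suc j)

  -- Cauchy-Schwarz with a crude constant, from (p + s)² ≤ 2(p² + s²) at each coordinate; only the
  -- existence of L matters.
  dot-bound : ∀ (h : Vector n) → ∃[ L ] (0# ≤ L × ∀ x → dot h x * dot h x ≤ L * dot x x)
  dot-bound {zero}  h = 0# , ≤-refl , λ x → ≤-reflexive ≈-refl
  dot-bound {suc n} h with dot-bound (h ∘ suc)
  ... | L , 0≤L , bound = fromℕ 2 * (h₀ * h₀ + L) , *-nonNeg (fromℕ-nonNeg 2) (+-nonNeg (square-nonNeg h₀) 0≤L) , λ x →
        let x₀ = x zero; X = dot (x ∘ suc) (x ∘ suc); s = dot (h ∘ suc) (x ∘ suc) in
        ≤-diff
          (+-nonNeg (+-nonNeg (square-nonNeg (h₀ * x₀ - s)) (*-nonNeg (fromℕ-nonNeg 2) (0≤y-x (bound (x ∘ suc)))))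
            (*-nonNeg (fromℕ-nonNeg 2) (+-nonNeg (*-nonNeg (square-nonNeg h₀) (dot-nonNeg (x ∘ suc))) (*-nonNeg 0≤L (square-nonNeg x₀)))))
          (solve 5 (λ h x L X s →
             con (+ 2) :* (h :* h :+ L) :* (x :* x :+ X) :- (h :* x :+ s) :* (h :* x :+ s) :=
             (h :* x :- s) :* (h :* x :- s) :+ con (+ 2) :* (L :* X :- s :* s)
               :+ con (+ 2) :* (h :* h :* X :+ L :* (x :* x))) ≈-refl h₀ x₀ L X s)
    where h₀ = h zero

  -- Expanding |x - Hx|² ≥ 0 gives 2Q(x) ≤ |x|² + |Hx|², and `dot-bound` applied to every row bounds
  -- |Hx|² by M|x|².
  form-bound : ∀ (H : Matrix n) → ∃[ L ] ∀ x → form H x x ≤ L * dot x x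
  form-bound {n} H = 1# + M , λ x →
    let X = dot x x; Y = dot (H *ᵥ x) (H *ᵥ x); Q = form H x x in
    *-cancelˡ-≤ (fromℕ 2) (fromℕ-pos 1) (≤-diff
      (+-nonNeg (+-nonNeg (dot-nonNeg (comb 1# x (- 1#) (H *ᵥ x))) (0≤y-x (Y≤ x)))
        (*-nonNeg (+-nonNeg 0≤1 0≤M) (dot-nonNeg x)))
      (≈-trans (solve 5 (λ o M X Y Q → con (+ 2) :* ((o :+ M) :* X) :- con (+ 2) :* Q :=
                  o :* X :- con (+ 2) :* Q :+ Y :+ (M :* X :- Y) :+ (o :+ M) :* X) ≈-refl 1# M X Y Q)
        (+-congʳ (+-congʳ (≈-sym (≈-trans (dot-combˡ 1# x (- 1#) (H *ᵥ x) _)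
          (≈-trans (+-cong (*-congˡ (dot-combʳ x 1# x (- 1#) (H *ᵥ x)))
                           (*-congˡ (≈-trans (dot-combʳ (H *ᵥ x) 1# x (- 1#) (H *ᵥ x))
                                             (+-congʳ (*-congˡ (dot-comm (H *ᵥ x) x))))))
          (≈-trans (+-cong (*-identityˡ _) ≈-refl)
          (≈-trans (+-cong (+-cong (*-identityˡ _) (-1* Q)) (≈-trans (-1* _) (-‿cong (+-cong (*-identityˡ _) (-1* Y)))))
          (≈-trans (solve 3 (λ X Y Q → X :+ :- Q :+ :- (Q :+ :- Y) := X :- con (+ 2) :* Q :+ Y) ≈-refl X Y Q)
            (+-congʳ (+-congʳ (≈-sym (*-identityˡ X))))))))))))))
    where
    -1* : ∀ x → - 1# * x ≈ - x
    -1* x = ≈-trans (solve 2 (λ o x → :- o :* x := :- (o :* x)) ≈-refl 1# x) (-‿cong (*-identityˡ x))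
    L : Vector _
    L i = proj₁ (dot-bound (H i))
    M : Carrier
    M = sum L
    0≤M : 0# ≤ M
    0≤M = ≤-respˡ (sum-replicate-zero n) (sum-mono {f = λ _ → 0#} {L} λ i → proj₁ (proj₂ (dot-bound (H i))))
    Y≤ : ∀ x → dot (H *ᵥ x) (H *ᵥ x) ≤ M * dot x x
    Y≤ x = ≤-respʳ (≈-sym (*-distribʳ-sum (dot x x) L)) (sum-mono λ i → proj₂ (proj₂ (dot-bound (H i))) x)

  -- By induction on the dimension, passing to the Schur complement of the
  -- top left entry.
  isotropic⊎coercive : ∀ (H : Matrix n) → Symmetric H →
    (∃[ x ] Nonzero x × form H x x ≤ 0#) ⊎ (∃[ C ] 0# < C × (∀ x → dot x x ≤ C * form H x x))
  isotropic⊎coercive {zero}  H H-sym = inj₂ (1# , 0<1 , λ x → ≤-reflexive (≈-sym (*-identityˡ 0#)))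
  isotropic⊎coercive {suc n} H H-sym with em {H zero zero ≤ 0#}
  ... | yes a≤0 = inj₁ (x , (zero , 1≉0) , ≤-respˡ (≈-sym Q≈a) a≤0)
    where
    x : Vector (suc n)
    x zero    = 1#
    x (suc i) = 0#
    Hx : Vector n
    Hx = (λ i j → H (suc i) (suc j)) *ᵥ (x ∘ suc)
    Q≈a : form H x x ≈ H zero zero
    Q≈a = ≈-trans (form-split H H-sym x) (≈-trans (+-cong
      (+-cong (≈-trans (*-congˡ (*-identityˡ 1#)) (*-identityʳ _))
              (*-congˡ (*-congˡ (dot-zeroʳ (H zero ∘ suc) {x ∘ suc} λ _ → ≈-refl))))
      (≈-trans (dot-comm (x ∘ suc) Hx) (dot-zeroʳ Hx {x ∘ suc} λ _ → ≈-refl)))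
      (solve 2 (λ a o → a :+ con (+ 2) :* (o :* con (+ 0)) :+ con (+ 0) := a) ≈-refl _ 1#))
  ... | no  a≰0 with isotropic⊎coercive S (rankOne-sym a 1# h λ i j → H-sym (suc i) (suc j))
    where
    a = H zero zero
    h = H zero ∘ suc
    S = rankOne a (λ i j → H (suc i) (suc j)) 1# h
  ... | inj₁ (x′ , (i , x′i≉0) , S≤0) = inj₁ (x , (suc i , λ eq → x′i≉0 (*-cancelˡ-0 (<⇒≉ 0<a) (≈-trans (≈-sym (step i)) eq))) ,
          ≤-diff (*-nonNeg (<⇒≤ 0<a) (neg-nonNeg S≤0)) eq)
    where
    a = H zero zero
    h = H zero ∘ suc
    H′ : Matrix n
    H′ i j = H (suc i) (suc j)
    S = rankOne a H′ 1# h
    ℓ = dot h x′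
    0<a : 0# < a
    0<a = ≰⇒> a≰0
    -- Completing the square: for fixed x′ the form is least at first coordinate -ℓ/a. Scaling by a
    -- gives Q(-ℓ, a x′) = a S(x′).
    x : Vector (suc n)
    x zero    = - ℓ
    x (suc i) = comb a x′ 0# x′ i
    step : ∀ i → comb a x′ 0# x′ i ≈ a * x′ i
    step i = solve 2 (λ a x → a :* x :+ con (+ 0) :* x := a :* x) ≈-refl a (x′ i)
    eq : 0# - form H x x ≈ a * - form S x′ x′
    eq = begin
      0# - form H x x
        ≈⟨ +-congˡ (-‿cong (≈-trans (form-split H H-sym x) (+-cong (+-congˡ (*-congˡ (*-congˡ (dot-combʳ h a x′ 0# x′))))
             (form-comb H′ (λ i j → H-sym (suc i) (suc j)) a x′ 0# x′)))) ⟩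
      0# - (a * (- ℓ * - ℓ) + fromℕ 2 * (- ℓ * (a * ℓ + 0# * ℓ)) + (a * a * Q′ + fromℕ 2 * (a * 0#) * Q′ + 0# * 0# * Q′))
        ≈⟨ solve 3 (λ a l Q → con (+ 0) :- (a :* (:- l :* :- l) :+ con (+ 2) :* (:- l :* (a :* l :+ con (+ 0) :* l))
             :+ (a :* a :* Q :+ con (+ 2) :* (a :* con (+ 0)) :* Q :+ con (+ 0) :* con (+ 0) :* Q)) :=
             a :* :- (a :* Q :- l :* l)) ≈-refl a ℓ Q′ ⟩
      a * - (a * Q′ - ℓ * ℓ)
        ≈⟨ *-congˡ (-‿cong (≈-trans (rankOne-form a H′ 1# h x′ x′) (+-congˡ (-‿cong (*-identityˡ _))))) ⟨
      a * - form S x′ x′ ∎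
      where
      Q′ = form H′ x′ x′
  ... | inj₂ (C′ , 0<C′ , bound) with dot-bound (H zero ∘ suc)
  ... | L , 0≤L , L-bound = inj₂ (M * a ⁻¹ , *-pos 0<M (⁻¹-pos 0<a) , λ x →
          *-cancelˡ-≤ a 0<a (*-cancelˡ-≤ a 0<a (goal x)))
    where
    a = H zero zero
    h = H zero ∘ suc
    H′ : Matrix n
    H′ i j = H (suc i) (suc j)
    S = rankOne a H′ 1# h
    0<a : 0# < a
    0<a = ≰⇒> a≰0
    -- With y = a x₀ + ℓ one has a x₀ = y - ℓ, hence a²|x|² ≤ 2y² + 2ℓ² + a²|x′|² ≤ 2y² + K|x′|² ≤
    -- 2y² + K C′ S(x′), which is at most M(y² + S(x′)) = M a Q(x).
    K = fromℕ 2 * L + a * a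
    0≤K : 0# ≤ K
    0≤K = +-nonNeg (*-nonNeg (fromℕ-nonNeg 2) 0≤L) (square-nonNeg a)
    M = fromℕ 2 + K * C′
    0<M : 0# < M
    0<M = +-pos-nonNeg (fromℕ-pos 1) (*-nonNeg 0≤K (<⇒≤ 0<C′))
    goal : ∀ x → a * (a * dot x x) ≤ a * (a * (M * a ⁻¹ * form H x x))
    goal x = ≤-diff
      (+-nonNeg (+-nonNeg (+-nonNeg (+-nonNeg
        (square-nonNeg (y + ℓ)) (*-nonNeg (fromℕ-nonNeg 2) (0≤y-x (L-bound x′))))
        (*-nonNeg 0≤K (0≤y-x (bound x′))))
        (*-nonNeg (*-nonNeg 0≤K (<⇒≤ 0<C′)) (square-nonNeg y)))
        (*-nonNeg (fromℕ-nonNeg 2) 0≤Sx′))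
      (begin
        a * (a * (M * a ⁻¹ * Q)) - a * (a * (x₀ * x₀ + X))
          ≈⟨ solve 6 (λ a i M Q x X → a :* (a :* (M :* i :* Q)) :- a :* (a :* (x :* x :+ X)) :=
               (a :* i) :* (M :* (a :* Q)) :- a :* (a :* (x :* x :+ X))) ≈-refl a (a ⁻¹) M Q x₀ X ⟩
        (a * a ⁻¹) * (M * (a * Q)) - a * (a * (x₀ * x₀ + X))
          ≈⟨ +-congʳ (≈-trans (*-congʳ (*-inverseʳ a (<⇒≉ 0<a))) (≈-trans (*-identityˡ _) (*-congˡ aQ≈))) ⟩
        M * (y * y + Sx′) - a * (a * (x₀ * x₀ + X))
          ≈⟨ solve 7 (λ a x l L C X S →
               (con (+ 2) :+ (con (+ 2) :* L :+ a :* a) :* C) :* ((a :* x :+ l) :* (a :* x :+ l) :+ S)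
                 :- a :* (a :* (x :* x :+ X)) :=
               (a :* x :+ l :+ l) :* (a :* x :+ l :+ l) :+ con (+ 2) :* (L :* X :- l :* l)
                 :+ (con (+ 2) :* L :+ a :* a) :* (C :* S :- X)
                 :+ (con (+ 2) :* L :+ a :* a) :* C :* ((a :* x :+ l) :* (a :* x :+ l)) :+ con (+ 2) :* S)
               ≈-refl a x₀ ℓ L C′ X Sx′ ⟩
        (y + ℓ) * (y + ℓ) + fromℕ 2 * (L * X - ℓ * ℓ) + K * (C′ * Sx′ - X) + K * C′ * (y * y) + fromℕ 2 * Sx′ ∎)
      where
      x₀ = x zero
      x′ = x ∘ suc
      X = dot x′ x′
      ℓ = dot h x′
      y = a * x₀ + ℓ
      Q = form H x x
      Sx′ = form S x′ x′
      0≤Sx′ : 0# ≤ Sx′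
      0≤Sx′ = *-cancelˡ-nonNeg 0<C′ (≤-trans (dot-nonNeg x′) (bound x′))
      aQ≈ : a * Q ≈ y * y + Sx′
      aQ≈ = begin
        a * Q ≈⟨ *-congˡ (form-split H H-sym x) ⟩
        a * (a * (x₀ * x₀) + fromℕ 2 * (x₀ * ℓ) + form H′ x′ x′)
          ≈⟨ solve 4 (λ a x l Q → a :* (a :* (x :* x) :+ con (+ 2) :* (x :* l) :+ Q) :=
               (a :* x :+ l) :* (a :* x :+ l) :+ (a :* Q :- l :* l)) ≈-refl a x₀ ℓ _ ⟩
        y * y + (a * form H′ x′ x′ - ℓ * ℓ)
          ≈⟨ +-congˡ (≈-trans (rankOne-form a H′ 1# h x′ x′) (+-congˡ (-‿cong (*-identityˡ _)))) ⟨
        y * y + Sx′ ∎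

-- Existence of a top eigenvector and the negative hyperplane

module Spectral (em : ExcludedMiddle 0ℓ) (R : CompleteOrderedField) where
  open OrderedField em R hiding (zero)
  open Lorentzian R
  open LinearAlgebra em R
  open SetoidReasoning setoid

  δ : Fin n → Vector n
  δ zero    zero    = 1#
  δ zero    (suc j) = 0#
  δ (suc i) zero    = 0#
  δ (suc i) (suc j) = δ i j

  δ-sym : ∀ (i j : Fin n) → δ i j ≡ δ j i
  δ-sym zero    zero    = ≡.refl
  δ-sym zero    (suc j) = ≡.refl
  δ-sym (suc i) zero    = ≡.refl
  δ-sym (suc i) (suc j) = δ-sym i j

  dot-δ : ∀ (i : Fin n) x → dot (δ i) x ≈ x i
  dot-δ zero x = ≈-trans (+-cong (*-identityˡ _) (≈-trans (dot-comm (λ _ → 0#) (x ∘ suc)) (dot-zeroʳ (x ∘ suc) {λ _ → 0#} λ _ → ≈-refl)))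
    (+-identityʳ _)
  dot-δ (suc i) x = ≈-trans (+-cong (zeroˡ _) (dot-δ i (x ∘ suc))) (+-identityˡ _)

  shift : Carrier → Matrix n → Matrix n
  shift l H i = comb l (δ i) (- 1#) (H i)

  -1*x≈-x : ∀ x → - 1# * x ≈ - x
  -1*x≈-x x = ≈-trans (solve 2 (λ o x → :- o :* x := :- (o :* x)) ≈-refl 1# x) (-‿cong (*-identityˡ x))

  shift-*ᵥ : ∀ l (H : Matrix n) x i → (shift l H *ᵥ x) i ≈ l * x i - (H *ᵥ x) i
  shift-*ᵥ l H x i = ≈-trans (dot-combˡ l (δ i) (- 1#) (H i) x) (+-cong (*-congˡ (dot-δ i x)) (-1*x≈-x _))

  shift-form : ∀ l (H : Matrix n) x → form (shift l H) x x ≈ l * dot x x - form H x x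
  shift-form l H x = ≈-trans (dot-congʳ {x = x} λ i → ≈-trans (shift-*ᵥ l H x i) (+-congˡ (≈-sym (-1*x≈-x _))))
    (≈-trans (dot-combʳ x l x (- 1#) (H *ᵥ x)) (+-congˡ (-1*x≈-x _)))

  shift-sym : ∀ l {H : Matrix n} → Symmetric H → Symmetric (shift l H)
  shift-sym l H-sym i j = +-cong (*-congˡ (≈-reflexive (δ-sym i j))) (*-congˡ (H-sym i j))

  -- Where a nonnegative form vanishes its gradient vanishes too: otherwise a step from x in
  -- direction -Ax would make the form negative. The vector (K + 1)x - N y is x - (N/(K + 1)) y
  -- cleared of its denominator.
  semidefinite-kernel : ∀ (A : Matrix n) → Symmetric A → (∀ x → 0# ≤ form A x x) →
    ∀ x → form A x x ≤ 0# → ∀ i → (A *ᵥ x) i ≈ 0#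
  semidefinite-kernel A A-sym A≥0 x Ax≤0 = dot≈0⇒≈0 y N≈0
    where
    y = A *ᵥ x
    N = dot y y
    K = form A y y
    value : form A (comb (K + 1#) x (- N) y) (comb (K + 1#) x (- N) y) ≈ - (N * N * (fromℕ 2 * 1# + K))
    value = begin
      _ ≈⟨ form-comb A A-sym (K + 1#) x (- N) y ⟩
      (K + 1#) * (K + 1#) * form A x x + fromℕ 2 * ((K + 1#) * - N) * form A x y + - N * - N * K
        ≈⟨ +-congʳ (+-cong (*-congˡ (≤-antisym Ax≤0 (A≥0 x))) (*-congˡ (form-sym A A-sym x y))) ⟩
      (K + 1#) * (K + 1#) * 0# + fromℕ 2 * ((K + 1#) * - N) * N + - N * - N * K
        ≈⟨ solve 3 (λ K N o → (K :+ o) :* (K :+ o) :* con (+ 0) :+ con (+ 2) :* ((K :+ o) :* :- N) :* N :+ :- N :* :- N :* K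
             := :- (N :* N :* (con (+ 2) :* o :+ K))) ≈-refl K N 1# ⟩
      - (N * N * (fromℕ 2 * 1# + K)) ∎
    N≈0 : N ≈ 0#
    N≈0 with em {N ≈ 0#}
    ... | yes N≈0 = N≈0
    ... | no  N≉0 = contradiction (≤-diff (≤-respʳ value (A≥0 _)) (+-identityˡ _))
      (<⇒≱ (*-pos (square-pos N≉0) (+-pos-nonNeg (*-pos (fromℕ-pos 1) 0<1) (A≥0 y))))

  -- The largest eigenvalue is the least l such that lI − H is positive
  -- semidefinite: there lI − H cannot be coercive, so it has a kernel.
  positive-eigenpair : ∀ (H : Matrix n) → Symmetric H → ∃[ x ] 0# < form H x x →
    ∃[ l ] ∃[ u ] 0# < l × Eigenpair H l u
  positive-eigenpair H H-sym (z , 0<Qz) = conclude (isotropic⊎coercive A (shift-sym l H-sym))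
    where
    P : Carrier → Set
    P m = ∀ x → m * dot x x + form H x x ≤ 0#
    inhabited : ∃ P
    inhabited = - proj₁ (form-bound H) , λ x → ≤-diff (0≤y-x (proj₂ (form-bound H) x))
      (solve 3 (λ L X Q → con (+ 0) :- (:- L :* X :+ Q) := L :* X :- Q) ≈-refl _ _ _)
    0<Z : 0# < dot z z
    0<Z = ≤∧≉⇒< (dot-nonNeg z) λ Z≈0 → <⇒≉ 0<Qz
      (≈-trans (dot-comm z (H *ᵥ z)) (dot-zeroʳ (H *ᵥ z) (dot≈0⇒≈0 z Z≈0)))
    bounded : ∃ (UpperBound P)
    bounded = 0# , λ m Pm → *-cancelˡ-≤ (dot z z) 0<Z (≤-diff (+-nonNeg (<⇒≤ 0<Qz) (neg-nonNeg (Pm z)))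
      (solve 3 (λ Z m Q → Z :* con (+ 0) :- Z :* m := Q :+ :- (m :* Z :+ Q)) ≈-refl _ _ _))
    s = sup P
    l = - s
    A = shift l H
    -- For fixed nonzero x the condition on m is the closed bound m ≤ -Q(x)/|x|², so it passes to
    -- the supremum.
    Ps : P s
    Ps x with em {dot x x ≈ 0#}
    ... | yes X≈0 = ≤-reflexive (≈-trans (+-cong (≈-trans (*-congˡ X≈0) (zeroʳ s))
            (≈-trans (dot-comm x (H *ᵥ x)) (dot-zeroʳ (H *ᵥ x) (dot≈0⇒≈0 x X≈0)))) (+-identityˡ 0#))
    ... | no  X≉0 = ≤-diff (0≤y-x (*-monoʳ-≤ X (dot-nonNeg x) (sup-least P inhabited bounded (- Q * X ⁻¹) upper)))
          (begin
            0# - (s * X + Q)           ≈⟨ solve 3 (λ s X Q → con (+ 0) :- (s :* X :+ Q) := :- Q :- X :* s) ≈-refl s X Q ⟩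
            - Q - X * s                ≈⟨ +-congʳ (scale (- Q)) ⟨
            X * (- Q * X ⁻¹) - X * s   ∎)
      where
      X = dot x x
      Q = form H x x
      scale : ∀ q → X * (q * X ⁻¹) ≈ q
      scale q = ≈-trans (solve 3 (λ X q i → X :* (q :* i) := (X :* i) :* q) ≈-refl X q (X ⁻¹))
        (≈-trans (*-congʳ (*-inverseʳ X X≉0)) (*-identityˡ q))
      upper : UpperBound P (- Q * X ⁻¹)
      upper m Pm = *-cancelˡ-≤ X (≤∧≉⇒< (dot-nonNeg x) X≉0) (≤-diff (neg-nonNeg (Pm x))
        (≈-trans (+-congʳ (scale (- Q))) (solve 3 (λ X m Q → :- Q :- X :* m := :- (m :* X :+ Q)) ≈-refl X m Q)))
    A≥0 : ∀ x → 0# ≤ form A x x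
    A≥0 x = ≤-respʳ (≈-trans (solve 3 (λ s X Q → :- (s :* X :+ Q) := :- s :* X :- Q) ≈-refl s _ _) (≈-sym (shift-form l H x)))
      (neg-nonNeg (Ps x))
    0<l : 0# < l
    0<l = ≰⇒> λ l≤0 → <⇒≱ 0<Qz (≤-diff (+-nonNeg (neg-nonNeg (Ps z)) (*-nonNeg (neg-nonNeg l≤0) (<⇒≤ 0<Z)))
      (solve 3 (λ s Z Q → con (+ 0) :- Q := :- (s :* Z :+ Q) :+ :- (:- s) :* Z) ≈-refl s _ _))
    conclude : (∃[ x ] Nonzero x × form A x x ≤ 0#) ⊎ (∃[ C ] 0# < C × (∀ x → dot x x ≤ C * form A x x)) →
      ∃[ l ] ∃[ u ] 0# < l × Eigenpair H l u
    conclude (inj₁ (u , u≉0 , Au≤0)) = l , u , 0<l , record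
      { nonzero = u≉0
      ; eigen   = λ i → ≈-trans (solve 2 (λ h m → h := m :- (m :- h)) ≈-refl _ (l * u i))
          (≈-trans (+-congˡ (-‿cong (≈-trans (≈-sym (shift-*ᵥ l H u i)) (semidefinite-kernel A (shift-sym l H-sym) A≥0 u Au≤0 i))))
          (solve 1 (λ m → m :- con (+ 0) := m) ≈-refl _))
      }
    -- Coercivity leaves room: A - C⁻¹I is still semidefinite, so s + C⁻¹ would lie in `P` beyond
    -- its supremum.
    conclude (inj₂ (C , 0<C , bound)) = contradiction (sup-upper P inhabited bounded (s + C ⁻¹) larger)
        (<⇒≱ (≤-diff (<⇒≤ (⁻¹-pos 0<C)) (solve 2 (λ s c → s :+ c :- s := c) ≈-refl s (C ⁻¹)) ,
              λ eq → <⇒≉ (⁻¹-pos 0<C) (≈-trans (solve 2 (λ s c → c := s :+ c :- s) ≈-refl s (C ⁻¹))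
                (≈-trans (+-congʳ (≈-sym eq)) (-‿inverseʳ s)))))
      where
      larger : P (s + C ⁻¹)
      larger x = *-cancelˡ-≤ C 0<C (≤-diff (0≤y-x (bound x)) (begin
        C * 0# - C * ((s + C ⁻¹) * X + Q)
          ≈⟨ solve 5 (λ C s c X Q → C :* con (+ 0) :- C :* ((s :+ c) :* X :+ Q) := C :* (:- s :* X :- Q) :- (C :* c) :* X) ≈-refl C s (C ⁻¹) X Q ⟩
        C * (- s * X - Q) - (C * C ⁻¹) * X
          ≈⟨ +-cong (*-congˡ (≈-sym (shift-form l H x))) (-‿cong (≈-trans (*-congʳ (*-inverseʳ C (<⇒≉ 0<C))) (*-identityˡ X))) ⟩
        C * form A x x - X ∎))
        where
        X = dot x x
        Q = form H x x

  -- The deflation W H - l w wᵀ annihilates w and agrees with W H as a form on the complement of w.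
  -- A positive value of it would yield an eigenvector u with positive eigenvalue; u is orthogonal
  -- to w, hence a second positive eigenvector of H independent of w.
  negative-hyperplane : ∀ (H : Matrix n) → Symmetric H → AtMostOnePositiveEigenvalue H →
    ∃[ w ] ∀ x → dot w x ≈ 0# → form H x x ≤ 0#
  negative-hyperplane H H-sym amo with em {∃[ x ] 0# < form H x x}
  -- If the form is nowhere positive, the whole space serves, as the complement of the zero vector.
  ... | no  none = (λ _ → 0#) , λ x _ → nonPos x
    where
    nonPos : ∀ x → form H x x ≤ 0#
    nonPos x with em {form H x x ≤ 0#}
    ... | yes p = p
    ... | no ¬p = contradiction (x , ≰⇒> ¬p) none
  ... | yes some with positive-eigenpair H H-sym some
  ... | l , w , 0<l , w-eigen = w , negative
    where
    W = dot w w
    0<W : 0# < W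
    0<W = dot-pos w (Eigenpair.nonzero w-eigen)
    H′ = rankOne W H l w
    H′-sym : Symmetric H′
    H′-sym = rankOne-sym W l w H-sym
    H′w≈0 : ∀ i → (H′ *ᵥ w) i ≈ 0#
    H′w≈0 i = ≈-trans (rankOne-*ᵥ W H l w w i) (≈-trans (+-congʳ (*-congˡ (Eigenpair.eigen w-eigen i)))
      (solve 3 (λ W l w → W :* (l :* w) :- l :* W :* w := con (+ 0)) ≈-refl W l (w i)))
    orthogonal : ∀ {m u} → 0# < m → Eigenpair H′ m u → dot w u ≈ 0#
    orthogonal {m} {u} 0<m u-eigen = *-cancelˡ-0 (<⇒≉ 0<m) (begin
      m * dot w u                  ≈⟨ solve 2 (λ m d → m :* d := m :* d :+ con (+ 0) :* d) ≈-refl m _ ⟩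
      m * dot w u + 0# * dot w u   ≈⟨ dot-combʳ w m u 0# u ⟨
      dot w (comb m u 0# u)        ≈⟨ dot-congʳ {x = w} (λ i → ≈-trans (solve 2 (λ m d → m :* d :+ con (+ 0) :* d := m :* d) ≈-refl m (u i))
                                        (≈-sym (Eigenpair.eigen u-eigen i))) ⟩
      form H′ w u                  ≈⟨ form-sym H′ H′-sym w u ⟩
      form H′ u w                  ≈⟨ dot-zeroʳ u H′w≈0 ⟩
      0#                           ∎)
    undeflate : ∀ {m u} → dot w u ≈ 0# → Eigenpair H′ m u → Eigenpair H (m * W ⁻¹) u
    undeflate {m} {u} w⊥u u-eigen = record
      { nonzero = Eigenpair.nonzero u-eigen
      ; eigen   = λ i → *-cancelˡ-≈ W (<⇒≉ 0<W) (begin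
          W * (H *ᵥ u) i                      ≈⟨ solve 2 (λ a b → a := a :- con (+ 0) :* b) ≈-refl _ (w i) ⟩
          W * (H *ᵥ u) i - 0# * w i           ≈⟨ +-congˡ (-‿cong (*-congʳ (≈-sym (≈-trans (*-congˡ w⊥u) (zeroʳ l))))) ⟩
          W * (H *ᵥ u) i - l * dot w u * w i  ≈⟨ rankOne-*ᵥ W H l w u i ⟨
          (H′ *ᵥ u) i                         ≈⟨ Eigenpair.eigen u-eigen i ⟩
          m * u i                             ≈⟨ *-identityˡ _ ⟨
          1# * (m * u i)                      ≈⟨ *-congʳ (*-inverseʳ W (<⇒≉ 0<W)) ⟨
          (W * W ⁻¹) * (m * u i)              ≈⟨ solve 4 (λ W i m u → (W :* i) :* (m :* u) := W :* (m :* i :* u)) ≈-refl W (W ⁻¹) m (u i) ⟩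
          W * (m * W ⁻¹ * u i)                ∎)
      }
    independent : ∀ {u s t} → dot w u ≈ 0# → Nonzero u → (∀ i → s * w i + t * u i ≈ 0#) → (s ≈ 0#) × (t ≈ 0#)
    independent {u} {s} {t} w⊥u u≉0 eq =
      *-cancelˡ-0 (<⇒≉ 0<W) (≈-trans (≈-trans (solve 3 (λ W s t → W :* s := s :* W :+ t :* con (+ 0)) ≈-refl W s t)
        (+-congˡ (*-congˡ (≈-sym w⊥u)))) (≈-trans (≈-sym (dot-combʳ w s w t u)) (dot-zeroʳ w eq))) ,
      *-cancelˡ-0 (<⇒≉ (dot-pos u u≉0)) (≈-trans (≈-trans (solve 3 (λ U s t → U :* t := s :* con (+ 0) :+ t :* U) ≈-refl _ s t)
        (+-congʳ (*-congˡ (≈-sym (≈-trans (dot-comm u w) w⊥u))))) (≈-trans (≈-sym (dot-combʳ u s w t u)) (dot-zeroʳ u eq)))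
    no-second-eigenpair : ∀ {m u} → 0# < m → ¬ Eigenpair H′ m u
    no-second-eigenpair {m} {u} 0<m u-eigen =
      refute (amo l (m * W ⁻¹) w u 0<l (*-pos 0<m (⁻¹-pos 0<W)) w-eigen (undeflate w⊥u u-eigen))
      where
      w⊥u : dot w u ≈ 0#
      w⊥u = orthogonal 0<m u-eigen
      refute : ¬ (∃[ s ] ∃[ t ] (s ≉ 0# ⊎ t ≉ 0#) × (∀ i → s * w i + t * u i ≈ 0#))
      refute (s , t , inj₁ s≉0 , dependent) = s≉0 (proj₁ (independent w⊥u (Eigenpair.nonzero u-eigen) dependent))
      refute (s , t , inj₂ t≉0 , dependent) = t≉0 (proj₂ (independent w⊥u (Eigenpair.nonzero u-eigen) dependent))
    no-second : ¬ (∃[ x ] 0# < form H′ x x)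
    no-second some′ = let m , u , 0<m , u-eigen = positive-eigenpair H′ H′-sym some′ in no-second-eigenpair 0<m u-eigen
    negative : ∀ x → dot w x ≈ 0# → form H x x ≤ 0#
    negative x w⊥x with em {form H x x ≤ 0#}
    ... | yes p = p
    ... | no ¬p = contradiction (x , <-≤-trans (*-pos 0<W (≰⇒> ¬p)) (≤-reflexive (≈-sym
          (≈-trans (rankOne-form W H l w x x) (≈-trans (+-congˡ (-‿cong (*-congˡ (≈-trans (*-congʳ w⊥x) (zeroˡ _)))))
            (solve 2 (λ a l → a :- l :* con (+ 0) := a) ≈-refl _ l)))))) no-second

-- Addition and degree of multi-indices

⊕-assoc : ∀ {n} (α β γ : Vec ℕ n) → α ⊕ β ⊕ γ ≡ α ⊕ (β ⊕ γ)
⊕-assoc = zipWith-assoc ℕ.+-assoc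

⊕-comm : ∀ {n} (α β : Vec ℕ n) → α ⊕ β ≡ β ⊕ α
⊕-comm = zipWith-comm ℕ.+-comm

⊕-e-comm : ∀ {n} (α : Vec ℕ n) i j → α ⊕ e i ⊕ e j ≡ α ⊕ e j ⊕ e i
⊕-e-comm α i j = ≡.trans (⊕-assoc α (e i) (e j))
  (≡.trans (≡.cong (α ⊕_) (⊕-comm (e i) (e j))) (≡.sym (⊕-assoc α (e j) (e i))))

∣⊕e⊕e∣ : ∀ {n} (β : Vec ℕ n) i j → ∣ β ⊕ e i ⊕ e j ∣ ≡ ∣ β ∣ ℕ.+ 2
∣⊕e⊕e∣ β i j = ≡.trans (∣⊕∣ (β ⊕ e i) (e j)) (≡.trans (≡.cong₂ ℕ._+_ (∣⊕∣ β (e i)) (∣e∣ j))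
  (≡.trans (≡.cong (λ k → ∣ β ∣ ℕ.+ k ℕ.+ 1) (∣e∣ i)) (ℕ.+-assoc ∣ β ∣ 1 1)))

-- Inequalities between entries of a Lorentzian Hessian

module QuadraticInequalities (em : ExcludedMiddle 0ℓ) (R : CompleteOrderedField) where
  open OrderedField em R hiding (zero)
  open Lorentzian R
  open LinearAlgebra em R
  open Spectral em R
  open SetoidReasoning setoid

  -- Choose z = s x + t y in the negative hyperplane. Then a Q(z) = (s a + t b)² - t²(b² - a c), so
  -- Q(z) ≤ 0 forces a c ≤ b² once t ≠ 0; and t = 0 would put x itself into the hyperplane.
  reverse-Cauchy-Schwarz : ∀ (H : Matrix n) → Symmetric H → AtMostOnePositiveEigenvalue H →
    ∀ x y → 0# < form H x x → form H x x * form H y y ≤ form H x y * form H x y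
  reverse-Cauchy-Schwarz H H-sym amo x y 0<xx with negative-hyperplane H H-sym amo
  ... | w , negative = *-cancelˡ-≤ (t * t) (square-pos t≉0)
          (≤-diff (+-nonNeg (square-nonNeg (s * a + t * b)) (*-nonNeg (<⇒≤ 0<xx) (neg-nonNeg (negative z w⊥z))))
          (begin
            t * t * (b * b) - t * t * (a * c)
              ≈⟨ solve 5 (λ s t a b c → t :* t :* (b :* b) :- t :* t :* (a :* c) :=
                   (s :* a :+ t :* b) :* (s :* a :+ t :* b)
                   :+ a :* :- (s :* s :* a :+ con (+ 2) :* (s :* t) :* b :+ t :* t :* c)) ≈-refl s t a b c ⟩
            (s * a + t * b) * (s * a + t * b) + a * - (s * s * a + fromℕ 2 * (s * t) * b + t * t * c)
              ≈⟨ +-congˡ (*-congˡ (-‿cong (form-comb H H-sym s x t y))) ⟨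
            (s * a + t * b) * (s * a + t * b) + a * - form H z z ∎))
    where
    s = dot w y
    t = - dot w x
    a = form H x x
    b = form H x y
    c = form H y y
    z = comb s x t y
    w⊥z : dot w z ≈ 0#
    w⊥z = ≈-trans (dot-combʳ w s x t y) (solve 2 (λ p q → q :* p :+ :- p :* q := con (+ 0)) ≈-refl _ _)
    t≉0 : t ≉ 0#
    t≉0 t≈0 = <⇒≱ 0<xx (negative x (≈-trans (solve 1 (λ p → p := :- (:- p)) ≈-refl _)
      (≈-trans (-‿cong t≈0) (solve 0 (:- con (+ 0) := con (+ 0)) ≈-refl))))

  form-δδ : ∀ (H : Matrix n) i j → form H (δ i) (δ j) ≈ H i j
  form-δδ H i j = ≈-trans (dot-δ i (H *ᵥ δ j)) (≈-trans (dot-comm (H i) (δ j)) (dot-δ j (H i)))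

  form-δ-pair : ∀ (H : Matrix n) i r k s l → form H (δ i) (comb r (δ k) s (δ l)) ≈ r * H i k + s * H i l
  form-δ-pair H i r k s l = ≈-trans (form-combʳ H (δ i) r (δ k) s (δ l))
    (+-cong (*-congˡ (form-δδ H i k)) (*-congˡ (form-δδ H i l)))

  form-pair-pair : ∀ (H : Matrix n) p i q j r k s l →
    form H (comb p (δ i) q (δ j)) (comb r (δ k) s (δ l)) ≈
    p * (r * H i k + s * H i l) + q * (r * H j k + s * H j l)
  form-pair-pair H p i q j r k s l = ≈-trans (form-combˡ H p (δ i) q (δ j) _)
    (+-cong (*-congˡ (form-δ-pair H i r k s l)) (*-congˡ (form-δ-pair H j r k s l)))

  module _ (H : Matrix n) (H-sym : Symmetric H) (amo : AtMostOnePositiveEigenvalue H)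
           (H-pos : ∀ i j → 0# < H i j) where

    private
      H≥0 : ∀ i j → 0# ≤ H i j
      H≥0 i j = <⇒≤ (H-pos i j)

    three-term : ∀ i j k → H i i * H j k ≤ fromℕ 2 * (H i j * H i k)
    three-term i j k = *-cancelˡ-≤ (fromℕ 2 * (r * s)) (*-pos (fromℕ-pos 1) (*-pos (H-pos i k) (H-pos i j)))
      (≤-diff (+-nonNeg (0≤y-x cs) (*-nonNeg (H≥0 i i)
          (+-nonNeg (*-nonNeg (square-nonNeg r) (H≥0 j j)) (*-nonNeg (square-nonNeg s) (H≥0 k k)))))
        (solve 6 (λ r s a b c d →
           con (+ 2) :* (r :* s) :* (con (+ 2) :* (s :* r)) :- con (+ 2) :* (r :* s) :* (a :* b) :=
           ((r :* s :+ s :* r) :* (r :* s :+ s :* r) :- a :* (r :* (r :* c :+ s :* b) :+ s :* (r :* b :+ s :* d)))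
           :+ a :* (r :* r :* c :+ s :* s :* d)) ≈-refl r s (H i i) (H j k) (H j j) (H k k)))
      where
      r = H i k
      s = H i j
      -- These weights make both terms of H(eᵢ, y) equal to r s. Dropping the diagonal terms leaves
      -- 2 r s Hⱼₖ ≤ H(y, y), so the square 4 r² s² divided by 2 r s leaves the factor 2.
      y = comb r (δ j) s (δ k)
      cs : H i i * (r * (r * H j j + s * H j k) + s * (r * H j k + s * H k k)) ≤ (r * s + s * r) * (r * s + s * r)
      cs = ≤-respˡ (*-cong (form-δδ H i i) (≈-trans (form-pair-pair H r j s k r j s k)
               (+-congˡ (*-congˡ (+-congʳ (*-congˡ (H-sym k j)))))))
             (≤-respʳ (*-cong (form-δ-pair H i r j s k) (form-δ-pair H i r j s k))
               (reverse-Cauchy-Schwarz H H-sym amo (δ i) y (<-≤-trans (H-pos i i) (≤-reflexive (≈-sym (form-δδ H i i))))))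

    module _ (i j k l : Fin n) where
      private
        a = H i k * H j l
        b = H i j * H k l
        c = H i l * H j k

      -- The coefficients of the two test vectors p eᵢ + q eₖ and
      -- β eⱼ + α eₗ minimise the discrepancy in reverse Cauchy–Schwarz up
      -- to a constant, without extracting square roots.
      four-term-square : fromℕ 4 * (a * a) ≤ (a + fromℕ 4 * b) * (a + fromℕ 4 * c)
      four-term-square = *-cancelˡ-≤ (H i j * H i l) (*-pos (H-pos i j) (H-pos i l))
        (≤-diff (0≤y-x αβ≥) (solve 6 (λ ij il jk kl ik jl →
             ij :* il :* ((ik :* jl :+ con (+ 4) :* (ij :* kl)) :* (ik :* jl :+ con (+ 4) :* (il :* jk)))
               :- ij :* il :* (con (+ 4) :* ((ik :* jl) :* (ik :* jl))) :=
             ((ik :* jl) :* ij :+ (con (+ 4) :* (ij :* il)) :* jk) :* ((ik :* jl) :* il :+ (con (+ 4) :* (ij :* il)) :* kl)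
               :- (ik :* jl) :* (con (+ 4) :* (ij :* il)) :* (ik :* jl))
             ≈-refl (H i j) (H i l) (H j k) (H k l) (H i k) (H j l)))
        where
        p = a
        q = fromℕ 4 * (H i j * H i l)
        α = p * H i j + q * H j k
        β = p * H i l + q * H k l
        x = comb p (δ i) q (δ k)
        y = comb β (δ j) α (δ l)
        0<p : 0# < p
        0<p = *-pos (H-pos i k) (H-pos j l)
        0<q : 0# < q
        0<q = *-pos (fromℕ-pos 3) (*-pos (H-pos i j) (H-pos i l))
        0<α : 0# < α
        0<α = +-pos-nonNeg (*-pos 0<p (H-pos i j)) (*-nonNeg (<⇒≤ 0<q) (H≥0 j k))
        0<β : 0# < β
        0<β = +-pos-nonNeg (*-pos 0<p (H-pos i l)) (*-nonNeg (<⇒≤ 0<q) (H≥0 k l))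
        form-diag-≥ : ∀ r s i j → 0# ≤ r → 0# ≤ s →
          fromℕ 2 * (r * s) * H i j ≤ form H (comb r (δ i) s (δ j)) (comb r (δ i) s (δ j))
        form-diag-≥ r s i j 0≤r 0≤s = ≤-diff
          (+-nonNeg (*-nonNeg (square-nonNeg r) (H≥0 i i)) (*-nonNeg (square-nonNeg s) (H≥0 j j)))
          (≈-trans (+-congʳ (≈-trans (form-pair-pair H r i s j r i s j) (+-congˡ (*-congˡ (+-congʳ (*-congˡ (H-sym j i)))))))
            (solve 5 (λ r s ii ij jj → r :* (r :* ii :+ s :* ij) :+ s :* (r :* ij :+ s :* jj) :- con (+ 2) :* (r :* s) :* ij :=
               r :* r :* ii :+ s :* s :* jj) ≈-refl r s (H i i) (H i j) (H j j)))
        -- α and β are the values of H(x, ·) at eⱼ and eₗ; attaching each to the other vector makes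
        -- both terms of H(x, y) equal to α β.
        xy≈ : form H x y ≈ fromℕ 2 * (α * β)
        xy≈ = ≈-trans (form-pair-pair H p i q k β j α l) (≈-trans (+-congˡ (*-congˡ (+-congʳ (*-congˡ (H-sym k j)))))
          (solve 6 (λ p q ij il jk kl →
             let α = p :* ij :+ q :* jk; β = p :* il :+ q :* kl in
             p :* (β :* ij :+ α :* il) :+ q :* (β :* jk :+ α :* kl) := con (+ 2) :* (α :* β)) ≈-refl
             p q (H i j) (H i l) (H j k) (H k l)))
        0<2pq : 0# < fromℕ 2 * (p * q) * H i k
        0<2pq = *-pos (*-pos (fromℕ-pos 1) (*-pos 0<p 0<q)) (H-pos i k)
        0<xx : 0# < form H x x
        0<xx = <-≤-trans 0<2pq (form-diag-≥ p q i k (<⇒≤ 0<p) (<⇒≤ 0<q))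
        cs : (fromℕ 2 * (p * q) * H i k) * (fromℕ 2 * (β * α) * H j l) ≤ (fromℕ 2 * (α * β)) * (fromℕ 2 * (α * β))
        cs = ≤-trans (*-mono-≤ (<⇒≤ 0<2pq)
               (≤-trans (*-nonNeg (*-nonNeg (fromℕ-nonNeg 2) (*-nonNeg (<⇒≤ 0<β) (<⇒≤ 0<α))) (H≥0 j l)) yy≥) (form-diag-≥ p q i k (<⇒≤ 0<p) (<⇒≤ 0<q)) yy≥)
             (≤-respʳ (*-cong xy≈ xy≈) (reverse-Cauchy-Schwarz H H-sym amo x y 0<xx))
          where
          yy≥ = form-diag-≥ β α j l (<⇒≤ 0<β) (<⇒≤ 0<α)
        αβ≥ : p * q * a ≤ α * β
        αβ≥ = *-cancelˡ-≤ (fromℕ 4 * (α * β)) (*-pos (fromℕ-pos 3) (*-pos 0<α 0<β)) (≤-diff (0≤y-x cs)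
          (solve 6 (λ α β p q ik jl →
             con (+ 4) :* (α :* β) :* (α :* β) :- con (+ 4) :* (α :* β) :* (p :* q :* (ik :* jl)) :=
             (con (+ 2) :* (α :* β)) :* (con (+ 2) :* (α :* β)) :- (con (+ 2) :* (p :* q) :* ik) :* (con (+ 2) :* (β :* α) :* jl))
             ≈-refl α β p q (H i k) (H j l)))

      -- If a exceeded both 4b and 4c, each factor in `four-term-square` would be below 2a. The
      -- constant 4 is read off from b = c = a/4, where both sides of that inequality agree.
      four-term : a ≤ fromℕ 4 * b ⊎ a ≤ fromℕ 4 * c
      four-term with em {a ≤ fromℕ 4 * b} | em {a ≤ fromℕ 4 * c}
      ... | yes p | _     = inj₁ p
      ... | no  _ | yes q = inj₂ q
      ... | no ¬p | no ¬q = contradiction four-term-square (<⇒≱ (≤-diff (<⇒≤ 0<z) eq , λ same → <⇒≉ 0<z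
              (≈-trans (≈-sym eq) (≈-trans (+-congˡ (-‿cong same)) (-‿inverseʳ _)))))
        where
        pos-diff : ∀ {x y} → ¬ (y ≤ x) → 0# < y - x
        pos-diff {x} {y} y≰x = ≤∧≉⇒< (0≤y-x (<⇒≤ (≰⇒> y≰x))) λ z → y≰x (≤-reflexive
          (≈-trans (solve 2 (λ x y → y := (y :- x) :+ x) ≈-refl x y) (≈-trans (+-congʳ z) (+-identityˡ x))))
        0<a : 0# < a
        0<a = *-pos (H-pos i k) (H-pos j l)
        z = (a - fromℕ 4 * b) * (a + fromℕ 4 * c) + fromℕ 2 * a * (a - fromℕ 4 * c)
        0<z : 0# < z
        0<z = +-pos-nonNeg (*-pos (pos-diff ¬p) (+-pos-nonNeg 0<a (*-nonNeg (fromℕ-nonNeg 4) (*-nonNeg (H≥0 i l) (H≥0 j k)))))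
          (*-nonNeg (*-nonNeg (fromℕ-nonNeg 2) (<⇒≤ 0<a)) (<⇒≤ (pos-diff ¬q)))
        eq : fromℕ 4 * (a * a) - (a + fromℕ 4 * b) * (a + fromℕ 4 * c) ≈ z
        eq = solve 3 (λ a b c → con (+ 4) :* (a :* a) :- (a :+ con (+ 4) :* b) :* (a :+ con (+ 4) :* c) :=
               (a :- con (+ 4) :* b) :* (a :+ con (+ 4) :* c) :+ con (+ 2) :* a :* (a :- con (+ 4) :* c)) ≈-refl a b c

  atMostOne-cong : ∀ {H H′ : Matrix n} → (∀ i j → H i j ≈ H′ i j) →
    AtMostOnePositiveEigenvalue H → AtMostOnePositiveEigenvalue H′
  atMostOne-cong H≈H′ amo l m u v 0<l 0<m u-eigen v-eigen = amo l m u v 0<l 0<m (back u-eigen) (back v-eigen)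
    where
    back : ∀ {l u} → Eigenpair _ l u → Eigenpair _ l u
    back p = record
      { nonzero = Eigenpair.nonzero p
      ; eigen   = λ i → ≈-trans (dot-cong (H≈H′ i) (λ _ → ≈-refl)) (Eigenpair.eigen p i)
      }

-- The bound 64

module UpperBound (em : ExcludedMiddle 0ℓ) (R : CompleteOrderedField) where
  open OrderedField em R hiding (zero)
  open Lorentzian R
  open LinearAlgebra em R using (Symmetric)
  open QuadraticInequalities em R

  ∣base∣ : ∀ {d} → 4 ℕ.≤ d → ∀ v → ∣ v ∣ ≡ 4 → ∣ base d ⊕ v ∣ ≡ d
  ∣base∣ {d} 4≤d v ∣v∣≡4 = ≡.trans (∣⊕∣ (base d) v) (≡.trans
    (≡.cong₂ ℕ._+_ (≡.trans (≡.cong (⌊ d ∸ 4 /2⌋ ℕ.+_) (ℕ.+-identityʳ _)) (ℕ.⌊n/2⌋+⌈n/2⌉≡n (d ∸ 4))) ∣v∣≡4)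
    (ℕ.m∸n+n≡m 4≤d))

  ∣base∣₂ : ∀ {d} → 4 ℕ.≤ d → ∀ v → ∣ v ∣ ≡ 2 → ∣ base d ⊕ v ∣ ≡ d ∸ 2
  ∣base∣₂ {d} 4≤d v ∣v∣≡2 = ≡.trans (∣⊕∣ (base d) v) (≡.trans
    (≡.cong₂ ℕ._+_ (≡.trans (≡.cong (⌊ d ∸ 4 /2⌋ ℕ.+_) (ℕ.+-identityʳ _)) (ℕ.⌊n/2⌋+⌈n/2⌉≡n (d ∸ 4))) ∣v∣≡2)
    (lemma 4≤d))
    where
    lemma : ∀ {d} → 4 ℕ.≤ d → d ∸ 4 ℕ.+ 2 ≡ d ∸ 2
    lemma (ℕ.s≤s (ℕ.s≤s (ℕ.s≤s (ℕ.s≤s {n = k} _)))) = ℕ.+-comm k 2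

  private
    -- In the product of the five hypotheses the auxiliary coefficients occur equally often on both
    -- sides, k₁ twice and k₂, ..., k₆ once, and the constants multiply to 4 · 2⁴. The factors `1#`
    -- are the ends of the folds `∏`.
    chain : ∀ {d₁ d₂ d₃ n₁ n₂ n₃ k₁ k₂ k₃ k₄ k₅ k₆} →
      0# < k₁ → 0# < k₂ → 0# < k₃ → 0# < k₄ → 0# < k₅ → 0# < k₆ →
      0# ≤ d₁ → 0# ≤ d₂ → 0# ≤ d₃ → 0# ≤ n₁ → 0# ≤ n₂ → 0# ≤ n₃ →
      k₁ * n₃ ≤ fromℕ 4 * (k₂ * k₃) →
      k₄ * k₂ ≤ fromℕ 2 * (d₃ * k₁) →
      n₂ * k₁ ≤ fromℕ 2 * (k₅ * k₆) →
      n₁ * k₅ ≤ fromℕ 2 * (d₁ * k₄) →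
      k₆ * k₃ ≤ fromℕ 2 * (k₁ * d₂) →
      n₁ * (n₂ * (n₃ * 1#)) ≤ fromℕ 64 * (d₁ * (d₂ * (d₃ * 1#)))
    chain {d₁} {d₂} {d₃} {n₁} {n₂} {n₃} {k₁} {k₂} {k₃} {k₄} {k₅} {k₆}
      0<k₁ 0<k₂ 0<k₃ 0<k₄ 0<k₅ 0<k₆ 0≤d₁ 0≤d₂ 0≤d₃ 0≤n₁ 0≤n₂ 0≤n₃ p₁ p₂ p₃ p₄ p₅ =
      *-cancelˡ-≤ (k₁ * k₂ * k₃ * (k₄ * k₅ * k₆ * k₁))
        (*-pos (*-pos (*-pos 0<k₁ 0<k₂) 0<k₃) (*-pos (*-pos (*-pos 0<k₄ 0<k₅) 0<k₆) 0<k₁))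
        (≤-diff (0≤y-x product) (+-cong
          (solve 10 (λ d₁ d₂ d₃ k₁ k₂ k₃ k₄ k₅ k₆ o →
            k₁ :* k₂ :* k₃ :* (k₄ :* k₅ :* k₆ :* k₁) :* (con (+ 64) :* (d₁ :* (d₂ :* (d₃ :* o)))) :=
            (con (+ 4) :* (k₂ :* k₃)) :* ((con (+ 2) :* (d₃ :* k₁)) :* ((con (+ 2) :* (k₅ :* k₆)) :* ((con (+ 2) :* (d₁ :* k₄)) :* (con (+ 2) :* (k₁ :* d₂))))) :* o)
            ≈-refl d₁ d₂ d₃ k₁ k₂ k₃ k₄ k₅ k₆ 1# )
          (-‿cong (solve 10 (λ n₁ n₂ n₃ k₁ k₂ k₃ k₄ k₅ k₆ o →
            k₁ :* k₂ :* k₃ :* (k₄ :* k₅ :* k₆ :* k₁) :* (n₁ :* (n₂ :* (n₃ :* o))) :=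
            (k₁ :* n₃) :* ((k₄ :* k₂) :* ((n₂ :* k₁) :* ((n₁ :* k₅) :* (k₆ :* k₃)))) :* o)
            ≈-refl n₁ n₂ n₃ k₁ k₂ k₃ k₄ k₅ k₆ 1#))))
      where
      0≤k₁ = <⇒≤ 0<k₁
      0≤k₂ = <⇒≤ 0<k₂
      0≤k₃ = <⇒≤ 0<k₃
      0≤k₄ = <⇒≤ 0<k₄
      0≤k₅ = <⇒≤ 0<k₅
      0≤k₆ = <⇒≤ 0<k₆
      0≤2 = fromℕ-nonNeg 2
      0≤r₅ = *-nonNeg 0≤2 (*-nonNeg 0≤k₁ 0≤d₂)
      0≤r₄ = *-nonNeg (*-nonNeg 0≤2 (*-nonNeg 0≤d₁ 0≤k₄)) 0≤r₅
      0≤r₃ = *-nonNeg (*-nonNeg 0≤2 (*-nonNeg 0≤k₅ 0≤k₆)) 0≤r₄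
      0≤r₂ = *-nonNeg (*-nonNeg 0≤2 (*-nonNeg 0≤d₃ 0≤k₁)) 0≤r₃
      product : (k₁ * n₃) * ((k₄ * k₂) * ((n₂ * k₁) * ((n₁ * k₅) * (k₆ * k₃)))) * 1# ≤
        (fromℕ 4 * (k₂ * k₃)) * ((fromℕ 2 * (d₃ * k₁)) * ((fromℕ 2 * (k₅ * k₆)) * ((fromℕ 2 * (d₁ * k₄)) * (fromℕ 2 * (k₁ * d₂))))) * 1#
      product = *-mono-≤ (*-nonNeg (*-nonNeg 0≤k₁ 0≤n₃) (*-nonNeg (*-nonNeg 0≤k₄ 0≤k₂) (*-nonNeg (*-nonNeg 0≤n₂ 0≤k₁) (*-nonNeg (*-nonNeg 0≤n₁ 0≤k₅) (*-nonNeg 0≤k₆ 0≤k₃)))))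
        0≤1
        (*-mono-≤ (*-nonNeg 0≤k₁ 0≤n₃) 0≤r₂ p₁
        (*-mono-≤ (*-nonNeg 0≤k₄ 0≤k₂) 0≤r₃ p₂
        (*-mono-≤ (*-nonNeg 0≤n₂ 0≤k₁) 0≤r₄ p₃
        (*-mono-≤ (*-nonNeg 0≤n₁ 0≤k₅) 0≤r₅ p₄ p₅)))) ≤-refl

  module _ {d} (4≤d : 4 ℕ.≤ d) (f : Family 4) (f∈𝓛 : 𝓛⁺ (Δ 4 d) f) where
    private
      g : Family 4
      g v = f (base d ⊕ v)

    f-pos : ∀ α → ∣ α ∣ ≡ d → 0# < f α
    f-pos α ∣α∣≡d = Equivalence.from (proj₂ f∈𝓛 α) (ℕ.≡⇒≡ᵇ ∣ α ∣ d ∣α∣≡d)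

    private
      g-pos : ∀ v → ∣ v ∣ ≡ 4 → 0# < g v
      g-pos v ∣v∣≡4 = f-pos (base d ⊕ v) (∣base∣ 4≤d v ∣v∣≡4)

      module Local (v : Vec ℕ 4) (∣v∣≡2 : ∣ v ∣ ≡ 2) where
        H-sym : Symmetric (hessian g v)
        H-sym i j = ≈-reflexive (≡.cong g (⊕-e-comm v i j))

        H-pos : ∀ i j → 0# < hessian g v i j
        H-pos i j = g-pos (v ⊕ e i ⊕ e j) (≡.trans (∣⊕e⊕e∣ v i j) (≡.cong (ℕ._+ 2) ∣v∣≡2))

        amo : AtMostOnePositiveEigenvalue (hessian g v)
        amo = atMostOne-cong (λ i j → ≈-reflexive (≡.cong f (≡.trans (≡.cong (_⊕ e j) (⊕-assoc (base d) v (e i))) (⊕-assoc (base d) (v ⊕ e i) (e j)))))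
          (IsLorentzian.signature (proj₁ f∈𝓛) (base d ⊕ v) (ℕ.≡⇒≡ᵇ ∣ base d ⊕ v ∣ (d ∸ 2) (∣base∣₂ 4≤d v ∣v∣≡2)))

        three : ∀ i j k → hessian g v i i * hessian g v j k ≤ fromℕ 2 * (hessian g v i j * hessian g v i k)
        three = three-term (hessian g v) H-sym amo H-pos

      module β₁₂ = Local (1 ∷ 1 ∷ 0 ∷ 0 ∷ []) ≡.refl
      module β₁₃ = Local (1 ∷ 0 ∷ 1 ∷ 0 ∷ []) ≡.refl
      module β₁₄ = Local (1 ∷ 0 ∷ 0 ∷ 1 ∷ []) ≡.refl
      module β₂₃ = Local (0 ∷ 1 ∷ 1 ∷ 0 ∷ []) ≡.refl
      module β₂₄ = Local (0 ∷ 1 ∷ 0 ∷ 1 ∷ []) ≡.refl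
      module β₃₄ = Local (0 ∷ 0 ∷ 1 ∷ 1 ∷ []) ≡.refl

      H₂₄ = hessian g (0 ∷ 1 ∷ 0 ∷ 1 ∷ [])

      g≥0 : ∀ v → ∣ v ∣ ≡ 4 → 0# ≤ g v
      g≥0 v p = <⇒≤ (g-pos v p)

    -- In the word notation x₁x₂x₃x₄ = 1234 for coefficients above γ, the
    -- branching is between 1234·2244 ≤ 4·1224·2344 and
    -- 1234·2244 ≤ 4·1244·2234; each alternative is completed to the bound
    -- by four three-term inequalities, and the two are exchanged by 2 ↔ 4.
    numerator≤64denominator : ∏ (map f (numerator d)) ≤ fromℕ 64 * ∏ (map f (denominator d))
    numerator≤64denominator with four-term H₂₄ β₂₄.H-sym β₂₄.amo β₂₄.H-pos 0F 1F 2F 3F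
    ... | inj₁ p = chain
      (g-pos (1 ∷ 1 ∷ 1 ∷ 1 ∷ []) ≡.refl) (g-pos (1 ∷ 2 ∷ 0 ∷ 1 ∷ []) ≡.refl) (g-pos (0 ∷ 1 ∷ 1 ∷ 2 ∷ []) ≡.refl)
      (g-pos (1 ∷ 1 ∷ 2 ∷ 0 ∷ []) ≡.refl) (g-pos (2 ∷ 1 ∷ 1 ∷ 0 ∷ []) ≡.refl) (g-pos (2 ∷ 0 ∷ 1 ∷ 1 ∷ []) ≡.refl)
      (g≥0 (2 ∷ 0 ∷ 2 ∷ 0 ∷ []) ≡.refl) (g≥0 (1 ∷ 0 ∷ 1 ∷ 2 ∷ []) ≡.refl) (g≥0 (1 ∷ 2 ∷ 1 ∷ 0 ∷ []) ≡.refl)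
      (g≥0 (1 ∷ 0 ∷ 3 ∷ 0 ∷ []) ≡.refl) (g≥0 (3 ∷ 0 ∷ 1 ∷ 0 ∷ []) ≡.refl) (g≥0 (0 ∷ 2 ∷ 0 ∷ 2 ∷ []) ≡.refl)
      p (β₁₂.three 2F 1F 3F) (β₁₃.three 0F 1F 3F) (β₁₃.three 2F 0F 1F) (β₃₄.three 0F 1F 3F)
    -- The exchange of 2 and 4 swaps the last two denominator entries; the rearrangement restores
    -- their order.
    ... | inj₂ p = ≤-respʳ (*-congˡ (*-congˡ (solve 3 (λ a b o → a :* (b :* o) := b :* (a :* o)) ≈-refl _ _ 1#))) (chain
      (g-pos (1 ∷ 1 ∷ 1 ∷ 1 ∷ []) ≡.refl) (g-pos (1 ∷ 1 ∷ 0 ∷ 2 ∷ []) ≡.refl) (g-pos (0 ∷ 2 ∷ 1 ∷ 1 ∷ []) ≡.refl)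
      (g-pos (1 ∷ 0 ∷ 2 ∷ 1 ∷ []) ≡.refl) (g-pos (2 ∷ 0 ∷ 1 ∷ 1 ∷ []) ≡.refl) (g-pos (2 ∷ 1 ∷ 1 ∷ 0 ∷ []) ≡.refl)
      (g≥0 (2 ∷ 0 ∷ 2 ∷ 0 ∷ []) ≡.refl) (g≥0 (1 ∷ 2 ∷ 1 ∷ 0 ∷ []) ≡.refl) (g≥0 (1 ∷ 0 ∷ 1 ∷ 2 ∷ []) ≡.refl)
      (g≥0 (1 ∷ 0 ∷ 3 ∷ 0 ∷ []) ≡.refl) (g≥0 (3 ∷ 0 ∷ 1 ∷ 0 ∷ []) ≡.refl) (g≥0 (0 ∷ 2 ∷ 0 ∷ 2 ∷ []) ≡.refl)
      p (β₁₄.three 2F 3F 1F) (β₁₃.three 0F 3F 1F) (β₁₃.three 2F 0F 3F) (β₂₃.three 0F 3F 1F))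

-- Folds over lists of multi-indices

All-filterᵇ : ∀ {A : Set} (p : A → Bool) xs → All (T ∘ p) (filterᵇ p xs)
All-filterᵇ p []       = []
All-filterᵇ p (x ∷ xs) with p x in eq
... | true  = ≡.subst T (≡.sym eq) tt ∷ All-filterᵇ p xs
... | false = All-filterᵇ p xs

elements-∈ : ∀ {n d} (S : Subset n d) → All (_∈ S) (elements S)
elements-∈ {n} {d} S = All-filterᵇ (mem S) (multiIndices n d)

-- Over an arbitrary commutative monoid, so that `∑` and `∏` are both instances.
module Fold (M : CommutativeMonoid 0ℓ 0ℓ) where
  open CommutativeMonoid M

  private variable A B : Set

  fold : (A → Carrier) → List A → Carrier
  fold F xs = foldr _∙_ ε (map F xs)

  fold-cong : ∀ {F G : A → Carrier} {xs} → All (λ x → F x ≈ G x) xs → fold F xs ≈ fold G xs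
  fold-cong []         = refl
  fold-cong (eq ∷ eqs) = ∙-cong eq (fold-cong eqs)

  fold-ε : ∀ {F : A → Carrier} → (∀ x → F x ≈ ε) → ∀ xs → fold F xs ≈ ε
  fold-ε F≈ε []       = refl
  fold-ε F≈ε (x ∷ xs) = trans (∙-cong (F≈ε x) (fold-ε F≈ε xs)) (identityˡ ε)

  fold-++ : ∀ (F : A → Carrier) xs ys → fold F (xs ++ ys) ≈ fold F xs ∙ fold F ys
  fold-++ F []       ys = sym (identityˡ _)
  fold-++ F (x ∷ xs) ys = trans (∙-congˡ (fold-++ F xs ys)) (sym (assoc _ _ _))

  fold-map : ∀ (F : B → Carrier) (f : A → B) xs → fold F (map f xs) ≈ fold (F ∘ f) xs
  fold-map F f []       = refl
  fold-map F f (x ∷ xs) = ∙-congˡ (fold-map F f xs)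

  fold-concatMap : ∀ (F : B → Carrier) (f : A → List B) xs → fold F (concatMap f xs) ≈ fold (fold F ∘ f) xs
  fold-concatMap F f []       = refl
  fold-concatMap F f (x ∷ xs) = trans (fold-++ F (f x) (concatMap f xs)) (∙-congˡ (fold-concatMap F f xs))

  fold-filterᵇ : ∀ (F : A → Carrier) p xs → fold F (filterᵇ p xs) ≈ fold (λ x → if p x then F x else ε) xs
  fold-filterᵇ F p []       = refl
  fold-filterᵇ F p (x ∷ xs) with p x
  ... | true  = ∙-congˡ (fold-filterᵇ F p xs)
  ... | false = trans (fold-filterᵇ F p xs) (sym (identityˡ _))

  fold-∙ : ∀ (F G : A → Carrier) xs → fold (λ x → F x ∙ G x) xs ≈ fold F xs ∙ fold G xs
  fold-∙ F G []       = sym (identityˡ ε)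
  fold-∙ F G (x ∷ xs) = trans (∙-congˡ (fold-∙ F G xs))
    (trans (assoc _ _ _) (trans (∙-congˡ (trans (sym (assoc _ _ _)) (trans (∙-congʳ (comm _ _)) (assoc _ _ _))))
      (sym (assoc _ _ _))))

  fold-applyUpTo : ∀ (F : A → Carrier) f m k → k ℕ.< m → (∀ i → i ≢ k → F (f i) ≈ ε) →
    fold F (applyUpTo f m) ≈ F (f k)
  fold-applyUpTo F f (suc m) zero    _           off =
    trans (∙-congˡ (rest f m λ i → off (suc i) λ ())) (identityʳ _)
    where
    rest : ∀ f m → (∀ i → F (f (suc i)) ≈ ε) → fold F (applyUpTo (f ∘ suc) m) ≈ ε
    rest f zero    eq = refl
    rest f (suc m) eq = trans (∙-cong (eq 0) (rest (f ∘ suc) m (eq ∘ suc))) (identityˡ ε)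
  fold-applyUpTo F f (suc m) (suc k) (ℕ.s≤s k<m) off =
    trans (∙-congʳ (off 0 λ ())) (trans (identityˡ _)
      (fold-applyUpTo F (f ∘ suc) m k k<m λ i i≢k → off (suc i) (i≢k ∘ ℕ.suc-injective)))

  -- Here it matters that `multiIndices` lists α exactly once: its first coordinate singles out one
  -- block of the concatenation, and induction treats that block.
  fold-multiIndices : ∀ n d (F : Vec ℕ n → Carrier) α → ∣ α ∣ ≡ d → (∀ β → β ≢ α → F β ≈ ε) →
    fold F (multiIndices n d) ≈ F α
  fold-multiIndices zero    .0 F []      ≡.refl off = identityʳ _
  fold-multiIndices (suc n) d  F (k ∷ α) eq    off =
    trans (fold-concatMap F (λ i → map (i ∷_) (multiIndices n (d ∸ i))) (upTo (suc d)))
    (trans (fold-applyUpTo (λ i → fold F (map (i ∷_) (multiIndices n (d ∸ i)))) id (suc d) k (ℕ.s≤s k≤d)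
       λ i i≢k → trans (fold-map F (i ∷_) (multiIndices n (d ∸ i))) (fold-ε (λ β → off (i ∷ β) (i≢k ∘ proj₁ ∘ ∷-injective)) (multiIndices n (d ∸ i))))
    (trans (fold-map F (k ∷_) (multiIndices n (d ∸ k)))
      (fold-multiIndices n (d ∸ k) (F ∘ (k ∷_)) α ∣α∣≡d∸k λ β β≢α → off (k ∷ β) (β≢α ∘ proj₂ ∘ ∷-injective))))
    where
    k≤d : k ℕ.≤ d
    k≤d = ≡.subst (k ℕ.≤_) eq (ℕ.m≤m+n k ∣ α ∣)
    ∣α∣≡d∸k : ∣ α ∣ ≡ d ∸ k
    ∣α∣≡d∸k = ≡.trans (≡.sym (ℕ.m+n∸m≡n k ∣ α ∣)) (≡.cong (_∸ k) eq)

  fold-elements : ∀ {n d} (S : Subset n d) (F : Vec ℕ n → Carrier) α → α ∈ S → (∀ β → β ≢ α → F β ≈ ε) →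
    fold F (elements S) ≈ F α
  fold-elements {n} {d} S F α α∈S off =
    trans (fold-filterᵇ F (mem S) (multiIndices n d))
    (trans (fold-multiIndices n d (λ β → if mem S β then F β else ε) α (degree S α α∈S) off′) (on (mem S α) α∈S))
    where
    off′ : ∀ β → β ≢ α → (if mem S β then F β else ε) ≈ ε
    off′ β β≢α with mem S β
    ... | true  = off β β≢α
    ... | false = refl
    on : ∀ b → T b → (if b then F α else ε) ≈ F α
    on true _ = refl

-- Estimates for real powers

module RealPowers (em : ExcludedMiddle 0ℓ) (R : CompleteOrderedField) where
  open OrderedField em R
  open SetoidReasoning setoid

  -- The integer P - Q lies on that side of x on which a^(P - Q) dominates a^x.
  ExponentBound : Carrier → Carrier → ℕ → ℕ → Set
  ExponentBound a x P Q = (1# ≤ a × x + fromℕ Q ≤ fromℕ P) ⊎ (a ≤ 1# × fromℕ P ≤ x + fromℕ Q)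

  ^-monoʳ : ∀ {a i j} → 0# ≤ a → (1# ≤ a × i ℕ.≤ j) ⊎ (a ≤ 1# × j ℕ.≤ i) → a ^ i ≤ a ^ j
  ^-monoʳ 0≤a (inj₁ (1≤a , i≤j)) = ^-monoʳ-≤ 1≤a i≤j
  ^-monoʳ 0≤a (inj₂ (a≤1 , j≤i)) = ^-antimonoʳ-≤ 0≤a a≤1 j≤i

  -- Here y stands for a^((p - q)/K). To compare it with a^(P - Q) without roots or negative
  -- exponents, y a^Q is raised to the power K and multiplied by a^q; this reduces to comparing p +
  -- QK with q + PK.
  rationalPower-upper : ∀ {a x y P Q} → 0# < a → ExponentBound a x P Q → RationalPower a x y → y * a ^ Q ≤ a ^ P
  rationalPower-upper {a} {x} {y} {P} {Q} 0<a bound (p , q , k , 0≤y , eq , side) =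
    ^-cancel-≤ (^-nonNeg (<⇒≤ 0<a) P) k (*-cancelˡ-≤ (a ^ q) (^-pos 0<a q)
      (≤-respˡ (≈-sym lhs) (≤-respʳ (≈-sym rhs) (^-monoʳ (<⇒≤ 0<a) (exponents bound side)))))
    where
    K = suc k
    i = p ℕ.+ Q ℕ.* K
    j = q ℕ.+ P ℕ.* K
    lhs : a ^ q * (y * a ^ Q) ^ K ≈ a ^ i
    lhs = begin
      a ^ q * (y * a ^ Q) ^ K        ≈⟨ *-congˡ (^-distrib-* y (a ^ Q) K) ⟩
      a ^ q * (y ^ K * (a ^ Q) ^ K)  ≈⟨ solve 3 (λ a b c → a :* (b :* c) := b :* a :* c) ≈-refl _ _ _ ⟩
      y ^ K * a ^ q * (a ^ Q) ^ K    ≈⟨ *-cong eq (^-assocʳ a Q K) ⟩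
      a ^ p * a ^ (Q ℕ.* K)          ≈⟨ ^-homo-* a p (Q ℕ.* K) ⟨
      a ^ i                          ∎
    rhs : a ^ q * (a ^ P) ^ K ≈ a ^ j
    rhs = ≈-trans (*-congˡ (^-assocʳ a P K)) (≈-sym (^-homo-* a q (P ℕ.* K)))
    fromℕ-+* : ∀ r s → fromℕ (r ℕ.+ s ℕ.* K) ≈ fromℕ r + fromℕ K * fromℕ s
    fromℕ-+* r s = ≈-trans (fromℕ-+ r (s ℕ.* K)) (+-congˡ (≈-trans (fromℕ-* s K) (*-comm _ _)))
    exponents : ExponentBound a x P Q →
      ((1# ≤ a) × (fromℕ p ≤ fromℕ q + fromℕ K * x)) ⊎ ((a ≤ 1#) × (fromℕ q + fromℕ K * x ≤ fromℕ p)) →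
      (1# ≤ a × i ℕ.≤ j) ⊎ (a ≤ 1# × j ℕ.≤ i)
    exponents (inj₁ (1≤a , x+Q≤P)) (inj₁ (_ , p≤)) = inj₁ (1≤a , fromℕ-cancel-≤
      (≤-respˡ (≈-sym (fromℕ-+* p Q)) (≤-respʳ (≈-sym (fromℕ-+* q P))
        (≤-diff (+-nonNeg (0≤y-x p≤) (*-nonNeg (fromℕ-nonNeg K) (0≤y-x x+Q≤P)))
          (solve 6 (λ p q P Q K x → q :+ K :* P :- (p :+ K :* Q) := (q :+ K :* x :- p) :+ K :* (P :- (x :+ Q)))
            ≈-refl _ _ _ _ _ x)))))
    exponents (inj₂ (a≤1 , P≤x+Q)) (inj₂ (_ , ≤p)) = inj₂ (a≤1 , fromℕ-cancel-≤
      (≤-respʳ (≈-sym (fromℕ-+* p Q)) (≤-respˡ (≈-sym (fromℕ-+* q P))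
        (≤-diff (+-nonNeg (0≤y-x ≤p) (*-nonNeg (fromℕ-nonNeg K) (0≤y-x P≤x+Q)))
          (solve 6 (λ p q P Q K x → p :+ K :* Q :- (q :+ K :* P) := (p :- (q :+ K :* x)) :+ K :* (x :+ Q :- P))
            ≈-refl _ _ _ _ _ x)))))
    -- The two sides can disagree only for a = 1, and then either order of the exponents will do.
    exponents (inj₁ (1≤a , _)) (inj₂ (a≤1 , _)) with ℕ.≤-total i j
    ... | inj₁ le = inj₁ (1≤a , le)
    ... | inj₂ le = inj₂ (a≤1 , le)
    exponents (inj₂ (a≤1 , _)) (inj₁ (1≤a , _)) with ℕ.≤-total i j
    ... | inj₁ le = inj₁ (1≤a , le)
    ... | inj₂ le = inj₂ (a≤1 , le)

  *⁻¹-cancelʳ : ∀ x {y} → 0# < y → x * y ⁻¹ * y ≈ x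
  *⁻¹-cancelʳ x {y} 0<y = ≈-trans (solve 3 (λ x i y → x :* i :* y := (y :* i) :* x) ≈-refl x (y ⁻¹) y)
    (≈-trans (*-congʳ (*-inverseʳ y (<⇒≉ 0<y))) (*-identityˡ x))

  -- At an integer exponent the supremum is attained: a^P / a^Q is itself a rational power, with
  -- denominator 1, and `rationalPower-upper` bounds all others by it.
  pow-integral : ∀ {a x} P Q → 0# < a → x + fromℕ Q ≈ fromℕ P → pow a x * a ^ Q ≈ a ^ P
  pow-integral {a} {x} P Q 0<a x+Q≈P = ≤-antisym
    (≤-respˡ (*-comm _ _) (≤-respʳ (≈-trans (*-comm _ _) y₀a^Q≈a^P)
      (*-monoʳ-≤ (a ^ Q) (^-nonNeg (<⇒≤ 0<a) Q) (sup-least S inhabited bounded y₀ (proj₂ bounded)))))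
    (≤-respʳ (*-comm _ _) (≤-respˡ (≈-trans (*-comm _ _) y₀a^Q≈a^P)
      (*-monoʳ-≤ (a ^ Q) (^-nonNeg (<⇒≤ 0<a) Q) (sup-upper S inhabited bounded y₀ y₀∈S))))
    where
    S = RationalPower a x
    y₀ = a ^ P * (a ^ Q) ⁻¹
    y₀a^Q≈a^P : y₀ * a ^ Q ≈ a ^ P
    y₀a^Q≈a^P = *⁻¹-cancelʳ (a ^ P) (^-pos 0<a Q)
    P≈Q+1*x : fromℕ P ≈ fromℕ Q + fromℕ 1 * x
    P≈Q+1*x = ≈-trans (≈-sym x+Q≈P) (solve 2 (λ x q → x :+ q := q :+ con (+ 1) :* x) ≈-refl x (fromℕ Q))
    y₀∈S : S y₀
    y₀∈S = P , Q , 0 , *-nonNeg (^-nonNeg (<⇒≤ 0<a) P) (<⇒≤ (⁻¹-pos (^-pos 0<a Q))) ,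
      ≈-trans (*-congʳ (*-identityʳ y₀)) y₀a^Q≈a^P , side
      where
      side : ((1# ≤ a) × (fromℕ P ≤ fromℕ Q + fromℕ 1 * x)) ⊎ ((a ≤ 1#) × (fromℕ Q + fromℕ 1 * x ≤ fromℕ P))
      side with ≤-total 1# a
      ... | inj₁ 1≤a = inj₁ (1≤a , ≤-reflexive P≈Q+1*x)
      ... | inj₂ a≤1 = inj₂ (a≤1 , ≤-reflexive (≈-sym P≈Q+1*x))
    inhabited : ∃ S
    inhabited = y₀ , y₀∈S
    exponentBound : ExponentBound a x P Q
    exponentBound with ≤-total 1# a
    ... | inj₁ 1≤a = inj₁ (1≤a , ≤-reflexive x+Q≈P)
    ... | inj₂ a≤1 = inj₂ (a≤1 , ≤-reflexive (≈-sym x+Q≈P))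
    bounded : ∃ (UpperBound S)
    bounded = y₀ , λ y y∈S → *-cancelˡ-≤ (a ^ Q) (^-pos 0<a Q)
      (≤-respˡ (*-comm _ _) (≤-respʳ (≈-trans (≈-sym y₀a^Q≈a^P) (*-comm _ _)) (rationalPower-upper {P = P} {Q} 0<a exponentBound y∈S)))

  -- As a is given as an exact K-th power, K = k + 1, the rational power a^((P - Q)/K) is s^(m(P -
  -- Q)): a witness below the supremum without extracting a root.
  pow-lower : ∀ {s a x} m k P Q → 1# ≤ s → a ≈ s ^ (m ℕ.* suc k) → fromℕ P ≤ fromℕ Q + fromℕ (suc k) * x →
    s ^ (m ℕ.* P) ≤ pow a x * s ^ (m ℕ.* Q)
  pow-lower {s} {a} {x} m k P Q 1≤s a≈ P≤ = ≤-respˡ (≈-trans (*-comm _ _) (*⁻¹-cancelʳ _ (^-pos 0<s (m ℕ.* Q))))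
    (≤-respʳ (*-comm _ _) (*-monoʳ-≤ (s ^ (m ℕ.* Q)) (^-nonNeg (<⇒≤ 0<s) (m ℕ.* Q)) (sup-upper S (y , y∈S) bounded y y∈S)))
    where
    K = suc k
    S = RationalPower a x
    0<s : 0# < s
    0<s = <-≤-trans 0<1 1≤s
    1≤a : 1# ≤ a
    1≤a = ≤-respʳ (≈-sym a≈) (1≤^ 1≤s (m ℕ.* K))
    y = s ^ (m ℕ.* P) * (s ^ (m ℕ.* Q)) ⁻¹
    a^≈ : ∀ r → (s ^ (m ℕ.* r)) ^ K ≈ a ^ r
    a^≈ r = ≈-sym (begin
      a ^ r                  ≈⟨ ^-congˡ r a≈ ⟩
      (s ^ (m ℕ.* K)) ^ r    ≈⟨ ^-assocʳ s (m ℕ.* K) r ⟩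
      s ^ (m ℕ.* K ℕ.* r)    ≡⟨ ≡.cong (s ^_) (≡.trans (ℕ.*-assoc m K r) (≡.trans (≡.cong (m ℕ.*_) (ℕ.*-comm K r)) (≡.sym (ℕ.*-assoc m r K)))) ⟩
      s ^ (m ℕ.* r ℕ.* K)    ≈⟨ ^-assocʳ s (m ℕ.* r) K ⟨
      (s ^ (m ℕ.* r)) ^ K    ∎)
    y∈S : S y
    y∈S = P , Q , k , *-nonNeg (^-nonNeg (<⇒≤ 0<s) (m ℕ.* P)) (<⇒≤ (⁻¹-pos (^-pos 0<s (m ℕ.* Q)))) , (begin
      y ^ K * a ^ Q                  ≈⟨ *-congˡ (a^≈ Q) ⟨
      y ^ K * (s ^ (m ℕ.* Q)) ^ K    ≈⟨ ^-distrib-* y (s ^ (m ℕ.* Q)) K ⟨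
      (y * s ^ (m ℕ.* Q)) ^ K        ≈⟨ ^-congˡ K (*⁻¹-cancelʳ _ (^-pos 0<s (m ℕ.* Q))) ⟩
      (s ^ (m ℕ.* P)) ^ K            ≈⟨ a^≈ P ⟩
      a ^ P                          ∎) , inj₁ (1≤a , P≤)
    -- `sup` has a specified value only on bounded sets; any natural N ≥ x supplies the bound a^N.
    bounded : ∃ (UpperBound S)
    bounded with archimedean x
    ... | N , x≤N = a ^ N , λ z z∈S → ≤-respˡ (*-identityʳ z)
      (rationalPower-upper {P = N} {Q = 0} (<-≤-trans 0<1 1≤a) (inj₁ (1≤a , ≤-respˡ (≈-sym (+-identityʳ x)) x≤N)) z∈S)

  -- The floor of a real of either sign is recorded as a difference P - Q of naturals; a preliminary
  -- shift by some Q ≥ -x keeps the downward search inside ℕ.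
  floor : ∀ x → ∃[ P ] ∃[ Q ] (fromℕ P ≤ fromℕ Q + x) × (fromℕ Q + x ≤ fromℕ P + 1#)
  floor x with archimedean (- x)
  ... | Q , -x≤Q = let P , lower , upper = search (proj₁ bound) (proj₂ bound) in P , Q , lower , upper
    where
    y = fromℕ Q + x
    0≤y : 0# ≤ y
    0≤y = ≤-diff (0≤y-x -x≤Q) (solve 2 (λ q x → q :+ x :- con (+ 0) := q :- :- x) ≈-refl (fromℕ Q) x)
    bound = archimedean y
    search : ∀ N → y ≤ fromℕ N → ∃[ P ] (fromℕ P ≤ y) × (y ≤ fromℕ P + 1#)
    search zero    y≤0 = 0 , 0≤y , ≤-trans y≤0 (≤-respʳ (≈-sym (+-identityˡ 1#)) 0≤1)
    search (suc N) y≤N with em {y ≤ fromℕ N}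
    ... | yes le = search N le
    ... | no  nl = N , <⇒≤ (≰⇒> nl) , ≤-respʳ (+-comm _ _) y≤N

-- Pairings, integral ratios and ⟨w_d, q_d⟩

⌊≟⌋-refl : ∀ {n} (α : Vec ℕ n) → ⌊ α ≟ α ⌋ ≡ true
⌊≟⌋-refl α = ≡.trans (isYes≗does (α ≟ α)) (dec-true (α ≟ α) ≡.refl)

⌊≟⌋-≢ : ∀ {n} {α β : Vec ℕ n} → α ≢ β → ⌊ α ≟ β ⌋ ≡ false
⌊≟⌋-≢ {α = α} {β} α≢β = ≡.trans (isYes≗does (α ≟ β)) (dec-false (α ≟ β) α≢β)

⊕-cancelˡ : ∀ {n} (α : Vec ℕ n) {β γ} → α ⊕ β ≡ α ⊕ γ → β ≡ γ
⊕-cancelˡ []      {[]}    {[]}    _  = ≡.refl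
⊕-cancelˡ (a ∷ α) {b ∷ β} {c ∷ γ} eq =
  ≡.cong₂ _∷_ (ℕ.+-cancelˡ-≡ a b c (proj₁ (∷-injective eq))) (⊕-cancelˡ α (proj₂ (∷-injective eq)))

⌊≟⌋-⊕ : ∀ {n} (α β γ : Vec ℕ n) → ⌊ (α ⊕ β) ≟ (α ⊕ γ) ⌋ ≡ ⌊ β ≟ γ ⌋
⌊≟⌋-⊕ α β γ with β ≟ γ
... | yes ≡.refl = ⌊≟⌋-refl (α ⊕ β)
... | no  β≢γ    = ⌊≟⌋-≢ (β≢γ ∘ ⊕-cancelˡ α)

module Pairings (em : ExcludedMiddle 0ℓ) (R : CompleteOrderedField) where
  open OrderedField em R hiding (zero)
  open Lorentzian R
  open RealPowers em R
  open SetoidReasoning setoid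
  module Sum = Fold +-commutativeMonoid
  module Product = Fold *-commutativeMonoid

  private variable d : ℕ

  basis-refl : (α : Vec ℕ n) → basis α α ≡ 1#
  basis-refl α = ≡.cong (λ b → if b then 1# else 0#) (⌊≟⌋-refl α)

  basis-≢ : {α β : Vec ℕ n} → α ≢ β → basis α β ≡ 0#
  basis-≢ α≢β = ≡.cong (λ b → if b then 1# else 0#) (⌊≟⌋-≢ α≢β)

  basis-⊕ : (α β γ : Vec ℕ n) → basis (α ⊕ β) (α ⊕ γ) ≡ basis β γ
  basis-⊕ α β γ = ≡.cong (λ b → if b then 1# else 0#) (⌊≟⌋-⊕ α β γ)

  inner-basis : (S : Subset n d) (k : Carrier) {η : Vec ℕ n} (q : Family n) → η ∈ S →
    inner S (λ α → k * basis η α) q ≈ k * q η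
  inner-basis S k {η} q η∈S = ≈-trans
    (Sum.fold-elements S (λ α → k * basis η α * q α) η η∈S λ β β≢η →
      ≈-trans (*-congʳ (≈-trans (*-congˡ (≈-reflexive (basis-≢ (β≢η ∘ ≡.sym)))) (zeroʳ k))) (zeroˡ (q β)))
    (*-congʳ (≈-trans (*-congˡ (≈-reflexive (basis-refl η))) (*-identityʳ k)))

  inner-congˡ : (S : Subset n d) {g h : Family n} (q : Family n) → (∀ α → α ∈ S → g α ≈ h α) → inner S g q ≈ inner S h q
  inner-congˡ S q eq = Sum.fold-cong (All.map (λ α∈S → *-congʳ (eq _ α∈S)) (elements-∈ S))

  inner-+ : (S : Subset n d) (g h q : Family n) → inner S (λ α → g α + h α) q ≈ inner S g q + inner S h q
  inner-+ S g h q = ≈-trans (Sum.fold-cong (All.universal (λ α → distribʳ (q α) (g α) (h α)) (elements S)))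
    (Sum.fold-∙ (λ α → g α * q α) (λ α → h α * q α) (elements S))

  inner-0 : (S : Subset n d) (q : Family n) → inner S (λ _ → 0#) q ≈ 0#
  inner-0 S q = Sum.fold-ε (λ α → zeroˡ (q α)) (elements S)

  ∑-*-distribˡ : ∀ {A : Set} k (f : A → Carrier) xs → ∑ (map (λ x → k * f x) xs) ≈ k * ∑ (map f xs)
  ∑-*-distribˡ k f []       = ≈-sym (zeroʳ k)
  ∑-*-distribˡ k f (x ∷ xs) = ≈-trans (+-congˡ (∑-*-distribˡ k f xs)) (≈-sym (distribˡ k (f x) _))

  inner-* : (S : Subset n d) (k : Carrier) (g q : Family n) → inner S (λ α → k * g α) q ≈ k * inner S g q
  inner-* S k g q = ≈-trans (Sum.fold-cong (All.universal (λ α → *-assoc k (g α) (q α)) (elements S)))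
    (∑-*-distribˡ k (λ α → g α * q α) (elements S))

  inner-combination : ∀ {A : Set} (S : Subset n d) (k : A → Carrier) (η : A → Vec ℕ n) (q : Family n) xs →
    All (λ x → η x ∈ S) xs →
    inner S (λ α → ∑ (map (λ x → k x * basis (η x) α) xs)) q ≈ ∑ (map (λ x → k x * q (η x)) xs)
  inner-combination S k η q []       []            = inner-0 S q
  inner-combination S k η q (x ∷ xs) (η∈S ∷ ηs∈S) =
    ≈-trans (inner-+ S (λ α → k x * basis (η x) α) (λ α → ∑ (map (λ x → k x * basis (η x) α) xs)) q)
      (+-cong (inner-basis S (k x) q η∈S) (inner-combination S k η q xs ηs∈S))

  inner-indicator : ∀ (S : Subset n d) (q : Family n) ηs → All (_∈ S) ηs →
    inner S (λ α → ∑ (map (λ η → basis η α) ηs)) q ≈ ∑ (map q ηs)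
  inner-indicator S q ηs ηs∈S = ≈-trans
    (inner-congˡ S q λ α _ → Sum.fold-cong {G = λ η → 1# * basis η α} (All.universal (λ η → ≈-sym (*-identityˡ (basis η α))) ηs))
    (≈-trans (inner-combination S (λ _ → 1#) (λ η → η) q ηs ηs∈S)
      (Sum.fold-cong (All.universal (λ η → *-identityˡ (q η)) ηs)))

  -- Multiplicities turn a product over a list into a product of natural powers over all of S, the
  -- shape that `ratio` has.
  count : List (Vec ℕ n) → Vec ℕ n → ℕ
  count []       α = 0
  count (η ∷ ηs) α = (if ⌊ η ≟ α ⌋ then 1 else 0) ℕ.+ count ηs α

  fromℕ-count : ∀ ηs (α : Vec ℕ n) → fromℕ (count ηs α) ≈ ∑ (map (λ η → basis η α) ηs)
  fromℕ-count []       α = ≈-refl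
  fromℕ-count (η ∷ ηs) α = ≈-trans (fromℕ-+ (if ⌊ η ≟ α ⌋ then 1 else 0) (count ηs α))
    (+-cong (bit ⌊ η ≟ α ⌋) (fromℕ-count ηs α))
    where
    bit : ∀ b → fromℕ (if b then 1 else 0) ≈ (if b then 1# else 0#)
    bit true  = +-identityʳ 1#
    bit false = ≈-refl

  ∏-count : ∀ (S : Subset n d) (c : Family n) ηs → All (_∈ S) ηs →
    ∏ (map (λ α → c α ^ count ηs α) (elements S)) ≈ ∏ (map c ηs)
  ∏-count S c []       []            = Product.fold-ε (λ _ → ≈-refl) (elements S)
  ∏-count S c (η ∷ ηs) (η∈S ∷ ηs∈S) = begin
    ∏ (map (λ α → c α ^ (bit α ℕ.+ count ηs α)) (elements S))
      ≈⟨ Product.fold-cong (All.universal (λ α → ^-homo-* (c α) (bit α) (count ηs α)) (elements S)) ⟩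
    ∏ (map (λ α → c α ^ bit α * c α ^ count ηs α) (elements S))
      ≈⟨ Product.fold-∙ (λ α → c α ^ bit α) (λ α → c α ^ count ηs α) (elements S) ⟩
    ∏ (map (λ α → c α ^ bit α) (elements S)) * ∏ (map (λ α → c α ^ count ηs α) (elements S))
      ≈⟨ *-cong (Product.fold-elements S (λ α → c α ^ bit α) η η∈S λ β β≢η →
                   ≈-reflexive (≡.cong (λ b → c β ^ (if b then 1 else 0)) (⌊≟⌋-≢ (β≢η ∘ ≡.sym))))
                (∏-count S c ηs ηs∈S) ⟩
    c η ^ bit η * ∏ (map c ηs)
      ≈⟨ *-congʳ (≈-trans (≈-reflexive (≡.cong (λ b → c η ^ (if b then 1 else 0)) (⌊≟⌋-refl η))) (*-identityʳ (c η))) ⟩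
    c η * ∏ (map c ηs) ∎
    where
    bit = λ α → if ⌊ η ≟ α ⌋ then 1 else 0

  -- The bridge from `pow` to ordinary products: every exponent is a difference of two
  -- multiplicities, so `pow-integral` applies factor by factor.
  ratio-integral : ∀ (S : Subset n d) (c w : Family n) ηs θs → All (_∈ S) ηs → All (_∈ S) θs → (∀ α → α ∈ S → 0# < c α) →
    (∀ α → α ∈ S → w α ≈ ∑ (map (λ η → basis η α) ηs) - ∑ (map (λ η → basis η α) θs)) →
    ratio S w c * ∏ (map c θs) ≈ ∏ (map c ηs)
  ratio-integral S c w ηs θs ηs∈S θs∈S c-pos w≈ = begin
    ratio S w c * ∏ (map c θs)
      ≈⟨ *-congˡ (∏-count S c θs θs∈S) ⟨
    ratio S w c * ∏ (map (λ α → c α ^ count θs α) (elements S))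
      ≈⟨ Product.fold-∙ (λ α → pow (c α) (w α)) (λ α → c α ^ count θs α) (elements S) ⟨
    ∏ (map (λ α → pow (c α) (w α) * c α ^ count θs α) (elements S))
      ≈⟨ Product.fold-cong (All.map (λ {α} α∈S → pow-integral (count ηs α) (count θs α) (c-pos α α∈S)
           (≈-trans (+-cong (w≈ α α∈S) (fromℕ-count θs α))
             (≈-trans (solve 2 (λ a b → a :- b :+ b := a) ≈-refl _ _) (≈-sym (fromℕ-count ηs α))))) (elements-∈ S)) ⟩
    ∏ (map (λ α → c α ^ count ηs α) (elements S))
      ≈⟨ ∏-count S c ηs ηs∈S ⟩
    ∏ (map c ηs) ∎

  ∏-pos : ∀ {A : Set} {c : A → Carrier} {xs} → All (λ x → 0# < c x) xs → 0# < ∏ (map c xs)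
  ∏-pos []       = 0<1
  ∏-pos (p ∷ ps) = *-pos p (∏-pos ps)

  module _ {d} (4≤d : 4 ℕ.≤ d) where
    open UpperBound em R

    base-∈ : ∀ v → ∣ v ∣ ≡ 4 → base d ⊕ v ∈ Δ 4 d
    base-∈ v ∣v∣≡4 = ℕ.≡⇒≡ᵇ ∣ base d ⊕ v ∣ d (∣base∣ 4≤d v ∣v∣≡4)

    numerator-∈ : All (_∈ Δ 4 d) (numerator d)
    numerator-∈ = base-∈ (1 ∷ 0 ∷ 3 ∷ 0 ∷ []) ≡.refl ∷ base-∈ (3 ∷ 0 ∷ 1 ∷ 0 ∷ []) ≡.refl ∷ base-∈ (0 ∷ 2 ∷ 0 ∷ 2 ∷ []) ≡.refl ∷ []

    denominator-∈ : All (_∈ Δ 4 d) (denominator d)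
    denominator-∈ = base-∈ (2 ∷ 0 ∷ 2 ∷ 0 ∷ []) ≡.refl ∷ base-∈ (1 ∷ 0 ∷ 1 ∷ 2 ∷ []) ≡.refl ∷ base-∈ (1 ∷ 2 ∷ 1 ∷ 0 ∷ []) ≡.refl ∷ []

    denominator-pos : ∀ f → 𝓛⁺ (Δ 4 d) f → 0# < ∏ (map f (denominator d))
    denominator-pos f f∈𝓛 = ∏-pos (All.map (λ {α} α∈Δ → Equivalence.from (proj₂ f∈𝓛 α) α∈Δ) denominator-∈)

    R≤64 : ∀ f → 𝓛⁺ (Δ 4 d) f → R[ d ] f ≤ fromℕ 64
    R≤64 f f∈𝓛 = *-cancelˡ-≤ D 0<D (≤-respˡ (≈-sym (≈-trans (*-comm D _) (*⁻¹-cancelʳ _ 0<D)))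
      (≤-respʳ (*-comm _ _) (numerator≤64denominator 4≤d f f∈𝓛)))
      where
      D = ∏ (map f (denominator d))
      0<D = denominator-pos f f∈𝓛

    w∈BR : BR (Δ 4 d) w[ d ]
    w∈BR = fromℕ 64 , λ c c∈𝓛 → *-cancelˡ-≤ (∏ (map c (denominator d))) (denominator-pos c c∈𝓛)
      (≤-respˡ (≈-trans (≈-sym (ratio-integral (Δ 4 d) c w[ d ] (numerator d) (denominator d) numerator-∈ denominator-∈
                 (λ α → Equivalence.from (proj₂ c∈𝓛 α)) λ α _ → ≈-refl)) (*-comm _ _))
        (≤-respʳ (*-comm _ _) (numerator≤64denominator 4≤d c c∈𝓛)))

    private
      a b : ℕ
      a = ⌊ d ∸ 4 /2⌋
      b = ⌈ d ∸ 4 /2⌉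

    a≤b : a ℕ.≤ b
    a≤b = ℕ.⌊n/2⌋≤⌈n/2⌉ (d ∸ 4)

    b≤1+a : b ℕ.≤ suc a
    b≤1+a = lemma (d ∸ 4)
      where
      lemma : ∀ n → ⌈ n /2⌉ ℕ.≤ suc ⌊ n /2⌋
      lemma zero          = ℕ.z≤n
      lemma (suc zero)    = ℕ.s≤s ℕ.z≤n
      lemma (suc (suc n)) = ℕ.s≤s (lemma n)

    μ-≤ : ∀ {s r} → s ℕ.+ r ≡ d → s ℕ.≤ r → μ d s ≡ s
    μ-≤ {s} {r} s+r≡d s≤r = ≡.trans (≡.cong (s ℕ.⊓_) (≡.trans (≡.cong (_∸ s) (≡.sym s+r≡d)) (ℕ.m+n∸m≡n s r))) (ℕ.m≤n⇒m⊓n≡m s≤r)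

    μ-≥ : ∀ {s r} → s ℕ.+ r ≡ d → r ℕ.≤ s → μ d s ≡ r
    μ-≥ {s} {r} s+r≡d r≤s = ≡.trans (≡.cong (s ℕ.⊓_) (≡.trans (≡.cong (_∸ s) (≡.sym s+r≡d)) (ℕ.m+n∸m≡n s r))) (ℕ.m≥n⇒m⊓n≡n r≤s)

    a+b+4 : a ℕ.+ b ℕ.+ 4 ≡ d
    a+b+4 = ≡.trans (≡.cong (ℕ._+ 4) (ℕ.⌊n/2⌋+⌈n/2⌉≡n (d ∸ 4))) (ℕ.m∸n+n≡m 4≤d)

    b+k+[a+l]≡d : ∀ k l → k ℕ.+ l ≡ 4 → b ℕ.+ k ℕ.+ (a ℕ.+ l) ≡ d
    b+k+[a+l]≡d k l k+l≡4 = ≡.trans (interchange b k a l) (≡.trans (≡.cong₂ ℕ._+_ (ℕ.+-comm b a) k+l≡4) a+b+4)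

    -- Since d = a + b + 4 and a ≤ b ≤ a + 1, the midpoint d/2 lies between b + 1 and b + 2. The
    -- values at b + 1, b + 2 and b + 3 are the only explicit ones needed.
    μ[b+1] : μ d (b ℕ.+ 1) ≡ b ℕ.+ 1
    μ[b+1] = μ-≤ (b+k+[a+l]≡d 1 3 ≡.refl) (≡.subst₂ ℕ._≤_ (ℕ.+-comm 1 b) (ℕ.+-comm 3 a)
      (ℕ.s≤s (ℕ.≤-trans b≤1+a (ℕ.s≤s (ℕ.n≤1+n a)))))

    μ[b+2] : μ d (b ℕ.+ 2) ≡ a ℕ.+ 2
    μ[b+2] = μ-≥ (b+k+[a+l]≡d 2 2 ≡.refl) (ℕ.+-monoˡ-≤ 2 a≤b)

    μ[b+3] : μ d (b ℕ.+ 3) ≡ a ℕ.+ 1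
    μ[b+3] = μ-≥ (b+k+[a+l]≡d 3 1 ≡.refl) (ℕ.+-mono-≤ a≤b (ℕ.s≤s ℕ.z≤n))

    private
      q-value : ∀ v k l → μ d (lookup (base d ⊕ v) 1F ℕ.+ lookup (base d ⊕ v) 2F) ≡ k →
        μ d (lookup (base d ⊕ v) 2F ℕ.+ lookup (base d ⊕ v) 3F) ≡ l →
        q[ d ] (base d ⊕ v) ≈ fromℕ k + fromℕ l - fromℕ (ε d) * basis (2 ∷ 0 ∷ 2 ∷ 0 ∷ []) v
      q-value v k l p q = +-cong (≈-trans (≈-reflexive (≡.cong fromℕ (≡.cong₂ ℕ._+_ p q))) (fromℕ-+ k l))
        (-‿cong (*-congˡ (≈-reflexive (basis-⊕ (base d) (2 ∷ 0 ∷ 2 ∷ 0 ∷ []) v))))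

      +0 : ∀ k {l} → μ d k ≡ l → μ d (k ℕ.+ 0) ≡ l
      +0 k = ≡.trans (≡.cong (μ d) (ℕ.+-identityʳ k))

    inner-w-q : inner (Δ 4 d) w[ d ] q[ d ] ≈ fromℕ (ε d)
    inner-w-q = begin
      inner (Δ 4 d) w[ d ] q
        ≈⟨ inner-congˡ (Δ 4 d) q (λ α _ → +-congˡ (≈-trans (-‿cong (≈-sym (*-identityˡ _)))
             (solve 2 (λ o x → :- (o :* x) := :- o :* x) ≈-refl 1# _))) ⟩
      inner (Δ 4 d) (λ α → N α + - 1# * D α) q
        ≈⟨ inner-+ (Δ 4 d) N (λ α → - 1# * D α) q ⟩
      inner (Δ 4 d) N q + inner (Δ 4 d) (λ α → - 1# * D α) q
        ≈⟨ +-cong (inner-indicator (Δ 4 d) q (numerator d) numerator-∈)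
             (≈-trans (inner-* (Δ 4 d) (- 1#) D q) (*-congˡ (inner-indicator (Δ 4 d) q (denominator d) denominator-∈))) ⟩
      ∑ (map q (numerator d)) + - 1# * ∑ (map q (denominator d))
        ≈⟨ +-cong
            (+-cong (q-value (1 ∷ 0 ∷ 3 ∷ 0 ∷ []) (a ℕ.+ 1) (a ℕ.+ 1) μ[b+3] (+0 (b ℕ.+ 3) μ[b+3]))
            (+-cong (q-value (3 ∷ 0 ∷ 1 ∷ 0 ∷ []) (b ℕ.+ 1) (b ℕ.+ 1) μ[b+1] (+0 (b ℕ.+ 1) μ[b+1]))
            (+-cong (q-value (0 ∷ 2 ∷ 0 ∷ 2 ∷ []) (a ℕ.+ 2) (a ℕ.+ 2) (≡.trans (≡.cong (μ d) (≡.trans (≡.cong (2 ℕ.+_) (ℕ.+-identityʳ b)) (ℕ.+-comm 2 b))) μ[b+2])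
                      (≡.trans (≡.cong (λ k → μ d (k ℕ.+ 2)) (ℕ.+-identityʳ b)) μ[b+2]))
              ≈-refl)))
            (*-congˡ
            (+-cong (q-value (2 ∷ 0 ∷ 2 ∷ 0 ∷ []) (a ℕ.+ 2) (a ℕ.+ 2) μ[b+2] (+0 (b ℕ.+ 2) μ[b+2]))
            (+-cong (q-value (1 ∷ 0 ∷ 1 ∷ 2 ∷ []) (b ℕ.+ 1) (a ℕ.+ 1) μ[b+1] (≡.trans (≡.cong (μ d) (ℕ.+-assoc b 1 2)) μ[b+3]))
            (+-cong (q-value (1 ∷ 2 ∷ 1 ∷ 0 ∷ []) (a ℕ.+ 1) (b ℕ.+ 1) (≡.trans (≡.cong (μ d) (≡.trans (ℕ.+-comm 2 (b ℕ.+ 1)) (ℕ.+-assoc b 1 2))) μ[b+3]) (+0 (b ℕ.+ 1) μ[b+1]))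
              ≈-refl)))) ⟩
      -- The μ-parts of numerator and denominator both equal 2(a + 1) + 2(b + 1) + 2(a + 2) and
      -- cancel. The correction at α*, a denominator index, survives with a plus sign.
      _ ≈⟨ solve 5 (λ a₁ a₂ b₁ ε o →
             ((a₁ :+ a₁ :- ε :* con (+ 0)) :+ ((b₁ :+ b₁ :- ε :* con (+ 0)) :+ ((a₂ :+ a₂ :- ε :* con (+ 0)) :+ con (+ 0))))
             :+ :- o :* ((a₂ :+ a₂ :- ε :* o) :+ ((b₁ :+ a₁ :- ε :* con (+ 0)) :+ ((a₁ :+ b₁ :- ε :* con (+ 0)) :+ con (+ 0)))) :=
             (a₁ :+ a₁ :+ b₁ :+ b₁ :+ a₂ :+ a₂) :- o :* (a₁ :+ a₁ :+ b₁ :+ b₁ :+ a₂ :+ a₂) :+ ε :* (o :* o)) ≈-refl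
             (fromℕ (a ℕ.+ 1)) (fromℕ (a ℕ.+ 2)) (fromℕ (b ℕ.+ 1)) (fromℕ (ε d)) 1# ⟩
      X - 1# * X + fromℕ (ε d) * (1# * 1#)
        ≈⟨ +-cong (≈-trans (+-congˡ (-‿cong (*-identityˡ X))) (-‿inverseʳ X)) (≈-trans (*-congˡ (*-identityˡ 1#)) (*-identityʳ _)) ⟩
      0# + fromℕ (ε d)
        ≈⟨ +-identityˡ _ ⟩
      fromℕ (ε d) ∎
      where
      q = q[ d ]
      N D : Family 4
      N α = ∑ (map (λ η → basis η α) (numerator d))
      D α = ∑ (map (λ η → basis η α) (denominator d))
      X = fromℕ (a ℕ.+ 1) + fromℕ (a ℕ.+ 1) + fromℕ (b ℕ.+ 1) + fromℕ (b ℕ.+ 1) + fromℕ (a ℕ.+ 2) + fromℕ (a ℕ.+ 2)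

    0<ε : 0# < fromℕ (ε d)
    0<ε with d ℕ.% 2 ℕ.≡ᵇ 0
    ... | true  = fromℕ-pos 1
    ... | false = fromℕ-pos 0

-- Exchange, weights and cuts

0⊕ : ∀ (α : Vec ℕ n) → replicate n 0 ⊕ α ≡ α
0⊕ []      = ≡.refl
0⊕ (a ∷ α) = ≡.cong (a ∷_) (0⊕ α)

∣∣≡0⇒≡0 : ∀ (α : Vec ℕ n) → ∣ α ∣ ≡ 0 → α ≡ replicate n 0
∣∣≡0⇒≡0 []         eq = ≡.refl
∣∣≡0⇒≡0 (zero ∷ α) eq = ≡.cong (0 ∷_) (∣∣≡0⇒≡0 α eq)

split-e : ∀ (α : Vec ℕ n) {k} → ∣ α ∣ ≡ suc k → ∃[ i ] ∃[ β ] α ≡ e i ⊕ β × ∣ β ∣ ≡ k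
split-e (suc a ∷ α) eq = zero , a ∷ α , ≡.cong (suc a ∷_) (≡.sym (0⊕ α)) , ℕ.suc-injective eq
split-e (zero ∷ α)  eq with split-e α eq
... | i , β , ≡.refl , ∣β∣≡k = suc i , 0 ∷ β , ≡.refl , ∣β∣≡k

split-e⊕e : ∀ (α : Vec ℕ n) → ∣ α ∣ ≡ 2 → ∃[ i ] ∃[ j ] α ≡ e i ⊕ e j
split-e⊕e α ∣α∣≡2 with split-e α ∣α∣≡2
... | i , β , ≡.refl , ∣β∣≡1 with split-e β ∣β∣≡1
... | j , γ , ≡.refl , ∣γ∣≡0 with ∣∣≡0⇒≡0 γ ∣γ∣≡0
... | ≡.refl = i , j , ≡.cong (e i ⊕_) (≡.trans (⊕-comm (e j) _) (0⊕ (e j)))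

⊖e⊕e : ∀ (α : Vec ℕ n) i → 0 ℕ.< lookup α i → α ⊖ e i ⊕ e i ≡ α
⊖e⊕e (suc a ∷ α) zero    _   = ≡.cong₂ _∷_ (ℕ.+-comm a 1) (⊖0⊕0 α)
  where
  ⊖0⊕0 : ∀ {n} (α : Vec ℕ n) → α ⊖ replicate n 0 ⊕ replicate n 0 ≡ α
  ⊖0⊕0 []      = ≡.refl
  ⊖0⊕0 (a ∷ α) = ≡.cong₂ _∷_ (ℕ.+-identityʳ a) (⊖0⊕0 α)
⊖e⊕e (a ∷ α)     (suc i) 0<α = ≡.cong₂ _∷_ (ℕ.+-identityʳ a) (⊖e⊕e α i 0<α)

∣⊖e⊕e∣ : ∀ (α : Vec ℕ n) i j → 0 ℕ.< lookup α i → ∣ α ⊖ e i ⊕ e j ∣ ≡ ∣ α ∣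
∣⊖e⊕e∣ α i j 0<αᵢ = ≡.trans (∣⊕∣ (α ⊖ e i) (e j)) (≡.trans (≡.cong (∣ α ⊖ e i ∣ ℕ.+_) (≡.trans (∣e∣ j) (≡.sym (∣e∣ i))))
  (≡.trans (≡.sym (∣⊕∣ (α ⊖ e i) (e i))) (≡.cong ∣_∣ (⊖e⊕e α i 0<αᵢ))))

∣∣-mono-≤ : ∀ (α β : Vec ℕ n) → (∀ j → lookup α j ℕ.≤ lookup β j) → ∣ α ∣ ℕ.≤ ∣ β ∣
∣∣-mono-≤ []      []      le = ℕ.z≤n
∣∣-mono-≤ (a ∷ α) (b ∷ β) le = ℕ.+-mono-≤ (le zero) (∣∣-mono-≤ α β (le ∘ suc))

∣∣-mono-< : ∀ (α β : Vec ℕ n) → (∀ j → lookup α j ℕ.≤ lookup β j) → ∀ i → lookup α i ℕ.< lookup β i → ∣ α ∣ ℕ.< ∣ β ∣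
∣∣-mono-< (a ∷ α) (b ∷ β) le zero    lt = ℕ.+-mono-<-≤ lt (∣∣-mono-≤ α β (le ∘ suc))
∣∣-mono-< (a ∷ α) (b ∷ β) le (suc i) lt = ℕ.+-mono-≤-< (le zero) (∣∣-mono-< α β (le ∘ suc) i lt)

-- Equal totals force a surplus to be balanced elsewhere; this supplies the exchange index for
-- M-convexity of the full simplex.
∃-deficit : ∀ (α β : Vec ℕ n) → ∣ α ∣ ≡ ∣ β ∣ → ∀ i → lookup β i ℕ.< lookup α i → ∃[ j ] lookup α j ℕ.< lookup β j
∃-deficit α β eq i βᵢ<αᵢ with Fin.any? (λ j → lookup α j ℕ.<? lookup β j)
... | yes p = p
... | no ¬p = contradiction (≡.sym eq) (ℕ.<⇒≢ (∣∣-mono-< β α (λ j → ℕ.≮⇒≥ (λ lt → ¬p (j , lt))) i βᵢ<αᵢ))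

-- α(X), where χ is the characteristic vector of X.
weight : Vec Bool n → Vec ℕ n → ℕ
weight []      []      = 0
weight (b ∷ χ) (a ∷ α) = (if b then a else 0) ℕ.+ weight χ α

weight-0 : ∀ (χ : Vec Bool n) → weight χ (replicate n 0) ≡ 0
weight-0 []          = ≡.refl
weight-0 (true ∷ χ)  = weight-0 χ
weight-0 (false ∷ χ) = weight-0 χ

bit : Bool → ℕ
bit b = if b then 1 else 0

weight-e : ∀ (χ : Vec Bool n) i → weight χ (e i) ≡ bit (lookup χ i)
weight-e (b ∷ χ)     zero    = ≡.trans (≡.cong (bit b ℕ.+_) (weight-0 χ)) (ℕ.+-identityʳ (bit b))
weight-e (true ∷ χ)  (suc i) = weight-e χ i
weight-e (false ∷ χ) (suc i) = weight-e χ i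

weight-⊕ : ∀ (χ : Vec Bool n) α β → weight χ (α ⊕ β) ≡ weight χ α ℕ.+ weight χ β
weight-⊕ []          []      []      = ≡.refl
weight-⊕ (false ∷ χ) (a ∷ α) (b ∷ β) = weight-⊕ χ α β
weight-⊕ (true ∷ χ)  (a ∷ α) (b ∷ β) = ≡.trans (≡.cong (a ℕ.+ b ℕ.+_) (weight-⊕ χ α β))
  (interchange a b (weight χ α) (weight χ β))

weight-e⊕e : ∀ (χ : Vec Bool n) i j → weight χ (e i ⊕ e j) ≡ bit (lookup χ i) ℕ.+ bit (lookup χ j)
weight-e⊕e χ i j = ≡.trans (weight-⊕ χ (e i) (e j)) (≡.cong₂ ℕ._+_ (weight-e χ i) (weight-e χ j))

cut : Vec Bool n → Vec ℕ n → ℕ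
cut χ γ = bit (weight χ γ ℕ.≡ᵇ 1)

-- Lorentzian families with coefficients t^m and bounded ratios

module QuadraticFamilies (em : ExcludedMiddle 0ℓ) (R : CompleteOrderedField) where
  open OrderedField em R hiding (zero)
  open Lorentzian R
  open LinearAlgebra em R
  open RealPowers em R
  open Pairings em R using (module Sum; module Product; ∑-*-distribˡ)
  open SetoidReasoning setoid

  -- The vector z = (w·v)u - (w·u)v lies in the hyperplane, and its coefficients are not both 0
  -- because u itself does not. If u·v = 0, then Q(z) is a sum of nonnegative terms, one of them
  -- positive, which is impossible. Otherwise symmetry forces l = m, so Q(z) = l|z|² ≤ 0 and z = 0
  -- is the dependence sought.
  negative-hyperplane⇒atMostOne : ∀ (H : Matrix n) → Symmetric H → ∀ w →
    (∀ x → dot w x ≈ 0# → form H x x ≤ 0#) → AtMostOnePositiveEigenvalue H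
  negative-hyperplane⇒atMostOne H H-sym w negative l m u v 0<l 0<m u-eigen v-eigen =
    q , - p , p,q≉0 , conclusion
    where
    p = dot w u
    q = dot w v
    U = dot u u
    V = dot v v
    D = dot u v
    0<U = dot-pos u (Eigenpair.nonzero u-eigen)
    0<V = dot-pos v (Eigenpair.nonzero v-eigen)
    form-eigen : ∀ {l u} → Eigenpair H l u → ∀ x → form H x u ≈ l * dot x u
    form-eigen {l} {u} u-eigen x = ≈-trans (dot-congʳ {x = x} λ i → ≈-trans (Eigenpair.eigen u-eigen i)
      (solve 2 (λ l u → l :* u := l :* u :+ con (+ 0) :* u) ≈-refl l (u i)))
      (≈-trans (dot-combʳ x l u 0# u) (solve 2 (λ l d → l :* d :+ con (+ 0) :* d := l :* d) ≈-refl l _))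
    mD≈lD : m * D ≈ l * D
    mD≈lD = ≈-trans (≈-sym (form-eigen v-eigen u)) (≈-trans (form-sym H H-sym u v)
      (≈-trans (form-eigen u-eigen v) (*-congˡ (dot-comm v u))))
    p,q≉0 : q ≉ 0# ⊎ - p ≉ 0#
    p,q≉0 with em {q ≈ 0#} | em {p ≈ 0#}
    ... | no q≉0 | _      = inj₁ q≉0
    ... | yes _  | no p≉0 = inj₂ λ -p≈0 → p≉0 (≈-trans (solve 1 (λ p → p := :- (:- p)) ≈-refl p)
            (≈-trans (-‿cong -p≈0) (solve 0 (:- con (+ 0) := con (+ 0)) ≈-refl)))
    ... | yes _  | yes p≈0 = contradiction (≤-respˡ (form-eigen u-eigen u) (negative u p≈0)) (<⇒≱ (*-pos 0<l 0<U))
    z = comb q u (- p) v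
    z≤0 : form H z z ≤ 0#
    z≤0 = negative z (≈-trans (dot-combʳ w q u (- p) v) (solve 2 (λ p q → q :* p :+ :- p :* q := con (+ 0)) ≈-refl p q))
    z-form : form H z z ≈ q * q * (l * U) + fromℕ 2 * (q * - p) * (m * D) + - p * - p * (m * V)
    z-form = ≈-trans (form-comb H H-sym q u (- p) v)
      (+-cong (+-cong (*-congˡ (form-eigen u-eigen u)) (*-congˡ (form-eigen v-eigen u))) (*-congˡ (form-eigen v-eigen v)))
    conclusion : ∀ i → z i ≈ 0#
    conclusion with em {D ≈ 0#}
    ... | yes D≈0 = contradiction (≤-respˡ (≈-trans z-form (≈-trans (+-congʳ (+-congˡ (*-congˡ (*-congˡ D≈0))))
              (solve 6 (λ p q l m U V → q :* q :* (l :* U) :+ con (+ 2) :* (q :* :- p) :* (m :* con (+ 0)) :+ :- p :* :- p :* (m :* V) :=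
                 q :* q :* (l :* U) :+ :- p :* :- p :* (m :* V)) ≈-refl p q l m U V))) z≤0) (<⇒≱ (positive p,q≉0))
      where
      positive : q ≉ 0# ⊎ - p ≉ 0# → 0# < q * q * (l * U) + - p * - p * (m * V)
      positive (inj₁ q≉0) = +-pos-nonNeg (*-pos (square-pos q≉0) (*-pos 0<l 0<U)) (*-nonNeg (square-nonNeg (- p)) (<⇒≤ (*-pos 0<m 0<V)))
      positive (inj₂ p≉0) = <-≤-trans (+-pos-nonNeg (*-pos (square-pos p≉0) (*-pos 0<m 0<V)) (*-nonNeg (square-nonNeg q) (<⇒≤ (*-pos 0<l 0<U))))
        (≤-reflexive (+-comm _ _))
    ... | no  D≉0 = dot≈0⇒≈0 z (≤-antisym (*-cancelˡ-≤ l 0<l (≤-respˡ z-form′ (≤-respʳ (≈-sym (zeroʳ l)) z≤0))) (dot-nonNeg z))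
      where
      m≈l : m ≈ l
      m≈l = *-cancelˡ-≈ D D≉0 (≈-trans (*-comm D m) (≈-trans mD≈lD (*-comm l D)))
      z-form′ : form H z z ≈ l * dot z z
      z-form′ = begin
        form H z z
          ≈⟨ z-form ⟩
        q * q * (l * U) + fromℕ 2 * (q * - p) * (m * D) + - p * - p * (m * V)
          ≈⟨ +-cong (+-congˡ (*-congˡ mD≈lD)) (*-congˡ (*-congʳ m≈l)) ⟩
        q * q * (l * U) + fromℕ 2 * (q * - p) * (l * D) + - p * - p * (l * V)
          ≈⟨ solve 6 (λ p q l U D V → q :* q :* (l :* U) :+ con (+ 2) :* (q :* :- p) :* (l :* D) :+ :- p :* :- p :* (l :* V) :=
               l :* (q :* (q :* U :+ :- p :* D) :+ :- p :* (q :* D :+ :- p :* V))) ≈-refl p q l U D V ⟩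
        l * (q * (q * U + - p * D) + - p * (q * D + - p * V))
          ≈⟨ *-congˡ (+-cong (*-congˡ (≈-trans (dot-combʳ u q u (- p) v) ≈-refl))
               (*-congˡ (≈-trans (dot-combʳ v q u (- p) v) (+-congʳ (*-congˡ (dot-comm v u)))))) ⟨
        l * (q * dot u z + - p * dot v z)
          ≈⟨ *-congˡ (dot-combˡ q u (- p) v z) ⟨
        l * dot z z ∎

  rank-two-atMostOne : ∀ (H : Matrix n) (φ ψ : Vector n) k → 0# ≤ k →
    (∀ i j → H i j ≈ φ i * φ j - k * (ψ i * ψ j)) → AtMostOnePositiveEigenvalue H
  rank-two-atMostOne {n} H φ ψ k 0≤k H≈ = negative-hyperplane⇒atMostOne H
    (λ i j → ≈-trans (H≈ i j) (≈-trans (+-cong (*-comm _ _) (-‿cong (*-congˡ (*-comm _ _)))) (≈-sym (H≈ j i)))) φ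
    λ x φ⊥x → ≤-diff (*-nonNeg 0≤k (square-nonNeg (dot ψ x))) (begin
      0# - form H x x
        ≈⟨ +-congˡ (-‿cong (dot-congʳ {x = x} λ i → dot-cong (entry i) (λ _ → ≈-refl))) ⟩
      0# - form H′ x x
        ≈⟨ +-congˡ (-‿cong (≈-trans (rankOne-form 1# (rankOne 0# H (- 1#) φ) k ψ x x)
             (+-congʳ (*-congˡ (≈-trans (rankOne-form 0# H (- 1#) φ x x) (+-congˡ (-‿cong (*-congˡ (*-cong φ⊥x φ⊥x))))))))) ⟩
      0# - (1# * (0# * form H x x - - 1# * (0# * 0#)) - k * (dot ψ x * dot ψ x))
        ≈⟨ solve 4 (λ h o k d → con (+ 0) :- (o :* (con (+ 0) :* h :- :- o :* (con (+ 0) :* con (+ 0))) :- k :* (d :* d)) := k :* (d :* d)) ≈-refl (form H x x) 1# k (dot ψ x) ⟩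
      k * (dot ψ x * dot ψ x) ∎)
    where
    -- The inner `rankOne`, with scale 0 and coefficient -1, is φ φᵀ.
    H′ = rankOne 1# (rankOne 0# H (- 1#) φ) k ψ
    entry : ∀ i j → H i j ≈ H′ i j
    entry i j = ≈-trans (H≈ i j) (+-congʳ (≈-sym (≈-trans (*-identityˡ _)
      (≈-trans (solve 3 (λ h o x → con (+ 0) :* h :- :- o :* x := o :* x) ≈-refl (H i j) 1# (φ i * φ j)) (*-identityˡ _)))))

  ∑-mono : ∀ {A : Set} {f g : A → Carrier} {xs} → All (λ x → f x ≤ g x) xs → ∑ (map f xs) ≤ ∑ (map g xs)
  ∑-mono []       = ≤-refl
  ∑-mono (p ∷ ps) = +-mono-≤ p (∑-mono ps)

  ∏-nonNeg : ∀ {A : Set} {f : A → Carrier} → (∀ x → 0# ≤ f x) → ∀ xs → 0# ≤ ∏ (map f xs)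
  ∏-nonNeg 0≤f []       = 0≤1
  ∏-nonNeg 0≤f (x ∷ xs) = *-nonNeg (0≤f x) (∏-nonNeg 0≤f xs)

  ∏-mono : ∀ {A : Set} {f g : A → Carrier} → (∀ x → 0# ≤ f x) → ∀ {xs} → All (λ x → f x ≤ g x) xs →
    ∏ (map f xs) ≤ ∏ (map g xs)
  ∏-mono 0≤f []                 = ≤-refl
  ∏-mono 0≤f (_∷_ {xs = xs} p ps) = *-mono-≤ (0≤f _) (≤-trans (∏-nonNeg 0≤f xs) (∏-mono 0≤f ps)) p (∏-mono 0≤f ps)

  fromℕ-sum : ∀ {A : Set} (f : A → ℕ) xs → fromℕ (List.sum (map f xs)) ≈ ∑ (map (fromℕ ∘ f) xs)
  fromℕ-sum f []       = ≈-refl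
  fromℕ-sum f (x ∷ xs) = ≈-trans (fromℕ-+ (f x) _) (+-congˡ (fromℕ-sum f xs))

  ∏-^ : ∀ {A : Set} s (f : A → ℕ) xs → ∏ (map (λ x → s ^ f x) xs) ≈ s ^ List.sum (map f xs)
  ∏-^ s f []       = ≈-refl
  ∏-^ s f (x ∷ xs) = ≈-trans (*-congˡ (∏-^ s f xs)) (≈-sym (^-homo-* s (f x) _))

  -- The quadratic forms ∑ t^{m(γ)} x^γ / γ!.
  monomialFamily : (Vec ℕ n → ℕ) → Carrier → Family n
  monomialFamily m t γ = if ∣ γ ∣ ℕ.≡ᵇ 2 then t ^ m γ else 0#

  -- Stated for every S with the members of Δ, because the local subsets of Δ₄ᵈ share its members
  -- but have a different membership test. At least one variable makes the support nonempty.
  module _ (S : Subset (suc n) 2) (full : ∀ γ → ∣ γ ∣ ≡ 2 → γ ∈ S) where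

    pairing : Family (suc n) → (Vec ℕ (suc n) → ℕ) → Carrier
    pairing v m = ∑ (map (λ γ → v γ * fromℕ (m γ)) (elements S))

    Polarised : (Vec ℕ (suc n) → ℕ) → Set
    Polarised m = ∀ v → BR S v → pairing v m ≤ 0#

    monomialFamily-on : ∀ m t {γ} → ∣ γ ∣ ≡ 2 → monomialFamily {suc n} m t γ ≡ t ^ m γ
    monomialFamily-on m t {γ} ∣γ∣≡2 with ∣ γ ∣ ℕ.≡ᵇ 2 | ℕ.≡⇒≡ᵇ ∣ γ ∣ 2 ∣γ∣≡2
    ... | true | _ = ≡.refl

    monomialFamily-off : ∀ m t {γ} → ¬ (∣ γ ∣ ≡ 2) → monomialFamily {suc n} m t γ ≡ 0#
    monomialFamily-off m t {γ} ∣γ∣≢2 with ∣ γ ∣ ℕ.≡ᵇ 2 in eq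
    ... | true  = contradiction (ℕ.≡ᵇ⇒≡ ∣ γ ∣ 2 (≡.subst T (≡.sym eq) tt)) ∣γ∣≢2
    ... | false = ≡.refl

    monomialFamily-∈𝓛⁺ : ∀ m t → 1# ≤ t → AtMostOnePositiveEigenvalue (λ i j → t ^ m (e i ⊕ e j)) →
      𝓛⁺ S (monomialFamily m t)
    monomialFamily-∈𝓛⁺ m t 1≤t amo = record
      { homogeneous = λ α ne → ≈-reflexive (monomialFamily-off m t ne)
      ; nonNeg      = nonNeg
      ; nonzero     = γ₀ , nonzero γ₀ ∣γ₀∣≡2
      ; mConvex     = (γ₀ , nonzero γ₀ ∣γ₀∣≡2) , exchange
      ; signature   = λ β ∣β∣≡0 → QuadraticInequalities.atMostOne-cong em R (λ i j → ≈-sym (entry β (ℕ.≡ᵇ⇒≡ ∣ β ∣ 0 ∣β∣≡0) i j)) amo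
      } , λ α → mk⇔ (λ 0<c → full α (support α (<⇒≉ 0<c))) (λ α∈S → positive α (degree S α α∈S))
      where
      c = monomialFamily m t
      γ₀ : Vec ℕ (suc n)
      γ₀ = e zero ⊕ e zero
      ∣γ₀∣≡2 : ∣ γ₀ ∣ ≡ 2
      ∣γ₀∣≡2 = ≡.trans (∣⊕∣ {suc n} (e zero) (e zero)) (≡.cong₂ ℕ._+_ (∣e∣ {suc n} zero) (∣e∣ {suc n} zero))
      positive : ∀ α → ∣ α ∣ ≡ 2 → 0# < c α
      positive α ∣α∣≡2 = ≡.subst (0# <_) (≡.sym (monomialFamily-on m t ∣α∣≡2)) (^-pos (<-≤-trans 0<1 1≤t) (m α))
      nonzero : ∀ α → ∣ α ∣ ≡ 2 → c α ≉ 0#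
      nonzero α ∣α∣≡2 = <⇒≉ (positive α ∣α∣≡2)
      support : ∀ α → c α ≉ 0# → ∣ α ∣ ≡ 2
      support α c≉0 with ∣ α ∣ ℕ.≟ 2
      ... | yes eq = eq
      ... | no  ne = contradiction (≈-reflexive (monomialFamily-off m t ne)) c≉0
      nonNeg : ∀ α → 0# ≤ c α
      nonNeg α with ∣ α ∣ ℕ.≟ 2
      ... | yes eq = <⇒≤ (positive α eq)
      ... | no  ne = ≤-reflexive (≈-reflexive (≡.sym (monomialFamily-off m t ne)))
      exchange : ∀ α β → c α ≉ 0# → c β ≉ 0# → ∀ i → lookup β i ℕ.< lookup α i →
        ∃[ j ] (lookup α j ℕ.< lookup β j) × c (α ⊖ e i ⊕ e j) ≉ 0# × c (β ⊖ e j ⊕ e i) ≉ 0#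
      exchange α β cα cβ i βᵢ<αᵢ with ∃-deficit α β (≡.trans (support α cα) (≡.sym (support β cβ))) i βᵢ<αᵢ
      ... | j , αⱼ<βⱼ = j , αⱼ<βⱼ ,
        nonzero _ (≡.trans (∣⊖e⊕e∣ α i j (ℕ.≤-<-trans ℕ.z≤n βᵢ<αᵢ)) (support α cα)) ,
        nonzero _ (≡.trans (∣⊖e⊕e∣ β j i (ℕ.≤-<-trans ℕ.z≤n αⱼ<βⱼ)) (support β cβ))
      entry : ∀ β → ∣ β ∣ ≡ 0 → ∀ i j → hessian c β i j ≈ t ^ m (e i ⊕ e j)
      entry β ∣β∣≡0 i j = ≈-reflexive (≡.trans (monomialFamily-on m t (≡.trans (∣⊕e⊕e∣ β i j) (≡.cong (ℕ._+ 2) ∣β∣≡0)))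
        (≡.cong (λ α → t ^ m (α ⊕ e j)) (≡.trans (≡.cong (_⊕ e i) (∣∣≡0⇒≡0 β ∣β∣≡0)) (0⊕ (e i)))))

    -- A violation ⟨v, m⟩ > 0 makes the ratio at s^{Km} grow at least
    -- linearly in s, where K is a common denominator of rational lower
    -- approximations of the exponents v.
    polarised-from-family : ∀ m → (∀ t → 1# ≤ t → AtMostOnePositiveEigenvalue (λ i j → t ^ m (e i ⊕ e j))) → Polarised m
    polarised-from-family m amo v (M , bound) with em {pairing v m ≤ 0#}
    ... | yes le = le
    ... | no  nl = contradiction (≤-trans s≤ratio (bound c (monomialFamily-∈𝓛⁺ m t 1≤t (amo t 1≤t)))) (<⇒≱ M<s)
      where
      L = elements S
      X = pairing v m
      0<X : 0# < X
      0<X = ≰⇒> nl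
      -- Rounding K v(γ) down loses at most m(γ) in each term, hence at most N in total. With K X ≥
      -- N + 1 the integer exponent ΣP - ΣQ is still at least 1, which leaves a full factor s.
      N = ∑ (map (fromℕ ∘ m) L)
      k = proj₁ (archimedean ((N + 1#) * X ⁻¹))
      K = suc k
      N+1≤KX : N + 1# ≤ fromℕ K * X
      N+1≤KX = ≤-respˡ (*⁻¹-cancelʳ (N + 1#) 0<X) (≤-respˡ (*-comm _ _) (≤-respʳ (*-comm _ _)
        (*-monoʳ-≤ X (<⇒≤ 0<X) (≤-trans (proj₂ (archimedean ((N + 1#) * X ⁻¹))) (fromℕ-mono (ℕ.n≤1+n k))))))
      P Q : Vec ℕ (suc n) → ℕ
      P γ = proj₁ (floor (fromℕ K * v γ))
      Q γ = proj₁ (proj₂ (floor (fromℕ K * v γ)))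
      mP mQ : Vec ℕ (suc n) → ℕ
      mP γ = m γ ℕ.* P γ
      mQ γ = m γ ℕ.* Q γ
      ΣP = List.sum (map mP L)
      ΣQ = List.sum (map mQ L)
      termwise : ∀ γ → fromℕ K * (v γ * fromℕ (m γ)) + fromℕ (mQ γ) ≤ fromℕ (mP γ) + fromℕ (m γ)
      termwise γ = ≤-diff (*-nonNeg (fromℕ-nonNeg (m γ)) (0≤y-x (proj₂ (proj₂ (proj₂ (floor (fromℕ K * v γ)))))))
        (≈-trans (+-cong (+-congʳ (fromℕ-* (m γ) (P γ))) (-‿cong (+-congˡ (fromℕ-* (m γ) (Q γ)))))
          (≈-trans (+-congʳ (+-congˡ (≈-sym (*-identityʳ (fromℕ (m γ))))))
          (solve 6 (λ K v m P Q o → m :* P :+ m :* o :- (K :* (v :* m) :+ m :* Q) := m :* (P :+ o :- (Q :+ K :* v)))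
            ≈-refl (fromℕ K) (v γ) (fromℕ (m γ)) (fromℕ (P γ)) (fromℕ (Q γ)) 1#)))
      summed : fromℕ K * X + fromℕ ΣQ ≤ fromℕ ΣP + N
      summed = ≤-respˡ (≈-trans (Sum.fold-∙ (λ γ → fromℕ K * (v γ * fromℕ (m γ))) (fromℕ ∘ mQ) L)
                 (+-cong (∑-*-distribˡ (fromℕ K) (λ γ → v γ * fromℕ (m γ)) L) (≈-sym (fromℕ-sum mQ L))))
        (≤-respʳ (≈-trans (Sum.fold-∙ (fromℕ ∘ mP) (fromℕ ∘ m) L) (+-congʳ (≈-sym (fromℕ-sum mP L))))
          (∑-mono (All.universal termwise L)))
      ΣQ<ΣP : suc ΣQ ℕ.≤ ΣP
      ΣQ<ΣP = fromℕ-cancel-≤ (≤-diff (+-nonNeg (0≤y-x summed) (0≤y-x N+1≤KX))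
        (solve 5 (λ P Q N KX o → P :- (o :+ Q) := (P :+ N :- (KX :+ Q)) :+ (KX :- (N :+ o))) ≈-refl
          (fromℕ ΣP) (fromℕ ΣQ) N (fromℕ K * X) 1#))
      s = fromℕ (suc (proj₁ (archimedean M)))
      1≤s : 1# ≤ s
      1≤s = ≤-respˡ (+-identityʳ 1#) (fromℕ-mono {1} {suc (proj₁ (archimedean M))} (ℕ.s≤s ℕ.z≤n))
      0<s = <-≤-trans 0<1 1≤s
      M<s : M < s
      M<s = ≰⇒> λ s≤M → <⇒≱ (fromℕ-mono-< (ℕ.n<1+n (proj₁ (archimedean M)))) (≤-trans s≤M (proj₂ (archimedean M)))
      -- A K-th power, so that every coefficient t^m is an exact K-th power as `pow-lower` requires.
      t = s ^ K
      1≤t : 1# ≤ t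
      1≤t = 1≤^ 1≤s K
      c = monomialFamily m t
      factor : ∀ γ → γ ∈ S → s ^ mP γ ≤ pow (c γ) (v γ) * s ^ mQ γ
      factor γ γ∈S = pow-lower (m γ) k (P γ) (Q γ) 1≤s
        (≈-trans (≈-reflexive (monomialFamily-on m t (degree S γ γ∈S)))
          (≈-trans (^-assocʳ s K (m γ)) (≈-reflexive (≡.cong (s ^_) (ℕ.*-comm K (m γ))))))
        (proj₁ (proj₂ (proj₂ (floor (fromℕ K * v γ)))))
      s≤ratio : s ≤ ratio S v c
      s≤ratio = *-cancelˡ-≤ (s ^ ΣQ) (^-pos 0<s ΣQ) (≤-respˡ (*-comm s (s ^ ΣQ)) (≤-trans (^-monoʳ-≤ 1≤s ΣQ<ΣP)
        (≤-respˡ (∏-^ s mP L) (≤-respʳ (≈-trans (Product.fold-∙ (λ γ → pow (c γ) (v γ)) (λ γ → s ^ mQ γ) L)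
            (≈-trans (*-congˡ (∏-^ s mQ L)) (*-comm _ _)))
          (∏-mono (λ γ → ^-nonNeg (<⇒≤ 0<s) (mP γ)) (All.map (λ {γ} → factor γ) (elements-∈ S)))))))

    -- The Hessian is φ φᵀ, with φ equal to t on X and to 1 off X.
    polarised-weight : ∀ χ → Polarised (weight χ)
    polarised-weight χ = polarised-from-family (weight χ) λ t 1≤t →
      rank-two-atMostOne _ (λ i → t ^ bit (lookup χ i)) (λ _ → 0#) 0# ≤-refl λ i j →
        ≈-trans (≈-reflexive (≡.cong (t ^_) (weight-e⊕e χ i j))) (≈-trans (^-homo-* t (bit (lookup χ i)) _)
          (solve 1 (λ x → x := x :- con (+ 0) :* (con (+ 0) :* con (+ 0))) ≈-refl _))

    polarised-cut : ∀ χ → Polarised (cut χ)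
    polarised-cut χ = polarised-from-family (cut χ) λ t 1≤t →
      rank-two-atMostOne _ (φ t ∘ lookup χ) (ψ ∘ lookup χ) (t * t - 1#)
        (0≤y-x (≤-respˡ (*-identityˡ 1#) (*-mono-≤ 0≤1 (≤-trans 0≤1 1≤t) 1≤t 1≤t))) λ i j →
        ≈-trans (≈-reflexive (≡.cong (λ k → t ^ bit (k ℕ.≡ᵇ 1)) (weight-e⊕e χ i j))) (entry t (lookup χ i) (lookup χ j))
      where
      φ : Carrier → Bool → Carrier
      φ t b = if b then t else 1#
      ψ : Bool → Carrier
      ψ b = if b then 1# else 0#
      entry : ∀ t b b′ → t ^ bit ((bit b ℕ.+ bit b′) ℕ.≡ᵇ 1) ≈ φ t b * φ t b′ - (t * t - 1#) * (ψ b * ψ b′)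
      entry t false false = ≈-trans (≈-sym (*-identityˡ 1#)) (solve 2 (λ t o → o :* o := o :* o :- (t :* t :- o) :* (con (+ 0) :* con (+ 0))) ≈-refl t 1#)
      entry t false true  = ≈-trans (*-comm t 1#) (solve 2 (λ t o → o :* t := o :* t :- (t :* t :- o) :* (con (+ 0) :* o)) ≈-refl t 1#)
      entry t true  false = solve 2 (λ t o → t :* o := t :* o :- (t :* t :- o) :* (o :* con (+ 0))) ≈-refl t 1#
      entry t true  true  = ≈-sym (≈-trans (+-congˡ (-‿cong (≈-trans (*-congˡ (*-identityˡ 1#)) (*-identityʳ _))))
        (solve 2 (λ t o → t :* t :- (t :* t :- o) := o) ≈-refl t 1#))

    polarised-+ : ∀ {m m′} → Polarised m → Polarised m′ → Polarised (λ γ → m γ ℕ.+ m′ γ)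
    polarised-+ {m} {m′} p p′ v v∈BR = ≤-respʳ (+-identityˡ 0#) (≤-respˡ (≈-sym (≈-trans
      (Sum.fold-cong (All.universal (λ γ → ≈-trans (*-congˡ (fromℕ-+ (m γ) (m′ γ))) (distribˡ (v γ) _ _)) (elements S)))
      (Sum.fold-∙ (λ γ → v γ * fromℕ (m γ)) (λ γ → v γ * fromℕ (m′ γ)) (elements S)))) (+-mono-≤ (p v v∈BR) (p′ v v∈BR)))

    polarised-* : ∀ k {m} → Polarised m → Polarised (λ γ → k ℕ.* m γ)
    polarised-* k {m} p v v∈BR = ≤-respʳ (zeroʳ (fromℕ k)) (≤-respˡ (≈-sym (≈-trans
      (Sum.fold-cong (All.universal (λ γ → ≈-trans (*-congˡ (fromℕ-* k (m γ)))
        (solve 3 (λ v k m → v :* (k :* m) := k :* (v :* m)) ≈-refl (v γ) (fromℕ k) (fromℕ (m γ)))) (elements S)))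
      (∑-*-distribˡ (fromℕ k) (λ γ → v γ * fromℕ (m γ)) (elements S)))) (*-monoʳ-≤ (fromℕ k) (fromℕ-nonNeg k) (p v v∈BR)))

-- Every multi-index of degree 2 has the form eᵢ + eⱼ, so a decidable property of them is settled by
-- evaluating finitely many cases.
quadratic-check : ∀ {n} {P : Vec ℕ n → Set} (P? : ∀ γ → Dec (P γ)) →
  {True (Fin.all? λ i → Fin.all? λ j → P? (e i ⊕ e j))} → ∀ γ → ∣ γ ∣ ≡ 2 → P γ
quadratic-check P? {check} γ ∣γ∣≡2 with split-e⊕e γ ∣γ∣≡2
... | i , j , ≡.refl = toWitness check i j

weight-complement : ∀ {n} (χ : Vec Bool n) γ → weight χ γ ℕ.+ weight (Vec.map not χ) γ ≡ ∣ γ ∣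
weight-complement []          []      = ≡.refl
weight-complement (true ∷ χ)  (g ∷ γ) = ≡.trans (ℕ.+-assoc g _ _) (≡.cong (g ℕ.+_) (weight-complement χ γ))
weight-complement (false ∷ χ) (g ∷ γ) = ≡.trans (ℕ.+-comm (weight χ γ) _)
  (≡.trans (ℕ.+-assoc g _ _) (≡.cong (g ℕ.+_) (≡.trans (ℕ.+-comm _ (weight χ γ)) (weight-complement χ γ))))

⊕-cancelʳ : ∀ {n} {α β : Vec ℕ n} γ → α ⊕ γ ≡ β ⊕ γ → α ≡ β
⊕-cancelʳ {α = α} {β} γ eq = ⊕-cancelˡ γ (≡.trans (⊕-comm γ α) (≡.trans eq (⊕-comm β γ)))

-- Local decomposition of q_d into weights and cuts

module Decomposition (em : ExcludedMiddle 0ℓ) (R : CompleteOrderedField) {d : ℕ} (4≤d : 4 ℕ.≤ d) where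
  open Lorentzian R using (μ; ε; base; α*)
  open Pairings em R using (μ-≤; μ-≥; μ[b+1]; μ[b+2]; μ[b+3])

  -- Minus the second difference of μ_d at s + 1. By `μ-concave` the truncated subtraction is exact
  -- as long as s + 2 ≤ d.
  κ : ℕ → ℕ
  κ s = 2 ℕ.* μ d (s ℕ.+ 1) ∸ (μ d s ℕ.+ μ d (s ℕ.+ 2))

  μ-concave : ∀ s → s ℕ.+ 2 ℕ.≤ d → μ d s ℕ.+ μ d (s ℕ.+ 2) ℕ.≤ 2 ℕ.* μ d (s ℕ.+ 1)
  μ-concave s s+2≤d = concave (ℕ.≤-total s r)
    where
    r = d ∸ (s ℕ.+ 2)
    s+2+r≡d : s ℕ.+ 2 ℕ.+ r ≡ d
    s+2+r≡d = ℕ.m+[n∸m]≡n s+2≤d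
    s+1+[r+1]≡d : s ℕ.+ 1 ℕ.+ (r ℕ.+ 1) ≡ d
    s+1+[r+1]≡d = ≡.trans (solve 2 (λ s r → s :+ con 1 :+ (r :+ con 1) := s :+ con 2 :+ r) ≡.refl s r) s+2+r≡d
      where open +-*-Solver
    s+[r+2]≡d : s ℕ.+ (r ℕ.+ 2) ≡ d
    s+[r+2]≡d = ≡.trans (solve 2 (λ s r → s :+ (r :+ con 2) := s :+ con 2 :+ r) ≡.refl s r) s+2+r≡d
      where open +-*-Solver
    μ≤ˡ : ∀ s → μ d s ℕ.≤ s
    μ≤ˡ s = ℕ.m⊓n≤m s (d ∸ s)
    μ≤ʳ : ∀ {s r} → s ℕ.+ r ≡ d → μ d s ℕ.≤ r
    μ≤ʳ {s} {r} eq = ≡.subst (μ d s ℕ.≤_) (≡.trans (≡.cong (_∸ s) (≡.sym eq)) (ℕ.m+n∸m≡n s r)) (ℕ.m⊓n≤n s (d ∸ s))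
    concave : s ℕ.≤ r ⊎ r ℕ.≤ s → μ d s ℕ.+ μ d (s ℕ.+ 2) ℕ.≤ 2 ℕ.* μ d (s ℕ.+ 1)
    concave (inj₁ s≤r) = ≡.subst (μ d s ℕ.+ μ d (s ℕ.+ 2) ℕ.≤_)
      (≡.trans (solve 1 (λ s → s :+ (s :+ con 2) := con 2 :* (s :+ con 1)) ≡.refl s)
        (≡.cong (2 ℕ.*_) (≡.sym (μ-≤ 4≤d s+1+[r+1]≡d (ℕ.+-monoˡ-≤ 1 s≤r)))))
      (ℕ.+-mono-≤ (μ≤ˡ s) (μ≤ˡ (s ℕ.+ 2)))
      where open +-*-Solver
    concave (inj₂ r≤s) = ≡.subst (μ d s ℕ.+ μ d (s ℕ.+ 2) ℕ.≤_)
      (≡.trans (solve 1 (λ r → r :+ con 2 :+ r := con 2 :* (r :+ con 1)) ≡.refl r)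
        (≡.cong (2 ℕ.*_) (≡.sym (μ-≥ 4≤d s+1+[r+1]≡d (ℕ.+-monoˡ-≤ 1 r≤s)))))
      (ℕ.+-mono-≤ (μ≤ʳ {s} s+[r+2]≡d) (μ≤ʳ {s ℕ.+ 2} s+2+r≡d))
      where open +-*-Solver

  -- Twice the linear interpolation: on Δ₄² the weights of X and of its complement add up to 2, and
  -- the doubling keeps the coefficients in ℕ.
  linear : Vec Bool 4 → ℕ → Vec ℕ 4 → ℕ
  linear χ s γ = μ d s ℕ.* weight (Vec.map not χ) γ ℕ.+ μ d (s ℕ.+ 2) ℕ.* weight χ γ

  -- On {s, s+1, s+2} a function is the sum of its linear interpolation
  -- between the endpoints and half its second difference at s+1.
  interpolation : ∀ χ s γ → s ℕ.+ 2 ℕ.≤ d → ∣ γ ∣ ≡ 2 →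
    2 ℕ.* μ d (s ℕ.+ weight χ γ) ≡ linear χ s γ ℕ.+ κ s ℕ.* cut χ γ
  interpolation χ s γ s+2≤d ∣γ∣≡2 = interpolate (weight χ γ) (weight (Vec.map not χ) γ) (≡.trans (weight-complement χ γ) ∣γ∣≡2)
    where
    interpolate : ∀ w w′ → w ℕ.+ w′ ≡ 2 →
      2 ℕ.* μ d (s ℕ.+ w) ≡ μ d s ℕ.* w′ ℕ.+ μ d (s ℕ.+ 2) ℕ.* w ℕ.+ κ s ℕ.* bit (w ℕ.≡ᵇ 1)
    interpolate 0 .2 ≡.refl = ≡.trans (≡.cong (λ k → 2 ℕ.* μ d k) (ℕ.+-identityʳ s))
      (solve 3 (λ x y k → con 2 :* x := x :* con 2 :+ y :* con 0 :+ k :* con 0) ≡.refl (μ d s) (μ d (s ℕ.+ 2)) (κ s))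
      where open +-*-Solver
    interpolate 1 .1 ≡.refl = ≡.trans (≡.sym (ℕ.m+[n∸m]≡n (μ-concave s s+2≤d)))
      (solve 3 (λ x y k → x :+ y :+ k := x :* con 1 :+ y :* con 1 :+ k :* con 1) ≡.refl (μ d s) (μ d (s ℕ.+ 2)) (κ s))
      where open +-*-Solver
    interpolate 2 .0 ≡.refl =
      solve 3 (λ x y k → con 2 :* y := x :* con 0 :+ y :* con 2 :+ k :* con 0) ≡.refl (μ d s) (μ d (s ℕ.+ 2)) (κ s)
      where open +-*-Solver

  χ₂₃ χ₃₄ χ₁ χ₂ χ₃ χ₄ : Vec Bool 4
  χ₂₃ = false ∷ true  ∷ true  ∷ false ∷ []
  χ₃₄ = false ∷ false ∷ true  ∷ true  ∷ []
  χ₁  = true  ∷ false ∷ false ∷ false ∷ []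
  χ₂  = false ∷ true  ∷ false ∷ false ∷ []
  χ₃  = false ∷ false ∷ true  ∷ false ∷ []
  χ₄  = false ∷ false ∷ false ∷ true  ∷ []

  s₂₃ s₃₄ : Vec ℕ 4 → ℕ
  s₂₃ α = lookup α 1F ℕ.+ lookup α 2F
  s₃₄ α = lookup α 2F ℕ.+ lookup α 3F

  s₂₃-⊕ : ∀ β γ → s₂₃ (β ⊕ γ) ≡ s₂₃ β ℕ.+ weight χ₂₃ γ
  s₂₃-⊕ (_ ∷ b₁ ∷ b₂ ∷ _ ∷ []) (_ ∷ g₁ ∷ g₂ ∷ _ ∷ []) = solve 4 (λ b₁ b₂ g₁ g₂ →
    b₁ :+ g₁ :+ (b₂ :+ g₂) := b₁ :+ b₂ :+ (g₁ :+ (g₂ :+ con 0))) ≡.refl b₁ b₂ g₁ g₂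
    where open +-*-Solver

  s₃₄-⊕ : ∀ β γ → s₃₄ (β ⊕ γ) ≡ s₃₄ β ℕ.+ weight χ₃₄ γ
  s₃₄-⊕ (_ ∷ _ ∷ b₁ ∷ b₂ ∷ []) (_ ∷ _ ∷ g₁ ∷ g₂ ∷ []) = solve 4 (λ b₁ b₂ g₁ g₂ →
    b₁ :+ g₁ :+ (b₂ :+ g₂) := b₁ :+ b₂ :+ (g₁ :+ (g₂ :+ con 0))) ≡.refl b₁ b₂ g₁ g₂
    where open +-*-Solver

  s₂₃≤ : ∀ β → s₂₃ β ℕ.≤ ∣ β ∣
  s₂₃≤ (b₀ ∷ b₁ ∷ b₂ ∷ b₃ ∷ []) = ℕ.≤-trans (ℕ.+-monoʳ-≤ b₁ (ℕ.m≤m+n b₂ _)) (ℕ.m≤n+m _ b₀)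

  s₃₄≤ : ∀ β → s₃₄ β ℕ.≤ ∣ β ∣
  s₃₄≤ (b₀ ∷ b₁ ∷ b₂ ∷ b₃ ∷ []) = ℕ.≤-trans (ℕ.+-monoʳ-≤ b₂ (ℕ.m≤m+n b₃ 0)) (ℕ.≤-trans (ℕ.m≤n+m _ b₁) (ℕ.m≤n+m _ b₀))

  private
    a b : ℕ
    a = ⌊ d ∸ 4 /2⌋
    b = ⌈ d ∸ 4 /2⌉

  parity : ∀ n → 2 ℕ.* (⌊ n /2⌋ ℕ.+ 2) ≡ ⌈ n /2⌉ ℕ.+ 1 ℕ.+ (⌊ n /2⌋ ℕ.+ 1) ℕ.+ ε n
  parity zero          = ≡.refl
  parity (suc zero)    = ≡.refl
  parity (suc (suc n)) = ≡.trans (solve 1 (λ f → con 2 :* (con 1 :+ f :+ con 2) := con 2 :+ con 2 :* (f :+ con 2)) ≡.refl ⌊ n /2⌋)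
    (≡.trans (≡.cong (2 ℕ.+_) (parity n))
    (solve 3 (λ c f ε → con 2 :+ (c :+ con 1 :+ (f :+ con 1) :+ ε) := con 1 :+ c :+ con 1 :+ (con 1 :+ f :+ con 1) :+ ε) ≡.refl ⌈ n /2⌉ ⌊ n /2⌋ (ε n)))
    where open +-*-Solver

  ε-∸4 : ∀ {d} → 4 ℕ.≤ d → ε (d ∸ 4) ≡ ε d
  ε-∸4 (ℕ.s≤s (ℕ.s≤s (ℕ.s≤s (ℕ.s≤s _)))) = ≡.refl

  -- The origin of ε_d: 2(a + 2) - (b + 1) - (a + 1) = 2 - (b - a), and b - a is the parity of d.
  κ[b+1]≡ε : κ (b ℕ.+ 1) ≡ ε d
  κ[b+1]≡ε = ≡.trans
    (≡.cong₂ _∸_ (≡.trans (≡.cong (2 ℕ.*_) (≡.trans (≡.cong (μ d) (ℕ.+-assoc b 1 1)) (μ[b+2] 4≤d))) (parity (d ∸ 4)))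
      (≡.cong₂ ℕ._+_ (μ[b+1] 4≤d) (≡.trans (≡.cong (μ d) (ℕ.+-assoc b 1 2)) (μ[b+3] 4≤d))))
    (≡.trans (ℕ.m+n∸m≡n (b ℕ.+ 1 ℕ.+ (a ℕ.+ 1)) (ε (d ∸ 4))) (ε-∸4 4≤d))

  ε≤2 : ε d ℕ.≤ 2
  ε≤2 with d ℕ.% 2 ℕ.≡ᵇ 0
  ... | true  = ℕ.≤-refl
  ... | false = ℕ.s≤s ℕ.z≤n

  -- What is left of the coefficient μ_d(b + 2) = a + 2 after ε_d of it is spent on the correction;
  -- ε_d ≤ 2 keeps the subtraction exact.
  r : ℕ
  r = μ d (b ℕ.+ 2) ∸ ε d

  μ[b+2]≡r+ε : μ d (b ℕ.+ 2) ≡ r ℕ.+ ε d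
  μ[b+2]≡r+ε = ≡.sym (ℕ.m∸n+n≡m (ℕ.≤-trans ε≤2 (≡.subst (2 ℕ.≤_) (≡.sym (μ[b+2] 4≤d)) (ℕ.m≤n+m 2 a))))

  at : Vec ℕ 4 → Vec ℕ 4 → ℕ
  at β γ = bit ⌊ α* d ≟ (β ⊕ γ) ⌋

  v₁₁ v₁₃ v₃₃ : Vec ℕ 4
  v₁₁ = 2 ∷ 0 ∷ 0 ∷ 0 ∷ []
  v₁₃ = 1 ∷ 0 ∷ 1 ∷ 0 ∷ []
  v₃₃ = 0 ∷ 0 ∷ 2 ∷ 0 ∷ []

  at-base : ∀ v γ → at (base d ⊕ v) γ ≡ bit ⌊ (v₁₃ ⊕ v₁₃) ≟ (v ⊕ γ) ⌋
  at-base v γ = ≡.cong bit (≡.trans (≡.cong (λ α → ⌊ α* d ≟ α ⌋) (⊕-assoc (base d) v γ)) (⌊≟⌋-⊕ (base d) (v₁₃ ⊕ v₁₃) (v ⊕ γ)))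

  -- The second and fourth coordinates of α* are 0, so γ can only be 2e₁, e₁ + e₃ or 2e₃.
  base-cases : ∀ β γ → ∣ γ ∣ ≡ 2 → α* d ≡ β ⊕ γ → β ≡ base d ⊕ v₁₁ ⊎ β ≡ base d ⊕ v₁₃ ⊎ β ≡ base d ⊕ v₃₃
  base-cases β γ ∣γ∣≡2 eq with
    quadratic-check (λ γ → (lookup γ 1F ℕ.≟ 0) →-dec ((lookup γ 3F ℕ.≟ 0) →-dec ((γ ≟ v₁₁) ⊎-dec ((γ ≟ v₁₃) ⊎-dec (γ ≟ v₃₃)))))
      γ ∣γ∣≡2 (γ₁≡0 β γ eq) (γ₃≡0 β γ eq)
    where
    γ₁≡0 : ∀ β γ → α* d ≡ β ⊕ γ → lookup γ 1F ≡ 0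
    γ₁≡0 (_ ∷ b₁ ∷ _ ∷ _ ∷ []) (_ ∷ g₁ ∷ _ ∷ _ ∷ []) eq = ℕ.m+n≡0⇒n≡0 b₁ (≡.sym (≡.cong (λ α → lookup α 1F) eq))
    γ₃≡0 : ∀ β γ → α* d ≡ β ⊕ γ → lookup γ 3F ≡ 0
    γ₃≡0 (_ ∷ _ ∷ _ ∷ b₃ ∷ []) (_ ∷ _ ∷ _ ∷ g₃ ∷ []) eq = ℕ.m+n≡0⇒n≡0 b₃ (≡.sym (≡.cong (λ α → lookup α 3F) eq))
  ... | inj₁ ≡.refl        = inj₂ (inj₂ (⊕-cancelʳ v₁₁ (≡.trans (≡.sym eq) (≡.sym (⊕-assoc (base d) v₃₃ v₁₁)))))
  ... | inj₂ (inj₁ ≡.refl) = inj₂ (inj₁ (⊕-cancelʳ v₁₃ (≡.trans (≡.sym eq) (≡.sym (⊕-assoc (base d) v₁₃ v₁₃)))))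
  ... | inj₂ (inj₂ ≡.refl) = inj₁ (⊕-cancelʳ v₃₃ (≡.trans (≡.sym eq) (≡.sym (⊕-assoc (base d) v₁₁ v₃₃))))

  PairSum : Vec ℕ 4 → Vec ℕ 4 → ℕ
  PairSum β γ = linear χ₂₃ (s₂₃ β) γ ℕ.+ κ (s₂₃ β) ℕ.* cut χ₂₃ γ ℕ.+ (linear χ₃₄ (s₃₄ β) γ ℕ.+ κ (s₃₄ β) ℕ.* cut χ₃₄ γ)

  2μ≡PairSum : ∀ β γ → ∣ β ∣ ≡ d ∸ 2 → ∣ γ ∣ ≡ 2 →
    2 ℕ.* (μ d (s₂₃ (β ⊕ γ)) ℕ.+ μ d (s₃₄ (β ⊕ γ))) ≡ PairSum β γ
  2μ≡PairSum β γ ∣β∣≡d-2 ∣γ∣≡2 = ≡.trans (ℕ.*-distribˡ-+ 2 (μ d (s₂₃ (β ⊕ γ))) _) (≡.cong₂ ℕ._+_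
    (≡.trans (≡.cong (λ k → 2 ℕ.* μ d k) (s₂₃-⊕ β γ)) (interpolation χ₂₃ (s₂₃ β) γ (bound (s₂₃≤ β)) ∣γ∣≡2))
    (≡.trans (≡.cong (λ k → 2 ℕ.* μ d k) (s₃₄-⊕ β γ)) (interpolation χ₃₄ (s₃₄ β) γ (bound (s₃₄≤ β)) ∣γ∣≡2)))
    where
    bound : ∀ {s} → s ℕ.≤ ∣ β ∣ → s ℕ.+ 2 ℕ.≤ d
    bound s≤ = ≡.subst (_ ℕ.≤_) (ℕ.m∸n+n≡m (ℕ.≤-trans (ℕ.s≤s (ℕ.s≤s ℕ.z≤n)) 4≤d))
      (ℕ.+-monoˡ-≤ 2 (ℕ.≤-trans s≤ (ℕ.≤-reflexive ∣β∣≡d-2)))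

  -- Twice q_d, restricted to β + Δ₄², as a combination of linear and cut
  -- functions with coefficients in ℕ.
  module _ (C : (Vec ℕ 4 → ℕ) → Set)
    (C-weight : ∀ χ → C (weight χ)) (C-cut : ∀ χ → C (cut χ))
    (C-+ : ∀ {m m′} → C m → C m′ → C (λ γ → m γ ℕ.+ m′ γ)) (C-* : ∀ k {m} → C m → C (λ γ → k ℕ.* m γ)) where

    private
      C-linear : ∀ χ s → C (linear χ s)
      C-linear χ s = C-+ (C-* (μ d s) (C-weight (Vec.map not χ))) (C-* (μ d (s ℕ.+ 2)) (C-weight χ))

    -- Only the closure of `C` as a cone is used, so this is pure arithmetic in ℕ; `C` will be
    -- membership in the polar of the bounded ratios. The correction stands on the left to avoid
    -- subtraction.
    decomposition : ∀ β → ∣ β ∣ ≡ d ∸ 2 → ∃[ m ] C m ×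
      (∀ γ → ∣ γ ∣ ≡ 2 → m γ ℕ.+ 2 ℕ.* (ε d ℕ.* at β γ) ≡ 2 ℕ.* (μ d (s₂₃ (β ⊕ γ)) ℕ.+ μ d (s₃₄ (β ⊕ γ))))
    decomposition β ∣β∣≡d-2 with β ≟ (base d ⊕ v₁₃)
    ... | yes ≡.refl = m , C-+ (C-+ (C-linear χ₂₃ sA) (C-linear χ₃₄ sB)) (C-* (ε d) (C-+ (C-cut χ₂) (C-cut χ₄))) , correct
      where
      sA = s₂₃ β
      sB = s₃₄ β
      m : Vec ℕ 4 → ℕ
      m γ = linear χ₂₃ sA γ ℕ.+ linear χ₃₄ sB γ ℕ.+ ε d ℕ.* (cut χ₂ γ ℕ.+ cut χ₄ γ)
      correct : ∀ γ → ∣ γ ∣ ≡ 2 → m γ ℕ.+ 2 ℕ.* (ε d ℕ.* at β γ) ≡ 2 ℕ.* (μ d (s₂₃ (β ⊕ γ)) ℕ.+ μ d (s₃₄ (β ⊕ γ)))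
      correct γ ∣γ∣≡2 = begin
        lA ℕ.+ lB ℕ.+ ε d ℕ.* (cut χ₂ γ ℕ.+ cut χ₄ γ) ℕ.+ 2 ℕ.* (ε d ℕ.* at β γ)
          ≡⟨ ≡.cong (λ i → lA ℕ.+ lB ℕ.+ ε d ℕ.* (cut χ₂ γ ℕ.+ cut χ₄ γ) ℕ.+ 2 ℕ.* (ε d ℕ.* i)) (at-base v₁₃ γ) ⟩
        lA ℕ.+ lB ℕ.+ ε d ℕ.* (cut χ₂ γ ℕ.+ cut χ₄ γ) ℕ.+ 2 ℕ.* (ε d ℕ.* i)
          ≡⟨ solve 5 (λ lA lB ε c i → lA :+ lB :+ ε :* c :+ con 2 :* (ε :* i) := lA :+ lB :+ ε :* (c :+ con 2 :* i)) ≡.refl lA lB (ε d) (cut χ₂ γ ℕ.+ cut χ₄ γ) i ⟩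
        lA ℕ.+ lB ℕ.+ ε d ℕ.* (cut χ₂ γ ℕ.+ cut χ₄ γ ℕ.+ 2 ℕ.* i)
          ≡⟨ ≡.cong (λ c → lA ℕ.+ lB ℕ.+ ε d ℕ.* c) (quadratic-check (λ γ →
               cut χ₂ γ ℕ.+ cut χ₄ γ ℕ.+ 2 ℕ.* bit ⌊ (v₁₃ ⊕ v₁₃) ≟ (v₁₃ ⊕ γ) ⌋ ℕ.≟ cut χ₂₃ γ ℕ.+ cut χ₃₄ γ) γ ∣γ∣≡2) ⟩
        lA ℕ.+ lB ℕ.+ ε d ℕ.* (cut χ₂₃ γ ℕ.+ cut χ₃₄ γ)
          ≡⟨ solve 5 (λ lA lB ε c c′ → lA :+ lB :+ ε :* (c :+ c′) := lA :+ ε :* c :+ (lB :+ ε :* c′)) ≡.refl lA lB (ε d) (cut χ₂₃ γ) (cut χ₃₄ γ) ⟩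
        lA ℕ.+ ε d ℕ.* cut χ₂₃ γ ℕ.+ (lB ℕ.+ ε d ℕ.* cut χ₃₄ γ)
          -- For this β both s₂₃ and s₃₄ are b + 1, up to a trailing 0, so both cuts have
          -- coefficient ε_d and combine in the identity.
          ≡⟨ ≡.cong₂ (λ k k′ → lA ℕ.+ k ℕ.* cut χ₂₃ γ ℕ.+ (lB ℕ.+ k′ ℕ.* cut χ₃₄ γ)) κ[b+1]≡ε
               (≡.trans (≡.cong κ (ℕ.+-identityʳ (b ℕ.+ 1))) κ[b+1]≡ε) ⟨
        PairSum β γ
          ≡⟨ 2μ≡PairSum β γ ∣β∣≡d-2 ∣γ∣≡2 ⟨
        _ ∎
        where
        open +-*-Solver
        open ≡.≡-Reasoning
        lA = linear χ₂₃ sA γ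
        lB = linear χ₃₄ sB γ
        i = bit ⌊ (v₁₃ ⊕ v₁₃) ≟ (v₁₃ ⊕ γ) ⌋
    ... | no β≢β₁₃ with β ≟ (base d ⊕ v₃₃)
    ... | yes ≡.refl = m ,
        C-+ (C-+ (C-+ (C-+ (C-+ (C-* r (C-weight χ₁)) (C-* (r ℕ.+ ε d) (C-weight χ₄))) (C-* (ε d) (C-cut χ₁)))
          (C-* (μ d (sA ℕ.+ 2)) (C-weight χ₂₃))) (C-* (κ sA) (C-cut χ₂₃)))
          (C-+ (C-linear χ₃₄ sB) (C-* (κ sB) (C-cut χ₃₄))) , correct
      where
      sA = s₂₃ β
      sB = s₃₄ β
      -- Here s₂₃ β = b + 2, so γ₁ + γ₄ has coefficient μ_d(b + 2) = r + ε_d. The share ε_d γ₁ is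
      -- traded for ε_d cut{1}, which gives up 2ε_d exactly at γ = 2e₁.
      m : Vec ℕ 4 → ℕ
      m γ = r ℕ.* weight χ₁ γ ℕ.+ (r ℕ.+ ε d) ℕ.* weight χ₄ γ ℕ.+ ε d ℕ.* cut χ₁ γ ℕ.+ μ d (sA ℕ.+ 2) ℕ.* weight χ₂₃ γ ℕ.+ κ sA ℕ.* cut χ₂₃ γ
        ℕ.+ (linear χ₃₄ sB γ ℕ.+ κ sB ℕ.* cut χ₃₄ γ)
      correct : ∀ γ → ∣ γ ∣ ≡ 2 → m γ ℕ.+ 2 ℕ.* (ε d ℕ.* at β γ) ≡ 2 ℕ.* (μ d (s₂₃ (β ⊕ γ)) ℕ.+ μ d (s₃₄ (β ⊕ γ)))
      correct γ ∣γ∣≡2 = begin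
        m γ ℕ.+ 2 ℕ.* (ε d ℕ.* at β γ)
          ≡⟨ ≡.cong (λ i → m γ ℕ.+ 2 ℕ.* (ε d ℕ.* i)) (at-base v₃₃ γ) ⟩
        m γ ℕ.+ 2 ℕ.* (ε d ℕ.* i)
          ≡⟨ solve 9 (λ r ε w₁ w₄ c x k y i →
               r :* w₁ :+ (r :+ ε) :* w₄ :+ ε :* c :+ x :+ k :+ y :+ con 2 :* (ε :* i) :=
               r :* w₁ :+ (r :+ ε) :* w₄ :+ ε :* (con 2 :* i :+ c) :+ x :+ k :+ y) ≡.refl
               r (ε d) (weight χ₁ γ) (weight χ₄ γ) (cut χ₁ γ) X Y Z i ⟩
        r ℕ.* weight χ₁ γ ℕ.+ (r ℕ.+ ε d) ℕ.* weight χ₄ γ ℕ.+ ε d ℕ.* (2 ℕ.* i ℕ.+ cut χ₁ γ) ℕ.+ X ℕ.+ Y ℕ.+ Z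
          ≡⟨ ≡.cong (λ w → r ℕ.* weight χ₁ γ ℕ.+ (r ℕ.+ ε d) ℕ.* weight χ₄ γ ℕ.+ ε d ℕ.* w ℕ.+ X ℕ.+ Y ℕ.+ Z)
               (quadratic-check (λ γ → 2 ℕ.* bit ⌊ (v₁₃ ⊕ v₁₃) ≟ (v₃₃ ⊕ γ) ⌋ ℕ.+ cut χ₁ γ ℕ.≟ weight χ₁ γ) γ ∣γ∣≡2) ⟩
        r ℕ.* weight χ₁ γ ℕ.+ (r ℕ.+ ε d) ℕ.* weight χ₄ γ ℕ.+ ε d ℕ.* weight χ₁ γ ℕ.+ X ℕ.+ Y ℕ.+ Z
          ≡⟨ solve 7 (λ r ε w₁ w₄ x k y →
               r :* w₁ :+ (r :+ ε) :* w₄ :+ ε :* w₁ :+ x :+ k :+ y := (r :+ ε) :* (w₁ :+ w₄) :+ x :+ k :+ y) ≡.refl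
               r (ε d) (weight χ₁ γ) (weight χ₄ γ) X Y Z ⟩
        (r ℕ.+ ε d) ℕ.* (weight χ₁ γ ℕ.+ weight χ₄ γ) ℕ.+ X ℕ.+ Y ℕ.+ Z
          ≡⟨ ≡.cong₂ (λ k w → k ℕ.* w ℕ.+ X ℕ.+ Y ℕ.+ Z) (≡.sym μ[b+2]≡r+ε)
               (quadratic-check (λ γ → weight χ₁ γ ℕ.+ weight χ₄ γ ℕ.≟ weight (Vec.map not χ₂₃) γ) γ ∣γ∣≡2) ⟩
        PairSum β γ
          ≡⟨ 2μ≡PairSum β γ ∣β∣≡d-2 ∣γ∣≡2 ⟨
        _ ∎
        where
        open +-*-Solver
        open ≡.≡-Reasoning
        X = μ d (sA ℕ.+ 2) ℕ.* weight χ₂₃ γ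
        Y = κ sA ℕ.* cut χ₂₃ γ
        Z = linear χ₃₄ sB γ ℕ.+ κ sB ℕ.* cut χ₃₄ γ
        i = bit ⌊ (v₁₃ ⊕ v₁₃) ≟ (v₃₃ ⊕ γ) ⌋
    ... | no β≢β₃₃ with β ≟ (base d ⊕ v₁₁)
    ... | yes ≡.refl = m ,
        C-+ (C-+ (C-+ (C-* (μ d sA) (C-weight (Vec.map not χ₂₃)))
            (C-+ (C-+ (C-* r (C-weight χ₃)) (C-* (r ℕ.+ ε d) (C-weight χ₂))) (C-* (ε d) (C-cut χ₃))))
          (C-* (κ sA) (C-cut χ₂₃)))
          (C-+ (C-linear χ₃₄ sB) (C-* (κ sB) (C-cut χ₃₄))) , correct
      where
      sA = s₂₃ β
      sB = s₃₄ β
      -- Now s₂₃ β = b, so it is γ₂ + γ₃ that has coefficient μ_d(b + 2), and the share ε_d γ₃ is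
      -- traded for ε_d cut{3}.
      m : Vec ℕ 4 → ℕ
      m γ = μ d sA ℕ.* weight (Vec.map not χ₂₃) γ ℕ.+ (r ℕ.* weight χ₃ γ ℕ.+ (r ℕ.+ ε d) ℕ.* weight χ₂ γ ℕ.+ ε d ℕ.* cut χ₃ γ) ℕ.+ κ sA ℕ.* cut χ₂₃ γ
        ℕ.+ (linear χ₃₄ sB γ ℕ.+ κ sB ℕ.* cut χ₃₄ γ)
      correct : ∀ γ → ∣ γ ∣ ≡ 2 → m γ ℕ.+ 2 ℕ.* (ε d ℕ.* at β γ) ≡ 2 ℕ.* (μ d (s₂₃ (β ⊕ γ)) ℕ.+ μ d (s₃₄ (β ⊕ γ)))
      correct γ ∣γ∣≡2 = begin
        m γ ℕ.+ 2 ℕ.* (ε d ℕ.* at β γ)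
          ≡⟨ ≡.cong (λ i → m γ ℕ.+ 2 ℕ.* (ε d ℕ.* i)) (at-base v₁₁ γ) ⟩
        m γ ℕ.+ 2 ℕ.* (ε d ℕ.* i)
          ≡⟨ solve 9 (λ r ε w₃ w₂ c x k y i →
               x :+ (r :* w₃ :+ (r :+ ε) :* w₂ :+ ε :* c) :+ k :+ y :+ con 2 :* (ε :* i) :=
               x :+ (r :* w₃ :+ (r :+ ε) :* w₂ :+ ε :* (con 2 :* i :+ c)) :+ k :+ y) ≡.refl
               r (ε d) (weight χ₃ γ) (weight χ₂ γ) (cut χ₃ γ) X Y Z i ⟩
        X ℕ.+ (r ℕ.* weight χ₃ γ ℕ.+ (r ℕ.+ ε d) ℕ.* weight χ₂ γ ℕ.+ ε d ℕ.* (2 ℕ.* i ℕ.+ cut χ₃ γ)) ℕ.+ Y ℕ.+ Z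
          ≡⟨ ≡.cong (λ w → X ℕ.+ (r ℕ.* weight χ₃ γ ℕ.+ (r ℕ.+ ε d) ℕ.* weight χ₂ γ ℕ.+ ε d ℕ.* w) ℕ.+ Y ℕ.+ Z)
               (quadratic-check (λ γ → 2 ℕ.* bit ⌊ (v₁₃ ⊕ v₁₃) ≟ (v₁₁ ⊕ γ) ⌋ ℕ.+ cut χ₃ γ ℕ.≟ weight χ₃ γ) γ ∣γ∣≡2) ⟩
        X ℕ.+ (r ℕ.* weight χ₃ γ ℕ.+ (r ℕ.+ ε d) ℕ.* weight χ₂ γ ℕ.+ ε d ℕ.* weight χ₃ γ) ℕ.+ Y ℕ.+ Z
          ≡⟨ solve 7 (λ r ε w₃ w₂ x k y →
               x :+ (r :* w₃ :+ (r :+ ε) :* w₂ :+ ε :* w₃) :+ k :+ y := x :+ (r :+ ε) :* (w₂ :+ w₃) :+ k :+ y) ≡.refl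
               r (ε d) (weight χ₃ γ) (weight χ₂ γ) X Y Z ⟩
        X ℕ.+ (r ℕ.+ ε d) ℕ.* (weight χ₂ γ ℕ.+ weight χ₃ γ) ℕ.+ Y ℕ.+ Z
          ≡⟨ ≡.cong₂ (λ k w → X ℕ.+ k ℕ.* w ℕ.+ Y ℕ.+ Z)
               (≡.trans (≡.sym μ[b+2]≡r+ε) (≡.cong (λ k → μ d (k ℕ.+ 2)) (≡.sym (ℕ.+-identityʳ b))))
               (quadratic-check (λ γ → weight χ₂ γ ℕ.+ weight χ₃ γ ℕ.≟ weight χ₂₃ γ) γ ∣γ∣≡2) ⟩
        PairSum β γ
          ≡⟨ 2μ≡PairSum β γ ∣β∣≡d-2 ∣γ∣≡2 ⟨
        _ ∎
        where
        open +-*-Solver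
        open ≡.≡-Reasoning
        X = μ d sA ℕ.* weight (Vec.map not χ₂₃) γ
        Y = κ sA ℕ.* cut χ₂₃ γ
        Z = linear χ₃₄ sB γ ℕ.+ κ sB ℕ.* cut χ₃₄ γ
        i = bit ⌊ (v₁₃ ⊕ v₁₃) ≟ (v₁₁ ⊕ γ) ⌋
    ... | no β≢β₁₁ = PairSum β ,
        C-+ (C-+ (C-linear χ₂₃ (s₂₃ β)) (C-* (κ (s₂₃ β)) (C-cut χ₂₃)))
            (C-+ (C-linear χ₃₄ (s₃₄ β)) (C-* (κ (s₃₄ β)) (C-cut χ₃₄))) ,
        λ γ ∣γ∣≡2 → ≡.trans (≡.cong (λ i → PairSum β γ ℕ.+ 2 ℕ.* (ε d ℕ.* bit i)) (⌊≟⌋-≢ (off γ ∣γ∣≡2)))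
          (≡.trans (≡.cong (λ k → PairSum β γ ℕ.+ 2 ℕ.* k) (ℕ.*-zeroʳ (ε d)))
          (≡.trans (ℕ.+-identityʳ (PairSum β γ)) (≡.sym (2μ≡PairSum β γ ∣β∣≡d-2 ∣γ∣≡2))))
      where
      off : ∀ γ → ∣ γ ∣ ≡ 2 → α* d ≢ β ⊕ γ
      off γ ∣γ∣≡2 eq with base-cases β γ ∣γ∣≡2 eq
      ... | inj₁ p        = β≢β₁₁ p
      ... | inj₂ (inj₁ p) = β≢β₁₃ p
      ... | inj₂ (inj₂ p) = β≢β₃₃ p

-- q_d in the polar of the local cone

module Polarity (em : ExcludedMiddle 0ℓ) (R : CompleteOrderedField) {d : ℕ} (4≤d : 4 ≤ℕ d) where
  open OrderedField em R hiding (zero)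
  open Lorentzian R
  open Pairings em R
  open QuadraticFamilies em R
  open Decomposition em R 4≤d

  d-2+2≡d : d ∸ 2 ℕ.+ 2 ≡ d
  d-2+2≡d = ℕ.m∸n+n≡m (ℕ.≤-trans (ℕ.s≤s (ℕ.s≤s ℕ.z≤n)) 4≤d)

  localSubset-full : ∀ β → ∣ β ∣ ≡ d ∸ 2 → ∀ γ → ∣ γ ∣ ≡ 2 → γ ∈ localSubset (Δ 4 d) β
  localSubset-full β ∣β∣≡d-2 γ ∣γ∣≡2 with split-e⊕e γ ∣γ∣≡2
  ... | i , j , γ≡ = fromWitness
    {a? = Fin.any? λ i → Fin.any? λ j → (γ ≟ (e i ⊕ e j)) ×-dec T? (mem (Δ 4 d) (β ⊕ e i ⊕ e j))}
    (i , j , γ≡ , ℕ.≡⇒≡ᵇ ∣ β ⊕ e i ⊕ e j ∣ d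
      (≡.trans (∣⊕e⊕e∣ β i j) (≡.trans (≡.cong (ℕ._+ 2) ∣β∣≡d-2) d-2+2≡d)))

  ⊕-∈ : ∀ β γ → ∣ β ∣ ≡ d ∸ 2 → ∣ γ ∣ ≡ 2 → β ⊕ γ ∈ Δ 4 d
  ⊕-∈ β γ ∣β∣≡d-2 ∣γ∣≡2 = ℕ.≡⇒≡ᵇ ∣ β ⊕ γ ∣ d (≡.trans (∣⊕∣ β γ) (≡.trans (≡.cong₂ ℕ._+_ ∣β∣≡d-2 ∣γ∣≡2) d-2+2≡d))

  -- Twice the restriction of q_d to β + Δ₄² is the function m of `decomposition`, so the doubled
  -- sum is a nonpositive pairing.
  local-pairing : ∀ β → ∣ β ∣ ≡ d ∸ 2 → ∀ v → BR (localSubset (Δ 4 d) β) v →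
    ∑ (map (λ γ → v γ * q[ d ] (β ⊕ γ)) (elements (localSubset (Δ 4 d) β))) ≤ 0#
  local-pairing β ∣β∣≡d-2 v v∈BR = conclude (decomposition (Polarised S full)
      (polarised-weight S full) (polarised-cut S full) (λ {m} {m′} → polarised-+ S full {m} {m′}) (λ k {m} → polarised-* S full k {m}) β ∣β∣≡d-2)
    where
    S = localSubset (Δ 4 d) β
    full = localSubset-full β ∣β∣≡d-2
    indicator : ∀ b → (if b then 1# else 0#) ≈ fromℕ (bit b)
    indicator true  = ≈-sym (+-identityʳ 1#)
    indicator false = ≈-refl
    conclude : (∃[ m ] Polarised S full m ×
      (∀ γ → ∣ γ ∣ ≡ 2 → m γ ℕ.+ 2 ℕ.* (ε d ℕ.* at β γ) ≡ 2 ℕ.* (μ d (s₂₃ (β ⊕ γ)) ℕ.+ μ d (s₃₄ (β ⊕ γ))))) →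
      ∑ (map (λ γ → v γ * q[ d ] (β ⊕ γ)) (elements S)) ≤ 0#
    conclude (m , m-polarised , m≡) = *-cancelˡ-≤ (fromℕ 2) (fromℕ-pos 1) (≤-respʳ (≈-sym (zeroʳ (fromℕ 2)))
      (≤-respˡ (≈-trans (Sum.fold-cong (All.map (λ {γ} γ∈S → term γ (degree S γ γ∈S)) (elements-∈ S)))
        (∑-*-distribˡ (fromℕ 2) (λ γ → v γ * q[ d ] (β ⊕ γ)) (elements S))) (m-polarised v v∈BR)))
      where
      term : ∀ γ → ∣ γ ∣ ≡ 2 → v γ * fromℕ (m γ) ≈ fromℕ 2 * (v γ * q[ d ] (β ⊕ γ))
      term γ ∣γ∣≡2 = ≈-trans
        (≈-trans (*-congˡ m≈) (solve 4 (λ v μ ε i → v :* (con (+ 2) :* μ :- con (+ 2) :* (ε :* i)) := con (+ 2) :* (v :* (μ :- ε :* i)))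
          ≈-refl (v γ) (fromℕ μ+μ) (fromℕ (ε d)) (fromℕ (at β γ))))
        (*-congˡ (*-congˡ (+-congˡ (-‿cong (*-congˡ (≈-sym (indicator ⌊ α* d ≟ (β ⊕ γ) ⌋)))))))
        where
        μ+μ = μ d (s₂₃ (β ⊕ γ)) ℕ.+ μ d (s₃₄ (β ⊕ γ))
        m≈ : fromℕ (m γ) ≈ fromℕ 2 * fromℕ μ+μ - fromℕ 2 * (fromℕ (ε d) * fromℕ (at β γ))
        m≈ = ≈-trans (solve 2 (λ m i → m := m :+ i :- i) ≈-refl (fromℕ (m γ)) (fromℕ 2 * (fromℕ (ε d) * fromℕ (at β γ))))
          (+-congʳ (≈-trans (+-congˡ (≈-trans (*-congˡ (≈-sym (fromℕ-* (ε d) (at β γ)))) (≈-sym (fromℕ-* 2 (ε d ℕ.* at β γ)))))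
            (≈-trans (≈-sym (fromℕ-+ (m γ) (2 ℕ.* (ε d ℕ.* at β γ))))
            (≈-trans (≈-reflexive (≡.cong fromℕ (m≡ γ ∣γ∣≡2))) (fromℕ-* 2 μ+μ)))))

  -- Extension by zero is adjoint to restriction: pairing a generator with q_d is pairing v with q_d
  -- on β + Δ₄².
  generator-pairing : ∀ g → 𝓖 (Δ 4 d) g → inner (Δ 4 d) g q[ d ] ≤ 0#
  generator-pairing g (β , β∈Δ , _ , v , v∈BR , g≈) = ≤-respˡ (≈-sym (≈-trans
      (inner-congˡ (Δ 4 d) q[ d ] g≈)
      (inner-combination (Δ 4 d) v (β ⊕_) q[ d ] (elements S)
        (All.map (λ {γ} γ∈S → ⊕-∈ β γ ∣β∣≡d-2 (degree S γ γ∈S)) (elements-∈ S)))))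
    (local-pairing β ∣β∣≡d-2 v v∈BR)
    where
    S = localSubset (Δ 4 d) β
    ∣β∣≡d-2 : ∣ β ∣ ≡ d ∸ 2
    ∣β∣≡d-2 = ℕ.≡ᵇ⇒≡ ∣ β ∣ (d ∸ 2) β∈Δ

  inner-conic-≤0 : ∀ {n d} (S : Subset n d) q m (a : Fin m → Carrier) (g : Fin m → Family n) →
    (∀ k → 0# ≤ a k) → (∀ k → inner S (g k) q ≤ 0#) → inner S (λ α → sum (λ k → a k * g k α)) q ≤ 0#
  inner-conic-≤0 S q zero    a g 0≤a g≤0 = ≤-reflexive (inner-0 S q)
  inner-conic-≤0 S q (suc m) a g 0≤a g≤0 = ≤-respʳ (+-identityˡ 0#) (≤-respˡ
    (≈-sym (≈-trans (inner-+ S (λ α → a zero * g zero α) (λ α → sum (λ k → a (suc k) * g (suc k) α)) q) (+-congʳ (inner-* S (a zero) (g zero) q))))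
    (+-mono-≤ (≤-respʳ (zeroʳ (a zero)) (*-monoʳ-≤ (a zero) (0≤a zero) (g≤0 zero)))
      (inner-conic-≤0 S q m (a ∘ suc) (g ∘ suc) (0≤a ∘ suc) (g≤0 ∘ suc))))

  q∈Polar : Polar (Δ 4 d) (Cone (Δ 4 d) (𝓖 (Δ 4 d))) q[ d ]
  q∈Polar w (m , a , g , conic , w≈) = ≤-respˡ (≈-sym (inner-congˡ (Δ 4 d) q[ d ] w≈))
    (inner-conic-≤0 (Δ 4 d) q[ d ] m a g (proj₁ ∘ conic) (λ k → generator-pairing (g k) (proj₂ (conic k))))

theorem5p1 : ExcludedMiddle 0ℓ → (R : CompleteOrderedField) → (d : ℕ) → 4 ≤ℕ d →
    let open CompleteOrderedField R
        open Lorentzian R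
    in
    (BR (Δ 4 d) w[ d ] × ¬ Cone (Δ 4 d) (𝓖 (Δ 4 d)) w[ d ]) ×
    (∀ f → 𝓛⁺ (Δ 4 d) f → R[ d ] f ≤ fromℕ 64) ×
    (inner (Δ 4 d) w[ d ] q[ d ] ≈ fromℕ (ε d)) ×
    (0# < fromℕ (ε d)) ×
    Polar (Δ 4 d) (Cone (Δ 4 d) (𝓖 (Δ 4 d))) q[ d ]
theorem5p1 em R d 4≤d =
  (w∈BR 4≤d , w∉Cone) , R≤64 4≤d , inner-w-q 4≤d , 0<ε 4≤d , q∈Polar
  where
  open OrderedField em R
  open Lorentzian R
  open Pairings em R
  open Polarity em R 4≤d
  w∉Cone : ¬ Cone (Δ 4 d) (𝓖 (Δ 4 d)) w[ d ]
  w∉Cone w∈Cone = <⇒≱ (0<ε 4≤d) (≤-respˡ (inner-w-q 4≤d) (q∈Polar w[ d ] w∈Cone))
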